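{- Let $\mathcal{A},\mathcal{B}$ be subsets in $\mathbb{F}_q$. If $$|\mathcal{A}|\ge q^{\frac12+\epsilon}\quad\text{and}\quad |\mathcal{B}|\ge q^{1-\frac{2\epsilon}{3}}$$ for some $\epsilon\ge 0$, then the number of congruence classes of triangles determined by $\mathcal{A}\times\mathcal{B}\subseteq\mathbb{F}_q^2$ is at least $c\,q^3$ for some positive constant $c$.
   Context: $\mathbb{F}_q$ is the finite field of order $q$, where $q=p^r$ for some prime $p$ and positive integer $r$. $O(2,\mathbb{F}_q)$ denotes the orthogonal group in $\mathbb{F}_q^2$, i.e. the group of linear maps of $\mathbb{F}_q^2$ preserving the standard form $x_1^2+x_2^2$. A triangle ($2$-simplex) in $\mathbb{F}_q^2$ is given by its vertices $(\mathbf{x}_1,\mathbf{x}_2,\mathbf{x}_3)$ in $\mathbb{F}_q^2$. Two triangles with vertices $(\mathbf{x}_1,\mathbf{x}_2,\mathbf{x}_3)$ and $(\mathbf{y}_1,\mathbf{y}_2,\mathbf{y}_3)$ are in the same congruence class if there exist $\theta\in O(2,\mathbb{F}_q)$ and $\mathbf{z}\in\mathbb{F}_q^2$ with $\mathbf{z}+\theta(\mathbf{x}_i)=\mathbf{y}_i$ for $i=1,2,3$. The number of congruence classes of triangles determined by a set $\mathcal{E}\subseteq\mathbb{F}_q^2$ is the number of congruence classes containing a triangle all of whose vertices lie in $\mathcal{E}$.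
   Formalization: The prime p is assumed odd: for p = 2 the form is (x₁+x₂)² and even A = B = F_q determines only O(q²) congruence classes, so the claim as stated fails in characteristic 2. -}

module Defs where

open import Algebra.Bundles using (CommutativeRing)
open import Algebra.Module.Bundles using (LeftModule)
import Algebra.Properties.Group as GroupProperties
import Algebra.Module.Construct.DirectProduct as DirectProduct
import Algebra.Module.Construct.TensorUnit as TensorUnit
import Algebra.Module.Morphism.Construct.Composition as Composition
import Algebra.Module.Morphism.Construct.Identity as Identity
open import Algebra.Module.Morphism.Structures using (module LeftModuleMorphisms)
open import Data.Fin.Base using (Fin)
open import Data.Integer.Base using (ℤ; +_; -[1+_])
open import Data.Nat.Base as ℕ using (ℕ; suc)
open import Data.Product.Base using (Σ; ∃; ∃₂; _×_; _,_; proj₁; proj₂; swap)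
open import Data.Rational.Base as ℚ using (ℚ; ↥_; ↧ₙ_; 1/_)
import Data.Rational.Properties as ℚ
open import Data.Sum.Base as Sum using (_⊎_)
open import Function.Base using (id; _∘_)
open import Function.Bundles using (Inverse; _⇔_; mk⇔; Equivalence)
open import Level using (Level; 0ℓ; _⊔_) renaming (suc to lsuc)
open import Relation.Binary.Bundles using (Setoid)
open import Relation.Binary.Core using (Rel)
open import Relation.Binary.Definitions using (_Respects_)
open import Relation.Binary.PropositionalEquality as ≡ using (_≡_)
import Relation.Binary.Construct.On as On
open import Relation.Nullary.Negation.Core using (¬_)
open import Relation.Unary using (Pred; _⟨×⟩_)

-- Sizes are counted up to the equality of the setoid.
HasCardinality : ∀ {a ℓ} → Setoid a ℓ → ℕ → Set (a ⊔ ℓ)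
HasCardinality S n = Inverse S (≡.setoid (Fin n))

record Subset {a ℓ} (S : Setoid a ℓ) : Set (a ⊔ ℓ ⊔ lsuc 0ℓ) where
  open Setoid S
  field
    member   : Pred Carrier 0ℓ
    respects : member Respects _≈_

∣_∣≡_ : ∀ {a ℓ} {S : Setoid a ℓ} → Subset S → ℕ → Set (a ⊔ ℓ)
∣_∣≡_ {S = S} P n =
  HasCardinality (On.setoid {B = Σ Carrier member} S proj₁) n
  where
  open Setoid S
  open Subset P

-- Real numbers, as two-sided Dedekind cuts: `lower r` means r < x and
-- `upper r` means x < r.

record ℝ : Set₁ where
  field
    lower upper : Pred ℚ 0ℓ
    inhabitedˡ  : ∃ lower
    inhabitedᵘ  : ∃ upper
    roundedˡ    : ∀ r → lower r ⇔ ∃ λ s → r ℚ.< s × lower s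
    roundedᵘ    : ∀ r → upper r ⇔ ∃ λ s → s ℚ.< r × upper s
    disjoint    : ∀ r → ¬ (lower r × upper r)
    located     : ∀ {r s} → r ℚ.< s → lower r ⊎ upper s

open ℝ

-- The image of a cut under an increasing bijection f of ℚ with inverse g.
transport : (f g : ℚ → ℚ) →
            (∀ {r s} → r ℚ.< s → f r ℚ.< f s) →
            (∀ {r s} → r ℚ.< s → g r ℚ.< g s) →
            (∀ r → f (g r) ≡ r) → (∀ r → g (f r) ≡ r) → ℝ → ℝ
transport f g f-mono g-mono fg gf x = record
  { lower      = lower x ∘ g
  ; upper      = upper x ∘ g
  ; inhabitedˡ = let r , p = inhabitedˡ x in f r , back (lower x) p
  ; inhabitedᵘ = let r , p = inhabitedᵘ x in f r , back (upper x) p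
  ; roundedˡ   = λ r → mk⇔
      (λ p → let s , r<s , q = Equivalence.to (roundedˡ x (g r)) p
             in f s , ≡.subst (ℚ._< f s) (fg r) (f-mono r<s) , back (lower x) q)
      (λ (s , r<s , q) → Equivalence.from (roundedˡ x (g r)) (g s , g-mono r<s , q))
  ; roundedᵘ   = λ r → mk⇔
      (λ p → let s , s<r , q = Equivalence.to (roundedᵘ x (g r)) p
             in f s , ≡.subst (f s ℚ.<_) (fg r) (f-mono s<r) , back (upper x) q)
      (λ (s , s<r , q) → Equivalence.from (roundedᵘ x (g r)) (g s , g-mono s<r , q))
  ; disjoint   = disjoint x ∘ g
  ; located    = located x ∘ g-mono
  }
  where
  back : (P : Pred ℚ 0ℓ) → ∀ {r} → P r → P (g (f r))
  back P {r} = ≡.subst P (≡.sym (gf r))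

infix  4 _^ℝ_≤_
infix  8 -ℝ_
infixl 7 _*ℝ_
infixl 6 _+ℝ_

_+ℝ_ : ℚ → ℝ → ℝ
k +ℝ x = transport (k ℚ.+_) (ℚ.- k ℚ.+_) (ℚ.+-monoʳ-< k) (ℚ.+-monoʳ-< (ℚ.- k))
  (cancel k (ℚ.- k) (ℚ.+-inverseʳ k)) (cancel (ℚ.- k) k (ℚ.+-inverseˡ k)) x
  where
  cancel : ∀ a b → a ℚ.+ b ≡ ℚ.0ℚ → ∀ r → a ℚ.+ (b ℚ.+ r) ≡ r
  cancel a b eq r =
    ≡.trans (≡.sym (ℚ.+-assoc a b r)) (≡.trans (≡.cong (ℚ._+ r) eq) (ℚ.+-identityˡ r))

_*ℝ_ : (k : ℚ) .{{_ : ℚ.Positive k}} → ℝ → ℝ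
k *ℝ x = transport (k ℚ.*_) (1/k ℚ.*_) (ℚ.*-monoʳ-<-pos k) (ℚ.*-monoʳ-<-pos 1/k)
  (cancel k 1/k (ℚ.*-inverseʳ k)) (cancel 1/k k (ℚ.*-inverseˡ k)) x
  where
  instance _ = ℚ.pos⇒nonZero k
  1/k = 1/ k
  instance _ = ℚ.1/pos⇒pos k
  cancel : ∀ a b → a ℚ.* b ≡ ℚ.1ℚ → ∀ r → a ℚ.* (b ℚ.* r) ≡ r
  cancel a b eq r =
    ≡.trans (≡.sym (ℚ.*-assoc a b r)) (≡.trans (≡.cong (ℚ._* r) eq) (ℚ.*-identityˡ r))

-ℝ_ : ℝ → ℝ
-ℝ x = record
  { lower      = upper x ∘ ℚ.-_
  ; upper      = lower x ∘ ℚ.-_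
  ; inhabitedˡ = let r , p = inhabitedᵘ x in ℚ.- r , back (upper x) p
  ; inhabitedᵘ = let r , p = inhabitedˡ x in ℚ.- r , back (lower x) p
  ; roundedˡ   = λ r → mk⇔
      (λ p → let s , s<r , q = Equivalence.to (roundedᵘ x (ℚ.- r)) p
             in ℚ.- s , ≡.subst (ℚ._< ℚ.- s) (neg-involutive r) (ℚ.neg-antimono-< s<r) , back (upper x) q)
      (λ (s , r<s , q) → Equivalence.from (roundedᵘ x (ℚ.- r)) (ℚ.- s , ℚ.neg-antimono-< r<s , q))
  ; roundedᵘ   = λ r → mk⇔
      (λ p → let s , r<s , q = Equivalence.to (roundedˡ x (ℚ.- r)) p
             in ℚ.- s , ≡.subst (ℚ.- s ℚ.<_) (neg-involutive r) (ℚ.neg-antimono-< r<s) , back (lower x) q)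
      (λ (s , s<r , q) → Equivalence.from (roundedˡ x (ℚ.- r)) (ℚ.- s , ℚ.neg-antimono-< s<r , q))
  ; disjoint   = λ r → disjoint x (ℚ.- r) ∘ swap
  ; located    = Sum.swap ∘ located x ∘ ℚ.neg-antimono-<
  }
  where
  open GroupProperties ℚ.+-0-group using () renaming (⁻¹-involutive to neg-involutive)
  back : (P : Pred ℚ 0ℓ) → ∀ {r} → P r → P (ℚ.- (ℚ.- r))
  back P {r} = ≡.subst P (≡.sym (neg-involutive r))

NonNegative : ℝ → Set
NonNegative x = ¬ upper x ℚ.0ℚ

-- q ^ (n / d) ≤ m, for q ≥ 1 and d ≥ 1, cleared of the d-th root and of
-- negative exponents.
powerBound : ℕ → ℤ → ℕ → ℕ → Set
powerBound q (+ n)    d m = q ℕ.^ n ℕ.≤ m ℕ.^ d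
powerBound q -[1+ n ] d m = 1 ℕ.≤ q ℕ.^ suc n ℕ.* m ℕ.^ d

-- q ^ x ≤ m, for q ≥ 1: here q ^ x is the supremum of q ^ r over the
-- rationals r < x.
_^ℝ_≤_ : ℕ → ℝ → ℕ → Set
q ^ℝ x ≤ m = ∀ r → lower x r → powerBound q (↥ r) (↧ₙ r) m

record Field c ℓ : Set (lsuc (c ⊔ ℓ)) where
  field
    commutativeRing : CommutativeRing c ℓ
  open CommutativeRing commutativeRing public
  field
    0≉1     : ¬ 0# ≈ 1#
    inverse : ∀ x → ¬ x ≈ 0# → ∃ λ y → x * y ≈ 1#

module Plane (F : Field 0ℓ 0ℓ) where

  open Field F

  plane : LeftModule ring 0ℓ 0ℓ
  plane = DirectProduct.leftModule TensorUnit.leftModule TensorUnit.leftModule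

  open LeftModule plane using
    ( Carrierᴹ; _≈ᴹ_; _+ᴹ_; _*ₗ_; -ᴹ_; 0ᴹ; rawLeftModule; ≈ᴹ-setoid
    ; ≈ᴹ-refl; ≈ᴹ-sym; ≈ᴹ-trans
    ; +ᴹ-cong; +ᴹ-congˡ; +ᴹ-congʳ; +ᴹ-assoc; +ᴹ-identityˡ
    ; -ᴹ‿cong; -ᴹ‿inverseˡ; *ₗ-cong)
    public
  open LeftModuleMorphisms rawLeftModule rawLeftModule

  Point : Set
  Point = Carrierᴹ

  form : Point → Carrier
  form (x₁ , x₂) = x₁ * x₁ + x₂ * x₂

  -- `linear` includes invertibility: O₂ is a subgroup of GL₂(F).
  record O₂ : Set where
    field
      map       : Point → Point
      linear    : IsLeftModuleIsomorphism map
      preserves : ∀ x → form (map x) ≈ form x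
    open IsLeftModuleIsomorphism linear public

  Triangle : Set
  Triangle = Fin 3 → Point

  Congruent : Rel Triangle 0ℓ
  Congruent x y = ∃₂ λ (θ : O₂) (z : Point) → ∀ i → (z +ᴹ O₂.map θ (x i)) ≈ᴹ y i

  form-cong : ∀ {x y} → x ≈ᴹ y → form x ≈ form y
  form-cong (p , q) = +-cong (*-cong p p) (*-cong q q)

  idO : O₂
  idO = record
    { map       = id
    ; linear    = Identity.isLeftModuleIsomorphism rawLeftModule ≈ᴹ-refl
    ; preserves = λ _ → refl
    }

  infixr 9 _∘O_
  _∘O_ : O₂ → O₂ → O₂
  φ ∘O θ = record
    { map       = O₂.map φ ∘ O₂.map θ
    ; linear    = Composition.isLeftModuleIsomorphism ≈ᴹ-trans (O₂.linear θ) (O₂.linear φ)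
    ; preserves = λ x → trans (O₂.preserves φ _) (O₂.preserves θ x)
    }

  module Inv (θ : O₂) where
    open O₂ θ

    inv : Point → Point
    inv y = proj₁ (surjective y)

    map-inv : ∀ y → map (inv y) ≈ᴹ y
    map-inv y = proj₂ (surjective y) ≈ᴹ-refl

    inv-unique : ∀ {x y} → map x ≈ᴹ y → inv y ≈ᴹ x
    inv-unique {x} {y} p = injective (≈ᴹ-trans (map-inv y) (≈ᴹ-sym p))

    inv-cong : ∀ {x y} → x ≈ᴹ y → inv x ≈ᴹ inv y
    inv-cong {x} {y} p = inv-unique (≈ᴹ-trans (map-inv y) (≈ᴹ-sym p))

    inv-map : ∀ x → inv (map x) ≈ᴹ x
    inv-map x = inv-unique ≈ᴹ-refl

    inv-+ : ∀ x y → inv (x +ᴹ y) ≈ᴹ (inv x +ᴹ inv y)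
    inv-+ x y = inv-unique (≈ᴹ-trans (+ᴹ-homo _ _) (+ᴹ-cong (map-inv x) (map-inv y)))

    invO : O₂
    invO = record
      { map    = inv
      ; linear = record
        { isLeftModuleMonomorphism = record
          { isLeftModuleHomomorphism = record
            { +ᴹ-isGroupHomomorphism = record
              { isMonoidHomomorphism = record
                { isMagmaHomomorphism = record
                  { isRelHomomorphism = record { cong = inv-cong }
                  ; homo              = inv-+
                  }
                ; ε-homo = inv-unique 0ᴹ-homo
                }
              ; ⁻¹-homo = λ x → inv-unique (≈ᴹ-trans (-ᴹ-homo _) (-ᴹ‿cong (map-inv x)))
              }
            ; *ₗ-homo = λ k x → inv-unique (≈ᴹ-trans (*ₗ-homo k _) (*ₗ-cong refl (map-inv x)))
            }
          ; injective = λ {x} {y} p →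
              ≈ᴹ-trans (≈ᴹ-sym (map-inv x)) (≈ᴹ-trans (⟦⟧-cong p) (map-inv y))
          }
        ; surjective = λ x → map x , λ p → inv-unique (≈ᴹ-sym p)
        }
      ; preserves = λ x → trans (sym (preserves (inv x))) (form-cong (map-inv x))
      }

  congruent-refl : ∀ {x} → Congruent x x
  congruent-refl {x} = idO , 0ᴹ , λ i → +ᴹ-identityˡ (x i)

  congruent-sym : ∀ {x y} → Congruent x y → Congruent y x
  congruent-sym {x} {y} (θ , z , p) = invO , inv (-ᴹ z) , λ i →
    ≈ᴹ-trans (≈ᴹ-sym (inv-+ (-ᴹ z) (y i))) (inv-unique (≈ᴹ-sym
      (≈ᴹ-trans (+ᴹ-congˡ (≈ᴹ-sym (p i)))
      (≈ᴹ-trans (≈ᴹ-sym (+ᴹ-assoc (-ᴹ z) z _))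
      (≈ᴹ-trans (+ᴹ-congʳ (-ᴹ‿inverseˡ z)) (+ᴹ-identityˡ _))))))
    where open Inv θ

  congruent-trans : ∀ {x y w} → Congruent x y → Congruent y w → Congruent x w
  congruent-trans {x} {y} {w} (θ , z , p) (φ , z′ , p′) = φ ∘O θ , (z′ +ᴹ O₂.map φ z) , λ i →
    ≈ᴹ-trans (+ᴹ-assoc z′ _ _)
    (≈ᴹ-trans (+ᴹ-congˡ (≈ᴹ-trans (≈ᴹ-sym (O₂.+ᴹ-homo φ z _)) (O₂.⟦⟧-cong φ (p i)))) (p′ i))

  -- The equality of this setoid is congruence, so its elements are the
  -- congruence classes, and cardinalities of its subsets count classes.
  congruenceClasses : Setoid 0ℓ 0ℓ
  congruenceClasses = record
    { Carrier       = Triangle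
    ; _≈_           = Congruent
    ; isEquivalence = record
      { refl = congruent-refl ; sym = congruent-sym ; trans = congruent-trans }
    }

  determinedBy : Subset ≈ᴹ-setoid → Subset congruenceClasses
  determinedBy E = record
    { member   = λ x → ∃ λ t → (∀ i → Subset.member E (t i)) × Congruent t x
    ; respects = λ x≅y (t , t∈E , t≅x) → t , t∈E , congruent-trans t≅x x≅y
    }

  product : Subset setoid → Subset setoid → Subset ≈ᴹ-setoid
  product A B = record
    { member   = Subset.member A ⟨×⟩ Subset.member B
    ; respects = λ (p , q) (x∈A , y∈B) → Subset.respects A p x∈A , Subset.respects B q y∈B
    }

-- Write E = A × B. By Cauchy–Schwarz, |E|⁶ is at most the number of classes times the number of
-- congruent pairs of triangles in E, and this is at most the sum of ν(g)³ over the motions g of the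
-- plane, where ν(g) = #{u ∈ E : g u ∈ E}. There are at most 4 q³ motions, so the sum is O(|E|⁶ / q³)
-- provided that the deviation of ν from |E|² / q² is small in mean square.
--
-- A motion maps (x , y) to z + x w′ + y w with w on the unit circle and w′ = ± w rotated by a right
-- angle. Cauchy–Schwarz over x ∈ A reduces to the number of t ∈ B with z + t w ∈ E, that is, to the
-- incidences between E × B ⊆ F³ and the lines in the directions (w , 1), which are isotropic for
-- x² + y² - z². The mean square deviation of these incidences is governed by an operator whose norm
-- is bounded by duality: for weights φ_w of mean zero, the correlation of φ_w and φ_u only involves
-- sums along lines of direction w - u, the directions w - u (w fixed, u ≠ w) are pairwise
-- transversal as no line meets the circle in three points, and sums of a function of mean zero along
-- transversal directions are orthogonal. The total error is O(q |A|³ |B|²), which is admissible if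
-- q⁴ ≤ 2 |A|² |B|³, and this follows from the hypotheses by eliminating ε.

module Submission where

open import Defs
open import Algebra.Bundles using (CommutativeRing; RawRing)
open import Algebra.Module.Bundles using (LeftModule)
open import Algebra.Morphism.Structures using (IsRingMonomorphism)
import Algebra.Morphism.RingMonomorphism as RingMonomorphism
import Algebra.Properties.AbelianGroup
import Algebra.Properties.CommutativeMonoid.Sum
import Algebra.Properties.Group as GroupProperties
import Algebra.Properties.Monoid.Mult
import Algebra.Properties.Ring
import Algebra.Properties.Semiring.Mult.TCOptimised
import Algebra.Solver.Ring
open import Algebra.Solver.Ring.AlmostCommutativeRing using (fromCommutativeRing; _-Raw-AlmostCommutative⟶_)
open import Algebra.Structures using (IsCommutativeRing)
open import Data.Fin.Base using (Fin; zero; suc)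
import Data.Fin.Properties as Fin
open import Data.Integer.Base as ℤ using (ℤ; +_; -[1+_]; +[1+_]; 0ℤ; 1ℤ; +≤+)
import Data.Integer.Properties as ℤ
open import Data.Integer.Tactic.RingSolver using (solve-∀)
open import Data.List.Base using (List; []; _∷_; _++_; map; length; lookup; filter; concatMap; deduplicate; allFin; cartesianProduct)
import Data.List.Properties as List
open import Data.List.Membership.Propositional using (_∈_; lose; find)
open import Data.List.Membership.Propositional.Properties using (∈-∃++; ∈-lookup; ∈-map⁺; ∈-filter⁺; ∈-filter⁻; ∈-concatMap⁺; ∈-allFin; ∈-cartesianProduct⁺; ∈-cartesianProduct⁻)
open import Data.List.Membership.Propositional.Properties.WithK using (unique∧set⇒bag)
open import Data.List.Relation.Binary.BagAndSetEquality using (∼bag⇒↭)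
open import Data.List.Relation.Binary.Permutation.Propositional as ↭ using (_↭_)
open import Data.List.Relation.Binary.Permutation.Propositional.Properties using (shift; ∈-resp-↭)
open import Data.List.Relation.Unary.All as All using (All; []; _∷_)
import Data.List.Relation.Unary.All.Properties as All
open import Data.List.Relation.Unary.AllPairs as AllPairs using (AllPairs; []; _∷_)
import Data.List.Relation.Unary.AllPairs.Properties as AllPairs
open import Data.List.Relation.Unary.Any as Any using (Any; here; there)
import Data.List.Relation.Unary.Any.Properties as Any
import Data.List.Relation.Unary.Unique.DecSetoid.Properties as UniqueDecSetoid
open import Data.List.Relation.Unary.Unique.Propositional using (Unique)
import Data.List.Relation.Unary.Unique.Propositional.Properties as Unique
import Data.Maybe.Base as Maybe
open import Data.Nat.Base as ℕ using (ℕ; zero; suc)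
import Data.Nat.Properties as ℕ
open import Data.Nat.Divisibility using (_∣_; ∣1⇒≡1; m%n≡0⇒n∣m)
open import Data.Nat.DivMod using (_/_; _%_; m≡m%n+[m/n]*n; m%n<n)
open import Data.Nat.Primality using (Prime; euclidsLemma; prime⇒irreducible; prime⇒nonZero; prime[2])
import Data.Nat.Tactic.RingSolver as ℕSolver
open import Data.Product.Base using (Σ; ∃; _×_; _,_; proj₁; proj₂)
open import Data.Product.Properties using (≡-dec)
open import Data.Rational.Base as ℚ using (ℚ; mkℚ; ↥_; ↧ₙ_; 0ℚ; 1ℚ; ½; toℚᵘ; fromℚᵘ)
import Data.Rational.Properties as ℚ
open import Data.Rational.Unnormalised.Base as ℚᵘ using (ℚᵘ; mkℚᵘ; _≃_; *≡*; *<*; *≤*)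
import Data.Rational.Unnormalised.Properties as ℚᵘ
open import Data.Sum.Base using (inj₁; inj₂)
open import Function.Bundles using (Equivalence; Inverse; mk⇔; mk↔ₛ′)
open import Level using (Level; 0ℓ)
open import Relation.Binary.Bundles using (Setoid; DecSetoid)
import Relation.Binary.Construct.On as On
open import Relation.Binary.Definitions using (DecidableEquality)
open import Relation.Binary.PropositionalEquality as ≡ using (_≡_; _≢_; module ≡-Reasoning)
import Relation.Binary.Reasoning.Setoid
open import Relation.Nullary using (¬_; Dec; yes; no; contradiction)
open import Relation.Nullary.Decidable as Dec using (dec⇒maybe; ¬?)

-- The powers in |A|² |B|³ are those for which ε cancels: 2 (1/2 + ε) + 3 (1 - 2ε/3) = 4. Only
-- second moments of the deviation are available, so ν³ is bounded by 8 m³ + 4 ν (ν - m)² with m =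
-- |E|² / q², and the surplus factor ν by |E|. The error |E| · q |A|³ |B|² is then O(|E|⁶ / q³)
-- exactly when q⁴ = O(|A|² |B|³).
--
-- The deviation along lines is bounded in terms of itself: its square sum V equals, up to a power
-- of q, its sum over the incidences with E × B, and Cauchy-Schwarz with the operator bound gives V²
-- ≤ C V. Deviations are multiplied by q², so no characters and no fractions occur, only integers.
--
-- Odd characteristic enters through the circle: if 2 = 0, then x² + y² = (x + y)² and the circle is
-- a line, so its chords are all parallel. If -1 is a square, there are nonzero vectors of length 0,
-- but two distinct points of the circle never differ by one.

-- A ring solver with integer coefficients for any commutative ring

module IntegerCoefficients {c ℓ} (R : CommutativeRing c ℓ) where

  open CommutativeRing R
  open Algebra.Properties.Semiring.Mult.TCOptimised semiring using (×-homo-+; 1+×) renaming (_×_ to _×′_)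
  open Algebra.Properties.Ring ring using (-0#≈0#; -‿involutive; -‿distribˡ-*)
  open Algebra.Properties.AbelianGroup +-abelianGroup using (⁻¹-∙-comm)
  open Relation.Binary.Reasoning.Setoid setoid

  ⟦_⟧ : ℤ → Carrier
  ⟦ + n      ⟧ = n ×′ 1#
  ⟦ -[1+ n ] ⟧ = - (suc n ×′ 1#)

  ⟦⟧-⊖ : ∀ m n → ⟦ m ℤ.⊖ n ⟧ ≈ m ×′ 1# - n ×′ 1#
  ⟦⟧-⊖ zero    zero    = sym (-‿inverseʳ 0#)
  ⟦⟧-⊖ zero    (suc n) = sym (+-identityˡ _)
  ⟦⟧-⊖ (suc m) zero    = sym (trans (+-congˡ -0#≈0#) (+-identityʳ _))
  ⟦⟧-⊖ (suc m) (suc n) = begin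
    ⟦ suc m ℤ.⊖ suc n ⟧                    ≡⟨ ≡.cong ⟦_⟧ (ℤ.[1+m]⊖[1+n]≡m⊖n m n) ⟩
    ⟦ m ℤ.⊖ n ⟧                            ≈⟨ ⟦⟧-⊖ m n ⟩
    m ×′ 1# - n ×′ 1#                        ≈⟨ +-congʳ (+-identityʳ _) ⟨
    m ×′ 1# + 0# - n ×′ 1#                   ≈⟨ +-congʳ (+-congˡ (-‿inverseʳ 1#)) ⟨
    m ×′ 1# + (1# - 1#) - n ×′ 1#            ≈⟨ +-congʳ (+-assoc _ _ _) ⟨
    m ×′ 1# + 1# - 1# - n ×′ 1#              ≈⟨ +-assoc _ _ _ ⟩
    m ×′ 1# + 1# + (- 1# - n ×′ 1#)          ≈⟨ +-cong (+-comm _ _) (⁻¹-∙-comm _ _) ⟩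
    1# + m ×′ 1# - (1# + n ×′ 1#)            ≈⟨ +-cong (1+× m 1#) (-‿cong (1+× n 1#)) ⟨
    suc m ×′ 1# - suc n ×′ 1#                ∎

  +-homo : ∀ i j → ⟦ i ℤ.+ j ⟧ ≈ ⟦ i ⟧ + ⟦ j ⟧
  +-homo (+ m)    (+ n)    = ×-homo-+ 1# m n
  +-homo (+ m)    -[1+ n ] = ⟦⟧-⊖ m (suc n)
  +-homo -[1+ m ] (+ n)    = trans (⟦⟧-⊖ n (suc m)) (+-comm _ _)
  +-homo -[1+ m ] -[1+ n ] = begin
    - (suc (suc (m ℕ.+ n)) ×′ 1#)       ≡⟨ ≡.cong (λ k → - (k ×′ 1#)) (≡.cong suc (≡.sym (ℕ.+-suc m n))) ⟩
    - ((suc m ℕ.+ suc n) ×′ 1#)         ≈⟨ -‿cong (×-homo-+ 1# (suc m) (suc n)) ⟩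
    - (suc m ×′ 1# + suc n ×′ 1#)        ≈⟨ ⁻¹-∙-comm _ _ ⟨
    - (suc m ×′ 1#) + - (suc n ×′ 1#)    ∎

  -‿homo : ∀ i → ⟦ ℤ.- i ⟧ ≈ - ⟦ i ⟧
  -‿homo (+ zero)  = sym -0#≈0#
  -‿homo (+ suc n) = refl
  -‿homo -[1+ n ]  = sym (-‿involutive _)

  *-homo⁺ : ∀ n j → ⟦ + n ℤ.* j ⟧ ≈ ⟦ + n ⟧ * ⟦ j ⟧
  *-homo⁺ zero    j = sym (zeroˡ _)
  *-homo⁺ (suc n) j = begin
    ⟦ + suc n ℤ.* j ⟧                ≡⟨ ≡.cong ⟦_⟧ (ℤ.suc-* (+ n) j) ⟩
    ⟦ j ℤ.+ + n ℤ.* j ⟧              ≈⟨ +-homo j (+ n ℤ.* j) ⟩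
    ⟦ j ⟧ + ⟦ + n ℤ.* j ⟧            ≈⟨ +-cong (sym (*-identityˡ _)) (*-homo⁺ n j) ⟩
    1# * ⟦ j ⟧ + ⟦ + n ⟧ * ⟦ j ⟧     ≈⟨ distribʳ _ _ _ ⟨
    (1# + ⟦ + n ⟧) * ⟦ j ⟧           ≈⟨ *-congʳ (1+× n 1#) ⟨
    ⟦ + suc n ⟧ * ⟦ j ⟧              ∎

  *-homo : ∀ i j → ⟦ i ℤ.* j ⟧ ≈ ⟦ i ⟧ * ⟦ j ⟧
  *-homo (+ n)    j = *-homo⁺ n j
  *-homo -[1+ n ] j = begin
    ⟦ -[1+ n ] ℤ.* j ⟧               ≡⟨ ≡.cong ⟦_⟧ (ℤ.neg-distribˡ-* (+ suc n) j) ⟨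
    ⟦ ℤ.- (+ suc n ℤ.* j) ⟧          ≈⟨ -‿homo (+ suc n ℤ.* j) ⟩
    - ⟦ + suc n ℤ.* j ⟧              ≈⟨ -‿cong (*-homo⁺ (suc n) j) ⟩
    - (⟦ + suc n ⟧ * ⟦ j ⟧)          ≈⟨ -‿distribˡ-* _ _ ⟩
    - ⟦ + suc n ⟧ * ⟦ j ⟧            ∎

  morphism : CommutativeRing.rawRing ℤ.+-*-commutativeRing -Raw-AlmostCommutative⟶ fromCommutativeRing R
  morphism = record
    { ⟦_⟧    = ⟦_⟧
    ; +-homo = +-homo
    ; *-homo = *-homo
    ; -‿homo = -‿homo
    ; 0-homo = refl
    ; 1-homo = refl
    }

  module Solver = Algebra.Solver.Ring _ _ morphism
    (λ i j → Maybe.map (λ eq → reflexive (≡.cong ⟦_⟧ eq)) (dec⇒maybe (i ℤ.≟ j)))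

open ≡ using (refl; sym; trans; cong; cong₂; subst)

-- The exponents

^-distribʳ-* : ∀ m n k → (m ℕ.* n) ℕ.^ k ≡ m ℕ.^ k ℕ.* n ℕ.^ k
^-distribʳ-* m n zero    = refl
^-distribʳ-* m n (suc k) = trans (cong (m ℕ.* n ℕ.*_) (^-distribʳ-* m n k)) (lem m n (m ℕ.^ k) (n ℕ.^ k))
  where
  lem : ∀ a b c d → a ℕ.* b ℕ.* (c ℕ.* d) ≡ a ℕ.* c ℕ.* (b ℕ.* d)
  lem = ℕSolver.solve-∀

^-cancelˡ-≤ : ∀ d .{{_ : ℕ.NonZero d}} {m n} → m ℕ.^ d ℕ.≤ n ℕ.^ d → m ℕ.≤ n
^-cancelˡ-≤ d md≤nd = ℕ.≮⇒≥ λ n<m → ℕ.<⇒≱ (ℕ.^-monoˡ-< d n<m) md≤nd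

n≤2^n : ∀ n → n ℕ.≤ 2 ℕ.^ n
n≤2^n zero    = ℕ.z≤n
n≤2^n (suc n) = ℕ.≤-trans (ℕ.+-mono-≤ (ℕ.m^n>0 2 n) (n≤2^n n)) (ℕ.+-monoʳ-≤ (2 ℕ.^ n) (ℕ.m≤m+n (2 ℕ.^ n) 0))

power-swap : ∀ q i d → (q ℕ.^ i) ℕ.^ d ≡ (q ℕ.^ d) ℕ.^ i
power-swap q i d = trans (ℕ.^-*-assoc q i d) (trans (cong (q ℕ.^_) (ℕ.*-comm i d)) (sym (ℕ.^-*-assoc q d i)))

-- n / d = (i - j) / D, with natural numbers i and j.
powerBound⇒≤ : ∀ q n d D {m i j} .{{_ : ℕ.NonZero d}} → powerBound q n d m → n ℤ.* + D ≡ (+ i ℤ.- + j) ℤ.* + d →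
  q ℕ.^ i ℕ.≤ q ℕ.^ j ℕ.* m ℕ.^ D
-- The hypothesis concerns m ^ d, so both sides are compared after raising them to the power d;
-- there the equation between the fractions becomes an equation between exponents of q.
powerBound⇒≤ q (+ n) d D {m} {i} {j} qⁿ≤mᵈ eq = ^-cancelˡ-≤ d (begin
  (q ℕ.^ i) ℕ.^ d                          ≡⟨ ℕ.^-*-assoc q i d ⟩
  q ℕ.^ (i ℕ.* d)                        ≡⟨ cong (q ℕ.^_) exponents ⟩
  q ℕ.^ (n ℕ.* D ℕ.+ j ℕ.* d)            ≡⟨ ℕ.^-distribˡ-+-* q (n ℕ.* D) (j ℕ.* d) ⟩
  q ℕ.^ (n ℕ.* D) ℕ.* q ℕ.^ (j ℕ.* d)      ≡⟨ cong₂ ℕ._*_ (ℕ.^-*-assoc q n D) (ℕ.^-*-assoc q j d) ⟨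
  (q ℕ.^ n) ℕ.^ D ℕ.* (q ℕ.^ j) ℕ.^ d          ≤⟨ ℕ.*-monoˡ-≤ ((q ℕ.^ j) ℕ.^ d) (ℕ.^-monoˡ-≤ D qⁿ≤mᵈ) ⟩
  (m ℕ.^ d) ℕ.^ D ℕ.* (q ℕ.^ j) ℕ.^ d          ≡⟨ cong (ℕ._* (q ℕ.^ j) ℕ.^ d) (power-swap m d D) ⟩
  (m ℕ.^ D) ℕ.^ d ℕ.* (q ℕ.^ j) ℕ.^ d          ≡⟨ ℕ.*-comm ((m ℕ.^ D) ℕ.^ d) _ ⟩
  (q ℕ.^ j) ℕ.^ d ℕ.* (m ℕ.^ D) ℕ.^ d          ≡⟨ ^-distribʳ-* (q ℕ.^ j) (m ℕ.^ D) d ⟨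
  (q ℕ.^ j ℕ.* m ℕ.^ D) ℕ.^ d                ∎)
  where
  open ℕ.≤-Reasoning
  lem : ∀ i j d → i ℤ.* d ≡ (i ℤ.- j) ℤ.* d ℤ.+ j ℤ.* d
  lem = solve-∀
  exponents : i ℕ.* d ≡ n ℕ.* D ℕ.+ j ℕ.* d
  exponents = ℤ.+-injective (trans (ℤ.pos-* i d) (trans (lem (+ i) (+ j) (+ d))
    (trans (cong₂ ℤ._+_ (sym eq) (sym (ℤ.pos-* j d))) (cong (ℤ._+ + (j ℕ.* d)) (sym (ℤ.pos-* n D))))))
powerBound⇒≤ q -[1+ n ] d D {m} {i} {j} 1≤qm eq = ^-cancelˡ-≤ d (begin
  (q ℕ.^ i) ℕ.^ d                                        ≡⟨ ℕ.*-identityʳ _ ⟨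
  (q ℕ.^ i) ℕ.^ d ℕ.* 1                                  ≡⟨ cong ((q ℕ.^ i) ℕ.^ d ℕ.*_) (ℕ.^-zeroˡ D) ⟨
  (q ℕ.^ i) ℕ.^ d ℕ.* 1 ℕ.^ D                              ≤⟨ ℕ.*-monoʳ-≤ ((q ℕ.^ i) ℕ.^ d) (ℕ.^-monoˡ-≤ D 1≤qm) ⟩
  (q ℕ.^ i) ℕ.^ d ℕ.* (q ℕ.^ suc n ℕ.* m ℕ.^ d) ℕ.^ D          ≡⟨ cong₂ ℕ._*_ (ℕ.^-*-assoc q i d) (^-distribʳ-* (q ℕ.^ suc n) (m ℕ.^ d) D) ⟩
  q ℕ.^ (i ℕ.* d) ℕ.* ((q ℕ.^ suc n) ℕ.^ D ℕ.* (m ℕ.^ d) ℕ.^ D) ≡⟨ ℕ.*-assoc (q ℕ.^ (i ℕ.* d)) _ _ ⟨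
  q ℕ.^ (i ℕ.* d) ℕ.* (q ℕ.^ suc n) ℕ.^ D ℕ.* (m ℕ.^ d) ℕ.^ D  ≡⟨ cong₂ ℕ._*_ (cong (q ℕ.^ (i ℕ.* d) ℕ.*_) (ℕ.^-*-assoc q (suc n) D)) (power-swap m d D) ⟩
  q ℕ.^ (i ℕ.* d) ℕ.* q ℕ.^ (suc n ℕ.* D) ℕ.* (m ℕ.^ D) ℕ.^ d ≡⟨ cong (ℕ._* (m ℕ.^ D) ℕ.^ d) (ℕ.^-distribˡ-+-* q (i ℕ.* d) (suc n ℕ.* D)) ⟨
  q ℕ.^ (i ℕ.* d ℕ.+ suc n ℕ.* D) ℕ.* (m ℕ.^ D) ℕ.^ d      ≡⟨ cong (λ e → q ℕ.^ e ℕ.* (m ℕ.^ D) ℕ.^ d) exponents ⟩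
  q ℕ.^ (j ℕ.* d) ℕ.* (m ℕ.^ D) ℕ.^ d                      ≡⟨ cong (ℕ._* (m ℕ.^ D) ℕ.^ d) (ℕ.^-*-assoc q j d) ⟨
  (q ℕ.^ j) ℕ.^ d ℕ.* (m ℕ.^ D) ℕ.^ d                        ≡⟨ ^-distribʳ-* (q ℕ.^ j) (m ℕ.^ D) d ⟨
  (q ℕ.^ j ℕ.* m ℕ.^ D) ℕ.^ d                              ∎)
  where
  open ℕ.≤-Reasoning
  lem : ∀ i j d n → i ℤ.* d ℤ.+ n ≡ j ℤ.* d ℤ.+ ((i ℤ.- j) ℤ.* d ℤ.+ n)
  lem = solve-∀
  cancel : (+ i ℤ.- + j) ℤ.* + d ℤ.+ + (suc n ℕ.* D) ≡ + 0
  cancel = trans (cong₂ ℤ._+_ (trans (sym eq) (sym (ℤ.neg-distribˡ-* (+ suc n) (+ D)))) (ℤ.pos-* (suc n) D)) (ℤ.+-inverseˡ (+ suc n ℤ.* + D))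
  exponents : i ℕ.* d ℕ.+ suc n ℕ.* D ≡ j ℕ.* d
  exponents = ℤ.+-injective (trans (ℤ.pos-+ (i ℕ.* d) _) (trans (cong (ℤ._+ + (suc n ℕ.* D)) (ℤ.pos-* i d))
    (trans (lem (+ i) (+ j) (+ d) (+ (suc n ℕ.* D))) (trans (cong (ℤ._+_ (+ j ℤ.* + d)) cancel) (trans (ℤ.+-identityʳ _) (sym (ℤ.pos-* j d)))))))

-- A cut is queried at rationals in lowest terms, whereas sums and multiples of grid points come as
-- unreduced fractions; this passes from the one to the other. The denominator of `mkℚᵘ` is stored
-- minus one, hence the exponent `suc D`.
powerBound-≃ : ∀ q (r : ℚ) {m} i j D → powerBound q (↥ r) (↧ₙ r) m → toℚᵘ r ≃ mkℚᵘ (+ i ℤ.- + j) D →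
  q ℕ.^ i ℕ.≤ q ℕ.^ j ℕ.* m ℕ.^ suc D
powerBound-≃ q r@(mkℚ n d _) i j D bound (*≡* eq) = powerBound⇒≤ q n (suc d) (suc D) {i = i} {j} bound eq

open GroupProperties ℚ.+-0-group using () renaming (⁻¹-involutive to neg-involutive)

-- Approximating a Dedekind cut by a rational grid

module Cuts (x : ℝ) where
  open ℝ x

  lower-< : ∀ {r s} → r ℚ.< s → lower s → lower r
  lower-< {r} {s} r<s l = Equivalence.from (roundedˡ r) (s , r<s , l)

  upper-< : ∀ {r s} → r ℚ.< s → upper r → upper s
  upper-< {r} {s} r<s u = Equivalence.from (roundedᵘ s) (r , r<s , u)

  -- Starting the grid at - y / (m + 1) keeps its indices natural.
  module Grid (m y : ℕ) where

    gridᵘ : ℕ → ℚᵘ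
    gridᵘ k = mkℚᵘ (+ k ℤ.- + y) m

    grid : ℕ → ℚ
    grid k = fromℚᵘ (gridᵘ k)

    toℚᵘ-grid : ∀ k → toℚᵘ (grid k) ≃ gridᵘ k
    toℚᵘ-grid k = ℚ.toℚᵘ-fromℚᵘ (gridᵘ k)

    grid-< : ∀ {k l} → k ℕ.< l → grid k ℚ.< grid l
    grid-< {k} {l} k<l = ℚ.toℚᵘ-cancel-< (ℚᵘ.<-respˡ-≃ (ℚᵘ.≃-sym (toℚᵘ-grid k)) (ℚᵘ.<-respʳ-≃ (ℚᵘ.≃-sym (toℚᵘ-grid l))
      (*<* (ℤ.*-monoʳ-<-pos (+ suc m) (ℤ.+-monoˡ-< (ℤ.- + y) (ℤ.+<+ k<l))))))

    -- Locatedness decides only between two distinct rationals, so a step of the walk compares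
    -- `suc k` with `suc (suc k)` and the enclosure is two meshes wide. The walk ends because after
    -- `n` steps the same grid point would lie on both sides of the cut.
    straddle : ∀ n k → lower (grid k) → upper (grid (n ℕ.+ k)) → ∃ λ l → lower (grid l) × upper (grid (2 ℕ.+ l))
    straddle zero    k lo up = contradiction (lo , up) (disjoint (grid k))
    straddle (suc n) k lo up with located (grid-< (ℕ.n<1+n (suc k)))
    ... | inj₁ lo′ = straddle n (suc k) lo′ (subst (λ i → upper (grid i)) (sym (ℕ.+-suc n k)) up)
    ... | inj₂ up′ = k , lo , up′

  straddled : ∀ m → ∃ λ y → ∃ λ l → lower (Grid.grid m y l) × upper (Grid.grid m y (2 ℕ.+ l))
  straddled m with inhabitedˡ | inhabitedᵘ
  ... | mkℚ n₀ d₀ c₀ , lo | mkℚ n₁ d₁ c₁ , up = y , straddle k 0 (lower-< below lo) (subst (λ i → upper (grid i)) (sym (ℕ.+-identityʳ k)) (upper-< above up))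
    where
    -- The grid runs from -(|n₀| + 1) to |n₁| + 1, which enclose the two witnesses because a
    -- fraction is bounded by the absolute value of its numerator.
    y k : ℕ
    y = suc ℤ.∣ n₀ ∣ ℕ.* suc m
    k = y ℕ.+ suc ℤ.∣ n₁ ∣ ℕ.* suc m
    open Grid m y
    -∣∣≤ : ∀ i → ℤ.- + ℤ.∣ i ∣ ℤ.≤ i
    -∣∣≤ (+ zero)  = ℤ.≤-refl
    -∣∣≤ (+ suc n) = ℤ.-≤+
    -∣∣≤ -[1+ n ]  = ℤ.≤-refl
    ≤∣∣ : ∀ i → i ℤ.≤ + ℤ.∣ i ∣
    ≤∣∣ (+ n)     = ℤ.≤-refl
    ≤∣∣ -[1+ n ]  = ℤ.-≤+
    s*M<[1+s]*M : ∀ s → s ℕ.* suc m ℕ.< suc s ℕ.* suc m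
    s*M<[1+s]*M s = ℕ.m<n+m (s ℕ.* suc m) ℕ.z<s
    below : grid 0 ℚ.< mkℚ n₀ d₀ c₀
    below = ℚ.toℚᵘ-cancel-< (ℚᵘ.<-respˡ-≃ (ℚᵘ.≃-sym (toℚᵘ-grid 0)) (*<* (begin-strict
      (+ 0 ℤ.- + y) ℤ.* + suc d₀     ≡⟨ cong (ℤ._* + suc d₀) (ℤ.+-identityˡ (ℤ.- + y)) ⟩
      ℤ.- + y ℤ.* + suc d₀           ≡⟨ ℤ.neg-distribˡ-* (+ y) (+ suc d₀) ⟨
      ℤ.- (+ y ℤ.* + suc d₀)         ≡⟨ cong ℤ.-_ (ℤ.pos-* y (suc d₀)) ⟨
      ℤ.- + (y ℕ.* suc d₀)           ≤⟨ ℤ.neg-mono-≤ (ℤ.+≤+ (ℕ.m≤m*n y (suc d₀))) ⟩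
      ℤ.- + y                        <⟨ ℤ.neg-mono-< (ℤ.+<+ (s*M<[1+s]*M ℤ.∣ n₀ ∣)) ⟩
      ℤ.- + (ℤ.∣ n₀ ∣ ℕ.* suc m)     ≡⟨ trans (cong ℤ.-_ (ℤ.pos-* ℤ.∣ n₀ ∣ (suc m))) (ℤ.neg-distribˡ-* (+ ℤ.∣ n₀ ∣) (+ suc m)) ⟩
      ℤ.- + ℤ.∣ n₀ ∣ ℤ.* + suc m     ≤⟨ ℤ.*-monoʳ-≤-nonNeg (+ suc m) (-∣∣≤ n₀) ⟩
      n₀ ℤ.* + suc m                 ∎)))
      where open ℤ.≤-Reasoning
    above : mkℚ n₁ d₁ c₁ ℚ.< grid k
    above = ℚ.toℚᵘ-cancel-< (ℚᵘ.<-respʳ-≃ (ℚᵘ.≃-sym (toℚᵘ-grid k)) (*<* (begin-strict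
      n₁ ℤ.* + suc m                          ≤⟨ ℤ.*-monoʳ-≤-nonNeg (+ suc m) (≤∣∣ n₁) ⟩
      + ℤ.∣ n₁ ∣ ℤ.* + suc m                  ≡⟨ ℤ.pos-* ℤ.∣ n₁ ∣ (suc m) ⟨
      + (ℤ.∣ n₁ ∣ ℕ.* suc m)                  <⟨ ℤ.+<+ (s*M<[1+s]*M ℤ.∣ n₁ ∣) ⟩
      + z                                     ≤⟨ ℤ.+≤+ (ℕ.m≤m*n z (suc d₁)) ⟩
      + (z ℕ.* suc d₁)                        ≡⟨ ℤ.pos-* z (suc d₁) ⟩
      + z ℤ.* + suc d₁                        ≡⟨ cong (ℤ._* + suc d₁) (lem (+ y) (+ z)) ⟩
      (+ y ℤ.+ + z ℤ.- + y) ℤ.* + suc d₁      ≡⟨ cong (λ i → (i ℤ.- + y) ℤ.* + suc d₁) (ℤ.pos-+ y z) ⟨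
      (+ k ℤ.- + y) ℤ.* + suc d₁              ∎)))
      where
      open ℤ.≤-Reasoning
      z : ℕ
      z = suc ℤ.∣ n₁ ∣ ℕ.* suc m
      lem : ∀ y z → z ≡ y ℤ.+ z ℤ.- y
      lem = solve-∀

⅔ : ℚ
⅔ = + 2 ℚ./ 3

-- With mesh 1 / M the hypotheses lose a factor q ^ 4 in the M-th power of the conclusion;
-- the factor 2 absorbs it as soon as q ^ 4 ≤ 2 ^ M, and M = 4 q will do.
exponents-bound : ∀ q a b (ε : ℝ) → 1 ℕ.≤ q → q ^ℝ (½ +ℝ ε) ≤ a → q ^ℝ (1ℚ +ℝ -ℝ (⅔ *ℝ ε)) ≤ b →
  q ℕ.^ 4 ℕ.≤ 2 ℕ.* (a ℕ.^ 2 ℕ.* b ℕ.^ 3)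
exponents-bound q@(suc q-1) a b ε _ q^≤a q^≤b
  with y , x , lo , up ← Cuts.straddled ε (q-1 ℕ.+ 3 ℕ.* q) = ^-cancelˡ-≤ M (begin
    (q ℕ.^ 4) ℕ.^ M                                           ≡⟨ ℕ.^-*-assoc q 4 M ⟩
    q ℕ.^ (4 ℕ.* M)                                         ≤⟨ ℕ.*-cancelˡ-≤ (q ℕ.^ e) {{ℕ.m^n≢0 q e}} cancelled ⟩
    q ℕ.^ 4 ℕ.* (a ℕ.^ 2 ℕ.* b ℕ.^ 3) ℕ.^ M                       ≤⟨ ℕ.*-monoˡ-≤ ((a ℕ.^ 2 ℕ.* b ℕ.^ 3) ℕ.^ M) q⁴≤2ᴹ ⟩
    2 ℕ.^ M ℕ.* (a ℕ.^ 2 ℕ.* b ℕ.^ 3) ℕ.^ M                       ≡⟨ ^-distribʳ-* 2 (a ℕ.^ 2 ℕ.* b ℕ.^ 3) M ⟨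
    (2 ℕ.* (a ℕ.^ 2 ℕ.* b ℕ.^ 3)) ℕ.^ M                         ∎)
  where
  open ℕ.≤-Reasoning
  m M e : ℕ
  -- One less than 4 q, since denominators are stored minus one.
  m = q-1 ℕ.+ 3 ℕ.* q
  M = suc m
  e = 2 ℕ.* x ℕ.+ 2 ℕ.* y
  open Cuts.Grid ε m y

  q⁴≤2ᴹ : q ℕ.^ 4 ℕ.≤ 2 ℕ.^ M
  q⁴≤2ᴹ = ℕ.≤-trans (ℕ.^-monoˡ-≤ 4 (n≤2^n q)) (ℕ.≤-reflexive (trans (ℕ.^-*-assoc 2 q 4) (cong (2 ℕ.^_) (ℕ.*-comm q 4))))

  -- The exponent 1/2 + (x - y)/M is (M + 2 x - 2 y) / (2 M), and the lower grid point lies below ε.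
  bound-a : q ℕ.^ (M ℕ.+ 2 ℕ.* x) ℕ.≤ q ℕ.^ (2 ℕ.* y) ℕ.* a ℕ.^ (2 ℕ.* M)
  bound-a = powerBound-≃ q (½ ℚ.+ grid x) (M ℕ.+ 2 ℕ.* x) (2 ℕ.* y) (m ℕ.+ (M ℕ.+ 0))
    (q^≤a (½ ℚ.+ grid x) (subst (ℝ.lower ε) (sym eq) lo))
    (ℚᵘ.≃-trans (ℚ.toℚᵘ-homo-+ ½ (grid x)) (ℚᵘ.≃-trans (ℚᵘ.+-congʳ (toℚᵘ ½) (toℚᵘ-grid x))
      (*≡* (cong (ℤ._* + (2 ℕ.* M)) numerator))))
    where
    lem : ∀ M x y → + 1 ℤ.* M ℤ.+ (x ℤ.- y) ℤ.* + 2 ≡ M ℤ.+ + 2 ℤ.* x ℤ.- + 2 ℤ.* y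
    lem = solve-∀
    numerator : + 1 ℤ.* + M ℤ.+ (+ x ℤ.- + y) ℤ.* + 2 ≡ + (M ℕ.+ 2 ℕ.* x) ℤ.- + (2 ℕ.* y)
    numerator = trans (lem (+ M) (+ x) (+ y)) (sym (cong₂ ℤ._-_
      (trans (ℤ.pos-+ M (2 ℕ.* x)) (cong (ℤ._+_ (+ M)) (ℤ.pos-* 2 x))) (ℤ.pos-* 2 y)))
    eq : ℚ.- ½ ℚ.+ (½ ℚ.+ grid x) ≡ grid x
    eq = trans (sym (ℚ.+-assoc (ℚ.- ½) ½ (grid x))) (ℚ.+-identityˡ (grid x))

  -- Here ε occurs with a negative sign, so the upper grid point `2 + x` is needed. Its distance of
  -- two meshes from the lower one, times 2/3, is the 4 in the numerator over 3 M.
  bound-b : q ℕ.^ (3 ℕ.* M ℕ.+ 2 ℕ.* y) ℕ.≤ q ℕ.^ (2 ℕ.* x ℕ.+ 4) ℕ.* b ℕ.^ (3 ℕ.* M)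
  bound-b = powerBound-≃ q s (3 ℕ.* M ℕ.+ 2 ℕ.* y) (2 ℕ.* x ℕ.+ 4) (m ℕ.+ (M ℕ.+ (M ℕ.+ 0)))
    (q^≤b s (subst (ℝ.upper ε) (sym eq) up))
    (ℚᵘ.≃-trans (ℚ.toℚᵘ-homo-+ 1ℚ (ℚ.- (⅔ ℚ.* g))) (ℚᵘ.≃-trans (ℚᵘ.+-congʳ (toℚᵘ 1ℚ)
        (ℚᵘ.≃-trans (ℚ.toℚᵘ-homo‿- (⅔ ℚ.* g)) (ℚᵘ.-‿cong (ℚᵘ.≃-trans (ℚ.toℚᵘ-homo-* ⅔ g) (ℚᵘ.*-congˡ {toℚᵘ ⅔} (toℚᵘ-grid (2 ℕ.+ x)))))))
      (*≡* (cong₂ ℤ._*_ numerator (cong +_ (sym (ℕ.+-identityʳ (3 ℕ.* M))))))))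
    where
    lem : ∀ M x y → + 1 ℤ.* (+ 3 ℤ.* M) ℤ.+ (ℤ.- (+ 2 ℤ.* (x ℤ.- y))) ℤ.* + 1 ≡ + 3 ℤ.* M ℤ.+ + 2 ℤ.* y ℤ.- + 2 ℤ.* x
    lem = solve-∀
    lem′ : ∀ M x y → + 3 ℤ.* M ℤ.+ + 2 ℤ.* y ℤ.- + 2 ℤ.* (+ 2 ℤ.+ x) ≡ + 3 ℤ.* M ℤ.+ + 2 ℤ.* y ℤ.- (+ 2 ℤ.* x ℤ.+ + 4)
    lem′ = solve-∀
    numerator : + 1 ℤ.* + (3 ℕ.* M) ℤ.+ (ℤ.- (+ 2 ℤ.* (+ (2 ℕ.+ x) ℤ.- + y))) ℤ.* + 1 ≡ + (3 ℕ.* M ℕ.+ 2 ℕ.* y) ℤ.- + (2 ℕ.* x ℕ.+ 4)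
    numerator = trans (cong (λ d → + 1 ℤ.* d ℤ.+ (ℤ.- (+ 2 ℤ.* (+ (2 ℕ.+ x) ℤ.- + y))) ℤ.* + 1) (ℤ.pos-* 3 M))
      (trans (lem (+ M) (+ (2 ℕ.+ x)) (+ y)) (trans (lem′ (+ M) (+ x) (+ y)) (sym (cong₂ ℤ._-_
        (trans (ℤ.pos-+ (3 ℕ.* M) (2 ℕ.* y)) (cong₂ ℤ._+_ (ℤ.pos-* 3 M) (ℤ.pos-* 2 y)))
        (trans (ℤ.pos-+ (2 ℕ.* x) 4) (cong (ℤ._+ + 4) (ℤ.pos-* 2 x)))))))
    g s : ℚ
    g = grid (2 ℕ.+ x)
    s = 1ℚ ℚ.+ (ℚ.- (⅔ ℚ.* g))
    eq : ℚ.1/ ⅔ ℚ.* (ℚ.- (ℚ.- 1ℚ ℚ.+ s)) ≡ g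
    eq = trans (cong (λ t → ℚ.1/ ⅔ ℚ.* ℚ.- t) (trans (sym (ℚ.+-assoc (ℚ.- 1ℚ) 1ℚ (ℚ.- (⅔ ℚ.* g)))) (ℚ.+-identityˡ (ℚ.- (⅔ ℚ.* g)))))
      (trans (cong (ℚ.1/ ⅔ ℚ.*_) (neg-involutive (⅔ ℚ.* g))) (trans (sym (ℚ.*-assoc (ℚ.1/ ⅔) ⅔ g)) (ℚ.*-identityˡ g)))

  cancelled : q ℕ.^ e ℕ.* q ℕ.^ (4 ℕ.* M) ℕ.≤ q ℕ.^ e ℕ.* (q ℕ.^ 4 ℕ.* (a ℕ.^ 2 ℕ.* b ℕ.^ 3) ℕ.^ M)
  cancelled = begin
    q ℕ.^ e ℕ.* q ℕ.^ (4 ℕ.* M)                                  ≡⟨ ℕ.^-distribˡ-+-* q e (4 ℕ.* M) ⟨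
    q ℕ.^ (e ℕ.+ 4 ℕ.* M)                                      ≡⟨ cong (q ℕ.^_) (lem₁ x y M) ⟩
    q ℕ.^ ((M ℕ.+ 2 ℕ.* x) ℕ.+ (3 ℕ.* M ℕ.+ 2 ℕ.* y))          ≡⟨ ℕ.^-distribˡ-+-* q (M ℕ.+ 2 ℕ.* x) (3 ℕ.* M ℕ.+ 2 ℕ.* y) ⟩
    q ℕ.^ (M ℕ.+ 2 ℕ.* x) ℕ.* q ℕ.^ (3 ℕ.* M ℕ.+ 2 ℕ.* y)        ≤⟨ ℕ.*-mono-≤ bound-a bound-b ⟩
    q ℕ.^ (2 ℕ.* y) ℕ.* a ℕ.^ (2 ℕ.* M) ℕ.* (q ℕ.^ (2 ℕ.* x ℕ.+ 4) ℕ.* b ℕ.^ (3 ℕ.* M))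
      ≡⟨ lem₂ (q ℕ.^ (2 ℕ.* y)) (a ℕ.^ (2 ℕ.* M)) (q ℕ.^ (2 ℕ.* x ℕ.+ 4)) (b ℕ.^ (3 ℕ.* M)) ⟩
    q ℕ.^ (2 ℕ.* y) ℕ.* q ℕ.^ (2 ℕ.* x ℕ.+ 4) ℕ.* (a ℕ.^ (2 ℕ.* M) ℕ.* b ℕ.^ (3 ℕ.* M))
      ≡⟨ cong₂ ℕ._*_ (trans (sym (ℕ.^-distribˡ-+-* q (2 ℕ.* y) (2 ℕ.* x ℕ.+ 4))) (trans (cong (q ℕ.^_) (lem₃ x y)) (ℕ.^-distribˡ-+-* q e 4)))
           (trans (sym (cong₂ ℕ._*_ (ℕ.^-*-assoc a 2 M) (ℕ.^-*-assoc b 3 M))) (sym (^-distribʳ-* (a ℕ.^ 2) (b ℕ.^ 3) M))) ⟩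
    q ℕ.^ e ℕ.* q ℕ.^ 4 ℕ.* (a ℕ.^ 2 ℕ.* b ℕ.^ 3) ℕ.^ M                ≡⟨ ℕ.*-assoc (q ℕ.^ e) (q ℕ.^ 4) _ ⟩
    q ℕ.^ e ℕ.* (q ℕ.^ 4 ℕ.* (a ℕ.^ 2 ℕ.* b ℕ.^ 3) ℕ.^ M)              ∎
    where
    lem₁ : ∀ x y M → 2 ℕ.* x ℕ.+ 2 ℕ.* y ℕ.+ 4 ℕ.* M ≡ (M ℕ.+ 2 ℕ.* x) ℕ.+ (3 ℕ.* M ℕ.+ 2 ℕ.* y)
    lem₁ = ℕSolver.solve-∀
    lem₂ : ∀ a b c d → a ℕ.* b ℕ.* (c ℕ.* d) ≡ a ℕ.* c ℕ.* (b ℕ.* d)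
    lem₂ = ℕSolver.solve-∀
    lem₃ : ∀ x y → 2 ℕ.* y ℕ.+ (2 ℕ.* x ℕ.+ 4) ≡ 2 ℕ.* x ℕ.+ 2 ℕ.* y ℕ.+ 4
    lem₃ = ℕSolver.solve-∀

open import Data.Integer.Base using (_+_; _*_; _-_; -_; _≤_)

private variable
  X Y : Set

-- Finite sums

0≤-+ : ∀ {i j} → 0ℤ ≤ i → 0ℤ ≤ j → 0ℤ ≤ i + j
0≤-+ p q = ℤ.+-mono-≤ p q

0≤-* : ∀ {i j} → 0ℤ ≤ i → 0ℤ ≤ j → 0ℤ ≤ i * j
0≤-* {+ m} {+ n} _ _ = subst (0ℤ ≤_) (ℤ.pos-* m n) (+≤+ ℕ.z≤n)

0≤-+n : ∀ {n} → 0ℤ ≤ + n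
0≤-+n = +≤+ ℕ.z≤n

0≤-² : ∀ i → 0ℤ ≤ i * i
0≤-² (+ n)      = 0≤-* {+ n} {+ n} 0≤-+n 0≤-+n
0≤-² -[1+ n ]   = +≤+ ℕ.z≤n

≤-by : ∀ {i j} d → 0ℤ ≤ d → j ≡ i + d → i ≤ j
≤-by {i} d 0≤d refl = subst (_≤ i + d) (ℤ.+-identityʳ i) (ℤ.+-monoʳ-≤ i 0≤d)

*-monoˡ-≤ : ∀ {k i j} → 0ℤ ≤ k → i ≤ j → k * i ≤ k * j
*-monoˡ-≤ {k} 0≤k i≤j = ℤ.*-monoˡ-≤-nonNeg k {{ℤ.nonNegative 0≤k}} i≤j

*-mono-≤ : ∀ {i j k l} → 0ℤ ≤ j → 0ℤ ≤ k → i ≤ j → k ≤ l → i * k ≤ j * l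
*-mono-≤ {j = j} {k} 0≤j 0≤k i≤j k≤l =
  ℤ.≤-trans (ℤ.*-monoʳ-≤-nonNeg k {{ℤ.nonNegative 0≤k}} i≤j) (*-monoˡ-≤ 0≤j k≤l)

infixr 5 ∑
∑ : List X → (X → ℤ) → ℤ
∑ []       f = 0ℤ
∑ (x ∷ xs) f = f x + ∑ xs f

syntax ∑ xs (λ x → e) = ∑[ x ← xs ] e

∑-cong : ∀ (xs : List X) {f g} → (∀ x → f x ≡ g x) → ∑ xs f ≡ ∑ xs g
∑-cong []       f≗g = refl
∑-cong (x ∷ xs) f≗g = cong₂ _+_ (f≗g x) (∑-cong xs f≗g)

∑-mono-∈ : ∀ (xs : List X) {f g} → (∀ {x} → x ∈ xs → f x ≤ g x) → ∑ xs f ≤ ∑ xs g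
∑-mono-∈ []       f≤g = ℤ.≤-refl
∑-mono-∈ (x ∷ xs) f≤g = ℤ.+-mono-≤ (f≤g (here refl)) (∑-mono-∈ xs (λ x∈ → f≤g (there x∈)))

∑-mono : ∀ (xs : List X) {f g} → (∀ x → f x ≤ g x) → ∑ xs f ≤ ∑ xs g
∑-mono xs f≤g = ∑-mono-∈ xs λ {x} _ → f≤g x

∑-zero : ∀ (xs : List X) {f} → (∀ x → f x ≡ 0ℤ) → ∑ xs f ≡ 0ℤ
∑-zero []       f≗0 = refl
∑-zero (x ∷ xs) f≗0 = cong₂ _+_ (f≗0 x) (∑-zero xs f≗0)

∑-nonNeg : ∀ (xs : List X) {f} → (∀ x → 0ℤ ≤ f x) → 0ℤ ≤ ∑ xs f
∑-nonNeg []       0≤f = ℤ.≤-refl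
∑-nonNeg (x ∷ xs) 0≤f = 0≤-+ (0≤f x) (∑-nonNeg xs 0≤f)

∑-+ : ∀ (xs : List X) (f g : X → ℤ) → (∑[ x ← xs ] f x + g x) ≡ ∑ xs f + ∑ xs g
∑-+ []       f g = refl
∑-+ (x ∷ xs) f g = trans (cong (_+_ (f x + g x)) (∑-+ xs f g)) (lem (f x) (g x) (∑ xs f) (∑ xs g))
  where
  lem : ∀ a b c d → a + b + (c + d) ≡ a + c + (b + d)
  lem = solve-∀

∑-*ˡ : ∀ (xs : List X) c (f : X → ℤ) → (∑[ x ← xs ] c * f x) ≡ c * ∑ xs f
∑-*ˡ []       c f = sym (ℤ.*-zeroʳ c)
∑-*ˡ (x ∷ xs) c f = trans (cong (_+_ (c * f x)) (∑-*ˡ xs c f)) (sym (ℤ.*-distribˡ-+ c (f x) _))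

∑-*ʳ : ∀ (xs : List X) c (f : X → ℤ) → (∑[ x ← xs ] f x * c) ≡ ∑ xs f * c
∑-*ʳ xs c f =
  trans (∑-cong xs λ x → ℤ.*-comm (f x) c) (trans (∑-*ˡ xs c f) (ℤ.*-comm c _))

∑-const : ∀ (xs : List X) c → (∑[ _ ← xs ] c) ≡ + length xs * c
∑-const []       c = sym (ℤ.*-zeroˡ c)
∑-const (x ∷ xs) c = trans (cong (_+_ c) (∑-const xs c)) (lem c (+ length xs))
  where
  lem : ∀ c n → c + n * c ≡ (1ℤ + n) * c
  lem = solve-∀

∑-swap : ∀ (xs : List X) (ys : List Y) (f : X → Y → ℤ) →
         (∑[ x ← xs ] ∑[ y ← ys ] f x y) ≡ (∑[ y ← ys ] ∑[ x ← xs ] f x y)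
∑-swap []       ys f = sym (∑-zero ys λ _ → refl)
∑-swap (x ∷ xs) ys f = trans (cong (_+_ (∑ ys (f x))) (∑-swap xs ys f)) (sym (∑-+ ys (f x) λ y → ∑ xs λ x′ → f x′ y))

∑-++ : ∀ (xs ys : List X) f → ∑ (xs ++ ys) f ≡ ∑ xs f + ∑ ys f
∑-++ []       ys f = sym (ℤ.+-identityˡ _)
∑-++ (x ∷ xs) ys f = trans (cong (_+_ (f x)) (∑-++ xs ys f)) (sym (ℤ.+-assoc (f x) _ _))

∑-map : ∀ (h : X → Y) (xs : List X) f → ∑ (map h xs) f ≡ (∑[ x ← xs ] f (h x))
∑-map h []       f = refl
∑-map h (x ∷ xs) f = cong (_+_ (f (h x))) (∑-map h xs f)

∑-cartesianProduct : ∀ (xs : List X) (ys : List Y) f →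
  ∑ (cartesianProduct xs ys) f ≡ (∑[ x ← xs ] ∑[ y ← ys ] f (x , y))
∑-cartesianProduct []       ys f = refl
∑-cartesianProduct (x ∷ xs) ys f = trans (∑-++ (map (x ,_) ys) _ f)
  (cong₂ _+_ (∑-map (x ,_) ys f) (∑-cartesianProduct xs ys f))

∑-*-∑ : ∀ (xs : List X) (ys : List Y) f g →
  ∑ xs f * ∑ ys g ≡ (∑[ x ← xs ] ∑[ y ← ys ] f x * g y)
∑-*-∑ xs ys f g = trans (sym (∑-*ʳ xs (∑ ys g) f)) (∑-cong xs λ x → sym (∑-*ˡ ys (f x) g))

∑-↭ : ∀ {xs ys : List X} f → xs ↭ ys → ∑ xs f ≡ ∑ ys f
∑-↭ f ↭.refl         = refl
∑-↭ f (↭.prep x p)   = cong (_+_ (f x)) (∑-↭ f p)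
∑-↭ f (↭.swap x y p) = trans (cong (λ s → f x + (f y + s)) (∑-↭ f p)) (lem (f x) (f y) _)
  where
  lem : ∀ a b c → a + (b + c) ≡ b + (a + c)
  lem = solve-∀
∑-↭ f (↭.trans p q)  = trans (∑-↭ f p) (∑-↭ f q)

∈-↭∷ : ∀ {x : X} {ys} → x ∈ ys → ∃ λ ys′ → ys ↭ x ∷ ys′
∈-↭∷ {x = x} x∈ys with as , bs , refl ← ∈-∃++ x∈ys = as ++ bs , shift x as bs

-- Each entry of `xs` uses up one occurrence of itself in `ys`, which is first moved to the front by
-- a permutation. Repetitions in `ys` only enlarge the right-hand side.
∑-⊆ : ∀ {xs ys : List X} {f} → Unique xs → (∀ {x} → x ∈ xs → x ∈ ys) → (∀ x → 0ℤ ≤ f x) →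
      ∑ xs f ≤ ∑ ys f
∑-⊆ {ys = ys} [] xs⊆ys 0≤f = ∑-nonNeg ys 0≤f
∑-⊆ {xs = x ∷ xs} {ys} {f} (x∉xs ∷ u) xs⊆ys 0≤f with ys′ , ys↭ ← ∈-↭∷ (xs⊆ys (here refl)) =
  subst (f x + ∑ xs f ≤_) (sym (∑-↭ f ys↭)) (ℤ.+-monoʳ-≤ (f x) (∑-⊆ u xs⊆ys′ 0≤f))
  where
  xs⊆ys′ : ∀ {y} → y ∈ xs → y ∈ ys′
  xs⊆ys′ y∈xs with ∈-resp-↭ ys↭ (xs⊆ys (there y∈xs))
  ... | here y≡x   = contradiction (sym y≡x) (All.lookup x∉xs y∈xs)
  ... | there y∈ys = y∈ys

record Finite (X : Set) : Set where
  field
    _≟_      : DecidableEquality X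
    elements : List X
    unique   : Unique elements
    complete : ∀ x → x ∈ elements

  δ : X → X → ℤ
  δ x y with x ≟ y
  ... | yes _ = 1ℤ
  ... | no  _ = 0ℤ

  δ-refl : ∀ {x y} → x ≡ y → δ x y ≡ 1ℤ
  δ-refl {x} {y} x≡y with x ≟ y
  ... | yes _   = refl
  ... | no  x≢y = contradiction x≡y x≢y

  δ-≢ : ∀ {x y} → x ≢ y → δ x y ≡ 0ℤ
  δ-≢ {x} {y} x≢y with x ≟ y
  ... | yes x≡y = contradiction x≡y x≢y
  ... | no  _   = refl

  δ-⇔ : ∀ {x y x′ y′} → (x ≡ y → x′ ≡ y′) → (x′ ≡ y′ → x ≡ y) → δ x y ≡ δ x′ y′
  δ-⇔ {x} {y} {x′} {y′} f g with x ≟ y | x′ ≟ y′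
  ... | yes _ | yes _ = refl
  ... | yes p | no  q = contradiction (f p) q
  ... | no  p | yes q = contradiction (g q) p
  ... | no  _ | no  _ = refl

  0≤δ : ∀ x y → 0ℤ ≤ δ x y
  0≤δ x y with x ≟ y
  ... | yes _ = +≤+ ℕ.z≤n
  ... | no  _ = ℤ.≤-refl

  ∑-δ-∉ : ∀ xs {x} (f : X → ℤ) → All (x ≢_) xs → (∑[ y ← xs ] δ x y * f y) ≡ 0ℤ
  ∑-δ-∉ []       f []       = refl
  ∑-δ-∉ (y ∷ xs) f (p ∷ ps) = cong₂ _+_ (trans (cong (_* f y) (δ-≢ p)) (ℤ.*-zeroˡ (f y))) (∑-δ-∉ xs f ps)

  ∑-δ-∈ : ∀ {xs x} (f : X → ℤ) → Unique xs → x ∈ xs → (∑[ y ← xs ] δ x y * f y) ≡ f x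
  ∑-δ-∈ {y ∷ xs} f (p ∷ u) (here refl) =
    trans (cong₂ _+_ (trans (cong (_* f y) (δ-refl refl)) (ℤ.*-identityˡ _)) (∑-δ-∉ xs f p)) (ℤ.+-identityʳ _)
  ∑-δ-∈ {y ∷ xs} {x} f (p ∷ u) (there x∈xs) =
    trans (cong₂ _+_ (trans (cong (_* f y) (δ-≢ λ x≡y → All.lookup p x∈xs (sym x≡y))) (ℤ.*-zeroˡ (f y)))
                     (∑-δ-∈ f u x∈xs)) (ℤ.+-identityˡ _)

  ∑-δ : ∀ x (f : X → ℤ) → (∑[ y ← elements ] δ x y * f y) ≡ f x
  ∑-δ x f = ∑-δ-∈ f unique (complete x)

  ∑-δ-1 : ∀ x → ∑ elements (δ x) ≡ 1ℤ
  ∑-δ-1 x = trans (∑-cong elements λ y → sym (ℤ.*-identityʳ (δ x y))) (∑-δ x λ _ → 1ℤ)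

finite-× : Finite X → Finite Y → Finite (X × Y)
finite-× F G = record
  { _≟_      = ≡-dec (Finite._≟_ F) (Finite._≟_ G)
  ; elements = cartesianProduct (Finite.elements F) (Finite.elements G)
  ; unique   = Unique.cartesianProduct⁺ (Finite.unique F) (Finite.unique G)
  ; complete = λ (x , y) → ∈-cartesianProduct⁺ (Finite.complete F x) (Finite.complete G y)
  }

-- The image of a complete duplicate-free list under a bijection is again complete and
-- duplicate-free, hence a permutation of the given list of `Y`.
∑-bijection : (F : Finite X) (G : Finite Y) (to : X → Y) (from : Y → X) →
  (∀ y → to (from y) ≡ y) → (∀ x → from (to x) ≡ x) → ∀ f →
  (∑[ x ← Finite.elements F ] f (to x)) ≡ ∑ (Finite.elements G) f
∑-bijection F G to from tf ft f = trans (sym (∑-map to (Finite.elements F) f))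
  (∑-↭ f (∼bag⇒↭ (unique∧set⇒bag
    (Unique.map⁺ (λ {x} {y} eq → trans (sym (ft x)) (trans (cong from eq) (ft y))) (Finite.unique F))
    (Finite.unique G)
    (mk⇔ (λ _ → Finite.complete G _) (λ _ → covers _)))))
  where
  covers : ∀ y → y ∈ map to (Finite.elements F)
  covers y = subst (_∈ _) (tf y) (∈-map⁺ to (Finite.complete F (from y)))

-- Cauchy-Schwarz against the constant 1. On adding x to the list, the difference of the two sides
-- grows by the sum over y of (f x - f y)².
∑-²≤ : ∀ (xs : List X) (f : X → ℤ) → ∑ xs f * ∑ xs f ≤ + length xs * (∑[ x ← xs ] f x * f x)
∑-²≤ []       f = ℤ.≤-refl
∑-²≤ (x ∷ xs) f = ≤-by _ (0≤-+ (∑-nonNeg xs λ y → 0≤-² (f x - f y)) (ℤ.i≤j⇒0≤j-i (∑-²≤ xs f)))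
  (trans (lem (f x) (∑ xs f) (∑[ y ← xs ] f y * f y) (+ length xs))
         (cong (λ t → (f x + ∑ xs f) * (f x + ∑ xs f) + (t + (+ length xs * (∑[ y ← xs ] f y * f y) - ∑ xs f * ∑ xs f))) (sym expand)))
  where
  lem : ∀ a s t n → (1ℤ + n) * (a * a + t) ≡ (a + s) * (a + s) + ((n * (a * a) + (- (+ 2 * a) * s + t)) + (n * t - s * s))
  lem = solve-∀
  lem₂ : ∀ a b → (a - b) * (a - b) ≡ a * a + (- (+ 2 * a) * b + b * b)
  lem₂ = solve-∀
  expand : (∑[ y ← xs ] (f x - f y) * (f x - f y)) ≡ + length xs * (f x * f x) + (- (+ 2 * f x) * ∑ xs f + (∑[ y ← xs ] f y * f y))
  expand = trans (∑-cong xs λ y → lem₂ (f x) (f y))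
    (trans (∑-+ xs (λ _ → f x * f x) _) (cong₂ _+_ (∑-const xs (f x * f x))
      (trans (∑-+ xs (λ y → - (+ 2 * f x) * f y) (λ y → f y * f y)) (cong (_+ ∑ xs λ y → f y * f y) (∑-*ˡ xs (- (+ 2 * f x)) f)))))

∑-concatMap : ∀ (h : X → List Y) (xs : List X) f → ∑ (concatMap h xs) f ≡ (∑[ x ← xs ] ∑ (h x) f)
∑-concatMap h []       f = refl
∑-concatMap h (x ∷ xs) f = trans (∑-++ (h x) (concatMap h xs) f) (cong (_+_ (∑ (h x) f)) (∑-concatMap h xs f))

distinct-pairs : ∀ {P : X → Set} {xs} → Unique xs → All P xs → AllPairs (λ x y → P x × P y × x ≢ y) xs
distinct-pairs []         []         = []
distinct-pairs (x∉ ∷ u) (px ∷ pxs) =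
  All.zipWith (λ (x≢y , py) → px , py , x≢y) (x∉ , pxs) ∷ distinct-pairs u pxs

∑-1 : ∀ (xs : List X) → (∑[ _ ← xs ] 1ℤ) ≡ + length xs
∑-1 xs = trans (∑-const xs 1ℤ) (ℤ.*-identityʳ _)

length-cartesianProduct : ∀ (xs : List X) (ys : List Y) → + length (cartesianProduct xs ys) ≡ + length xs * + length ys
length-cartesianProduct xs ys = trans (sym (∑-1 (cartesianProduct xs ys)))
  (trans (∑-cartesianProduct xs ys (λ _ → 1ℤ)) (trans (∑-cong xs λ _ → ∑-1 ys) (∑-const xs (+ length ys))))

-- This resolves a bound for a quantity in terms of itself, as it arises for `variance`; at 0
-- nothing can be cancelled, but nothing is to be shown either.
*-cancel-square : ∀ {i k} → 0ℤ ≤ i → 0ℤ ≤ k → i * i ≤ k * i → i ≤ k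
*-cancel-square {i} {k} 0≤i 0≤k ii≤ki with i ℤ.≟ 0ℤ
... | yes refl = 0≤k
... | no  i≢0  = ℤ.*-cancelʳ-≤-pos i k i {{ℤ.positive (ℤ.≤∧≢⇒< 0≤i λ 0≡i → i≢0 (sym 0≡i))}} ii≤ki

-- If x ≤ 2 m, then the first term dominates x³; otherwise x ≤ 2 (x - m).
cube-bound : ∀ {x m} → 0ℤ ≤ x → 0ℤ ≤ m → x * x * x ≤ + 8 * (m * m * m) + + 4 * (x * ((x - m) * (x - m)))
cube-bound {x} {m} 0≤x 0≤m = ℤ.*-cancelˡ-≤-pos _ _ (+ 4)
  -- Four times the difference of the two sides, written as a sum of nonnegative terms. The square
  -- vanishes at x = 3 m / 2, close to where the difference is smallest.
  (≤-by ((+ 2 * x - + 3 * m) * (+ 2 * x - + 3 * m) * (+ 3 * x + m) + (m * m * x + + 23 * (m * m * m)))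
    (0≤-+ (0≤-* (0≤-² (+ 2 * x - + 3 * m)) (0≤-+ (0≤-* (0≤-+n {3}) 0≤x) 0≤m))
          (0≤-+ (0≤-* (0≤-² m) 0≤x) (0≤-* (0≤-+n {23}) (0≤-* (0≤-² m) 0≤m))))
    (lem x m))
  where
  lem : ∀ x m → + 4 * (+ 8 * (m * m * m) + + 4 * (x * ((x - m) * (x - m)))) ≡
    + 4 * (x * x * x) + ((+ 2 * x - + 3 * m) * (+ 2 * x - + 3 * m) * (+ 3 * x + m) + (m * m * x + + 23 * (m * m * m)))
  lem = solve-∀

term≤∑ : ∀ {xs : List X} {x} {f : X → ℤ} → (∀ y → 0ℤ ℤ.≤ f y) → x ∈ xs → f x ℤ.≤ ∑ xs f
term≤∑ {xs = _ ∷ xs} {f = f} 0≤f (here refl) =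
  subst (ℤ._≤ f _ ℤ.+ ∑ xs f) (ℤ.+-identityʳ (f _)) (ℤ.+-monoʳ-≤ (f _) (∑-nonNeg xs 0≤f))
term≤∑ {xs = y ∷ xs} {f = f} 0≤f (there x∈) = ℤ.≤-trans (term≤∑ 0≤f x∈)
  (subst (ℤ._≤ f y ℤ.+ ∑ xs f) (ℤ.+-identityˡ (∑ xs f)) (ℤ.+-monoˡ-≤ (∑ xs f) (0≤f y)))

∑-×-product : ∀ (xs : List X) (ys : List Y) f g →
  (∑[ p ← cartesianProduct xs ys ] f (proj₁ p) ℤ.* g (proj₂ p)) ≡ ∑ xs f ℤ.* ∑ ys g
∑-×-product xs ys f g = trans (∑-cartesianProduct xs ys (λ p → f (proj₁ p) ℤ.* g (proj₂ p))) (sym (∑-*-∑ xs ys f g))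

-- The plane over a finite field

record FiniteField : Set₁ where
  infixl 6 _⊕_
  infixl 7 _⊗_
  infix  8 ⊝_
  field
    K       : Set
    _⊕_ _⊗_ : K → K → K
    ⊝_      : K → K
    𝟘 𝟙     : K
    isCommutativeRing : IsCommutativeRing _≡_ _⊕_ _⊗_ ⊝_ 𝟘 𝟙
    𝟘≢𝟙     : 𝟘 ≢ 𝟙
    inverse : ∀ x → x ≢ 𝟘 → ∃ λ y → x ⊗ y ≡ 𝟙
    finite  : Finite K

  commutativeRing : CommutativeRing 0ℓ 0ℓ
  commutativeRing = record { isCommutativeRing = isCommutativeRing }

  OddCharacteristic : Set
  OddCharacteristic = 𝟙 ⊕ 𝟙 ≢ 𝟘

module FinitePlane (𝔽 : FiniteField) where

  open FiniteField 𝔽 public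
  open IsCommutativeRing isCommutativeRing using (*-identityˡ; zeroʳ) public
  open IntegerCoefficients commutativeRing using (module Solver)
  open Solver using (solve; _:=_; _:+_; _:*_; _:-_; con) renaming (:-_ to ⊖′_)
  open ≡-Reasoning

  infixl 6 _⊞_ _⊟_
  infixr 7 _·_

  Pt : Set
  Pt = K × K

  _⊞_ _⊟_ : Pt → Pt → Pt
  (x₁ , x₂) ⊞ (y₁ , y₂) = x₁ ⊕ y₁ , x₂ ⊕ y₂
  (x₁ , x₂) ⊟ (y₁ , y₂) = x₁ ⊕ ⊝ y₁ , x₂ ⊕ ⊝ y₂

  _·_ : K → Pt → Pt
  t · (x₁ , x₂) = t ⊗ x₁ , t ⊗ x₂

  dot det : Pt → Pt → K
  dot (x₁ , x₂) (y₁ , y₂) = x₁ ⊗ y₁ ⊕ x₂ ⊗ y₂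
  det (x₁ , x₂) (y₁ , y₂) = x₁ ⊗ y₂ ⊕ ⊝ (x₂ ⊗ y₁)

  finitePt : Finite Pt
  finitePt = finite-× finite finite

  κ : List K
  κ = Finite.elements finite

  pts : List Pt
  pts = Finite.elements finitePt

  q : ℤ
  q = + length κ

  instance
    q-positive : ℤ.Positive q
    q-positive with κ | Finite.complete finite 𝟘
    ... | _ ∷ _ | _ = _

  0≤q : 0ℤ ≤ q
  0≤q = 0≤-+n

  noZeroDivisors : ∀ {x y} → x ⊗ y ≡ 𝟘 → x ≢ 𝟘 → y ≡ 𝟘
  noZeroDivisors {x} {y} xy≡0 x≢0 with i , xi≡1 ← inverse x x≢0 = begin
    y             ≡⟨ *-identityˡ y ⟨
    𝟙 ⊗ y         ≡⟨ cong (_⊗ y) xi≡1 ⟨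
    x ⊗ i ⊗ y     ≡⟨ solve 3 (λ x i y → x :* i :* y := i :* (x :* y)) refl x i y ⟩
    i ⊗ (x ⊗ y)   ≡⟨ cong (i ⊗_) xy≡0 ⟩
    i ⊗ 𝟘         ≡⟨ zeroʳ i ⟩
    𝟘             ∎

  square-zero : ∀ {x} → x ⊗ x ≡ 𝟘 → x ≡ 𝟘
  square-zero {x} xx≡0 with Finite._≟_ finite x 𝟘
  ... | yes x≡0 = x≡0
  ... | no  x≢0 = noZeroDivisors xx≡0 x≢0

  ∑-pts : ∀ f → ∑ pts f ≡ (∑[ x ← κ ] ∑[ y ← κ ] f (x , y))
  ∑-pts = ∑-cartesianProduct κ κ

  ∑-translate : ∀ v f → (∑[ z ← pts ] f (z ⊞ v)) ≡ ∑ pts f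
  ∑-translate v@(v₁ , v₂) = ∑-bijection finitePt finitePt (_⊞ v) (_⊟ v)
    (λ (x , y) → cong₂ _,_ (solve 2 (λ x v → x :- v :+ v := x) refl x v₁) (solve 2 (λ x v → x :- v :+ v := x) refl y v₂))
    (λ (x , y) → cong₂ _,_ (solve 2 (λ x v → x :+ v :- v := x) refl x v₁) (solve 2 (λ x v → x :+ v :- v := x) refl y v₂))

  -- Sums along lines and Bessel's inequality

  ⟪_,_⟫ : (Pt → ℤ) → (Pt → ℤ) → ℤ
  ⟪ f , g ⟫ = ∑[ z ← pts ] f z * g z

  ∥_∥² : (Pt → ℤ) → ℤ
  ∥ f ∥² = ⟪ f , f ⟫

  0≤∥∥² : ∀ f → 0ℤ ≤ ∥ f ∥²
  0≤∥∥² f = ∑-nonNeg pts λ z → 0≤-² (f z)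

  ⟪⟫-∑ʳ : ∀ {X : Set} (xs : List X) f (g : X → Pt → ℤ) →
          ⟪ f , (λ z → ∑[ x ← xs ] g x z) ⟫ ≡ (∑[ x ← xs ] ⟪ f , g x ⟫)
  ⟪⟫-∑ʳ xs f g = trans (∑-cong pts λ z → sym (∑-*ˡ xs (f z) (λ x → g x z)))
                       (∑-swap pts xs λ z x → f z * g x z)

  ∥+∥² : ∀ f g → ∥ (λ z → f z + g z) ∥² ≡ ∥ f ∥² + (+ 2 * ⟪ f , g ⟫ + ∥ g ∥²)
  ∥+∥² f g = begin
    (∑[ z ← pts ] (f z + g z) * (f z + g z))
      ≡⟨ ∑-cong pts (λ z → lem (f z) (g z)) ⟩
    (∑[ z ← pts ] f z * f z + (+ 2 * (f z * g z) + g z * g z))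
      ≡⟨ ∑-+ pts (λ z → f z * f z) (λ z → + 2 * (f z * g z) + g z * g z) ⟩
    ∥ f ∥² + (∑[ z ← pts ] + 2 * (f z * g z) + g z * g z)
      ≡⟨ cong (_+_ ∥ f ∥²) (∑-+ pts (λ z → + 2 * (f z * g z)) (λ z → g z * g z)) ⟩
    ∥ f ∥² + ((∑[ z ← pts ] + 2 * (f z * g z)) + ∥ g ∥²)
      ≡⟨ cong (λ s → ∥ f ∥² + (s + ∥ g ∥²)) (∑-*ˡ pts (+ 2) (λ z → f z * g z)) ⟩
    ∥ f ∥² + (+ 2 * ⟪ f , g ⟫ + ∥ g ∥²) ∎
    where
    lem : ∀ a b → (a + b) * (a + b) ≡ a * a + (+ 2 * (a * b) + b * b)
    lem = solve-∀

  ⟪⟫-*ˡ : ∀ c f g → ⟪ (λ z → c * f z) , g ⟫ ≡ c * ⟪ f , g ⟫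
  ⟪⟫-*ˡ c f g = trans (∑-cong pts λ z → ℤ.*-assoc c (f z) (g z)) (∑-*ˡ pts c λ z → f z * g z)

  ∥*∥² : ∀ c f → ∥ (λ z → c * f z) ∥² ≡ c * c * ∥ f ∥²
  ∥*∥² c f = trans (∑-cong pts λ z → lem c (f z)) (∑-*ˡ pts (c * c) λ z → f z * f z)
    where
    lem : ∀ c a → c * a * (c * a) ≡ c * c * (a * a)
    lem = solve-∀

  lineSum : Pt → (Pt → ℤ) → Pt → ℤ
  lineSum d φ z = ∑[ t ← κ ] φ (z ⊞ t · d)

  -- Translating z by `s · d` frees φ of the parameters. What remains depends on how `t · e ⊟ s · d`
  -- runs through the plane: over one line when the directions agree, over every point once when
  -- they are transversal.
  ⟪lineSum,lineSum⟫ : ∀ d e φ ψ →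
    ⟪ lineSum d φ , lineSum e ψ ⟫ ≡ (∑[ s ← κ ] ∑[ t ← κ ] ∑[ z ← pts ] φ z * ψ (z ⊞ (t · e ⊟ s · d)))
  ⟪lineSum,lineSum⟫ d@(d₁ , d₂) e@(e₁ , e₂) φ ψ = begin
    (∑[ z ← pts ] lineSum d φ z * lineSum e ψ z)
      ≡⟨ ∑-cong pts (λ z → ∑-*-∑ κ κ (λ s → φ (z ⊞ s · d)) (λ t → ψ (z ⊞ t · e))) ⟩
    (∑[ z ← pts ] ∑[ s ← κ ] ∑[ t ← κ ] φ (z ⊞ s · d) * ψ (z ⊞ t · e))
      ≡⟨ ∑-swap pts κ (λ z s → ∑[ t ← κ ] φ (z ⊞ s · d) * ψ (z ⊞ t · e)) ⟩
    (∑[ s ← κ ] ∑[ z ← pts ] ∑[ t ← κ ] φ (z ⊞ s · d) * ψ (z ⊞ t · e))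
      ≡⟨ ∑-cong κ (λ s → ∑-swap pts κ (λ z t → φ (z ⊞ s · d) * ψ (z ⊞ t · e))) ⟩
    (∑[ s ← κ ] ∑[ t ← κ ] ∑[ z ← pts ] φ (z ⊞ s · d) * ψ (z ⊞ t · e))
      ≡⟨ ∑-cong κ (λ s → ∑-cong κ λ t → trans
           (∑-cong pts λ z → cong (λ p → φ (z ⊞ s · d) * ψ p) (shift-pt z s t))
           (∑-translate (s · d) (λ z → φ z * ψ (z ⊞ (t · e ⊟ s · d))))) ⟩
    (∑[ s ← κ ] ∑[ t ← κ ] ∑[ z ← pts ] φ z * ψ (z ⊞ (t · e ⊟ s · d))) ∎
    where
    shift-pt : ∀ z s t → z ⊞ t · e ≡ z ⊞ s · d ⊞ (t · e ⊟ s · d)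
    shift-pt (z₁ , z₂) s t = cong₂ _,_ (lem z₁ (s ⊗ d₁) (t ⊗ e₁)) (lem z₂ (s ⊗ d₂) (t ⊗ e₂))
      where
      lem : ∀ z a b → z ⊕ b ≡ z ⊕ a ⊕ (b ⊕ ⊝ a)
      lem = solve 3 (λ z a b → z :+ b := z :+ a :+ (b :- a)) refl

  -- `lineSum d` is symmetric, and applying it twice multiplies it by q because t - s takes every
  -- value q times. For d other than 0 it is thus q times an orthogonal projection.
  lineSum-parallel : ∀ d φ ψ → ⟪ lineSum d φ , lineSum d ψ ⟫ ≡ q * ⟪ φ , lineSum d ψ ⟫
  lineSum-parallel d@(d₁ , d₂) φ ψ = begin
    ⟪ lineSum d φ , lineSum d ψ ⟫
      ≡⟨ ⟪lineSum,lineSum⟫ d d φ ψ ⟩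
    (∑[ s ← κ ] ∑[ t ← κ ] ∑[ z ← pts ] φ z * ψ (z ⊞ (t · d ⊟ s · d)))
      ≡⟨ ∑-cong κ (λ s → trans
           (∑-cong κ λ t → ∑-cong pts λ z → cong (λ v → φ z * ψ (z ⊞ v)) (factor s t))
           (∑-bijection finite finite (_⊕ ⊝ s) (_⊕ s)
             (λ t → solve 2 (λ s t → t :+ s :- s := t) refl s t)
             (λ t → solve 2 (λ s t → t :- s :+ s := t) refl s t)
             (λ t → ∑[ z ← pts ] φ z * ψ (z ⊞ t · d)))) ⟩
    (∑[ s ← κ ] ∑[ t ← κ ] ∑[ z ← pts ] φ z * ψ (z ⊞ t · d))
      ≡⟨ ∑-const κ _ ⟩
    q * (∑[ t ← κ ] ∑[ z ← pts ] φ z * ψ (z ⊞ t · d))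
      ≡⟨ cong (q *_) (sym (⟪⟫-∑ʳ κ φ (λ t z → ψ (z ⊞ t · d)))) ⟩
    q * ⟪ φ , lineSum d ψ ⟫ ∎
    where
    factor : ∀ s t → t · d ⊟ s · d ≡ (t ⊕ ⊝ s) · d
    factor s t = cong₂ _,_ (lem s t d₁) (lem s t d₂)
      where
      lem : ∀ s t a → t ⊗ a ⊕ ⊝ (s ⊗ a) ≡ (t ⊕ ⊝ s) ⊗ a
      lem = solve 3 (λ s t a → t :* a :- s :* a := (t :- s) :* a) refl

  -- The points are parametrised by their coordinates in the basis d, e; the inverse map is Cramer's
  -- rule, with `i` the inverse of the determinant.
  ∑-basis : ∀ d e → det d e ≢ 𝟘 → ∀ z f → (∑[ s ← κ ] ∑[ t ← κ ] f (z ⊞ (t · e ⊟ s · d))) ≡ ∑ pts f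
  ∑-basis d@(d₁ , d₂) e@(e₁ , e₂) D≢0 z@(z₁ , z₂) f with i , Di≡1 ← inverse (det d e) D≢0 =
    trans (sym (∑-pts λ (s , t) → f (z ⊞ (t · e ⊟ s · d))))
      (∑-bijection finitePt finitePt
        (λ (s , t) → z ⊞ (t · e ⊟ s · d))
        (λ y → i ⊗ det e (y ⊟ z) , i ⊗ det d (y ⊟ z))
        (λ (y₁ , y₂) → cong₂ _,_
          (trans (solve 8 (λ d₁ d₂ e₁ e₂ i z₁ y₁ v₂ →
              z₁ :+ (i :* (d₁ :* v₂ :- d₂ :* (y₁ :- z₁)) :* e₁ :- i :* (e₁ :* v₂ :- e₂ :* (y₁ :- z₁)) :* d₁)
                := (d₁ :* e₂ :- d₂ :* e₁) :* i :* (y₁ :- z₁) :+ z₁)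
              refl d₁ d₂ e₁ e₂ i z₁ y₁ (y₂ ⊕ ⊝ z₂))
            (trans (cong (_⊕ z₁) (unit Di≡1)) (solve 2 (λ y z → y :- z :+ z := y) refl y₁ z₁)))
          (trans (solve 8 (λ d₁ d₂ e₁ e₂ i z₂ v₁ y₂ →
              z₂ :+ (i :* (d₁ :* (y₂ :- z₂) :- d₂ :* v₁) :* e₂ :- i :* (e₁ :* (y₂ :- z₂) :- e₂ :* v₁) :* d₂)
                := (d₁ :* e₂ :- d₂ :* e₁) :* i :* (y₂ :- z₂) :+ z₂)
              refl d₁ d₂ e₁ e₂ i z₂ (y₁ ⊕ ⊝ z₁) y₂)
            (trans (cong (_⊕ z₂) (unit Di≡1)) (solve 2 (λ y z → y :- z :+ z := y) refl y₂ z₂))))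
        (λ (s , t) → cong₂ _,_
          (trans (solve 9 (λ d₁ d₂ e₁ e₂ i z₁ z₂ s t →
              i :* (e₁ :* (z₂ :+ (t :* e₂ :- s :* d₂) :- z₂) :- e₂ :* (z₁ :+ (t :* e₁ :- s :* d₁) :- z₁))
                := (d₁ :* e₂ :- d₂ :* e₁) :* i :* s)
              refl d₁ d₂ e₁ e₂ i z₁ z₂ s t)
            (unit Di≡1))
          (trans (solve 9 (λ d₁ d₂ e₁ e₂ i z₁ z₂ s t →
              i :* (d₁ :* (z₂ :+ (t :* e₂ :- s :* d₂) :- z₂) :- d₂ :* (z₁ :+ (t :* e₁ :- s :* d₁) :- z₁))
                := (d₁ :* e₂ :- d₂ :* e₁) :* i :* t)
              refl d₁ d₂ e₁ e₂ i z₁ z₂ s t)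
            (unit Di≡1)))
        f)
    where
    unit : ∀ {u x} → u ≡ 𝟙 → u ⊗ x ≡ x
    unit {x = x} refl = *-identityˡ x

  -- By `∑-basis` the inner double sum of ψ runs once over the whole plane, whatever z is, and so
  -- vanishes.
  lineSum-transversal : ∀ d e φ ψ → det d e ≢ 𝟘 → ∑ pts ψ ≡ 0ℤ → ⟪ lineSum d φ , lineSum e ψ ⟫ ≡ 0ℤ
  lineSum-transversal d e φ ψ D≢0 ∑ψ≡0 = begin
    ⟪ lineSum d φ , lineSum e ψ ⟫
      ≡⟨ ⟪lineSum,lineSum⟫ d e φ ψ ⟩
    (∑[ s ← κ ] ∑[ t ← κ ] ∑[ z ← pts ] φ z * ψ (z ⊞ (t · e ⊟ s · d)))
      ≡⟨ ∑-cong κ (λ s → sym (⟪⟫-∑ʳ κ φ (λ t z → ψ (z ⊞ (t · e ⊟ s · d))))) ⟩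
    (∑[ s ← κ ] ⟪ φ , (λ z → ∑[ t ← κ ] ψ (z ⊞ (t · e ⊟ s · d))) ⟫)
      ≡⟨ sym (⟪⟫-∑ʳ κ φ (λ s z → ∑[ t ← κ ] ψ (z ⊞ (t · e ⊟ s · d)))) ⟩
    ⟪ φ , (λ z → ∑[ s ← κ ] ∑[ t ← κ ] ψ (z ⊞ (t · e ⊟ s · d))) ⟫
      ≡⟨ ∑-zero pts (λ z → trans (cong (φ z *_) (trans (∑-basis d e D≢0 z ψ) ∑ψ≡0)) (ℤ.*-zeroʳ (φ z))) ⟩
    0ℤ ∎

  Transversal : Pt → Pt → Set
  Transversal d e = det d e ≢ 𝟘

  ∥∑lineSum∥² : ∀ {ds} φ → AllPairs Transversal ds → ∑ pts φ ≡ 0ℤ →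
    ∥ (λ z → ∑[ d ← ds ] lineSum d φ z) ∥² ≡ (∑[ d ← ds ] ∥ lineSum d φ ∥²)
  ∥∑lineSum∥² φ [] ∑φ≡0 = ∑-zero pts λ _ → refl
  ∥∑lineSum∥² {d ∷ ds} φ (ts ∷ tss) ∑φ≡0 = begin
    ∥ (λ z → lineSum d φ z + (∑[ e ← ds ] lineSum e φ z)) ∥²
      ≡⟨ ∥+∥² (lineSum d φ) (λ z → ∑[ e ← ds ] lineSum e φ z) ⟩
    N + (+ 2 * ⟪ lineSum d φ , (λ z → ∑[ e ← ds ] lineSum e φ z) ⟫ + ∥ (λ z → ∑[ e ← ds ] lineSum e φ z) ∥²)
      ≡⟨ cong₂ (λ a b → N + (+ 2 * a + b))
           (trans (⟪⟫-∑ʳ ds (lineSum d φ) (λ e → lineSum e φ)) (cross ts)) (∥∑lineSum∥² φ tss ∑φ≡0) ⟩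
    N + (+ 2 * 0ℤ + (∑[ e ← ds ] ∥ lineSum e φ ∥²))
      ≡⟨ cong (_+_ N) (ℤ.+-identityˡ _) ⟩
    N + (∑[ e ← ds ] ∥ lineSum e φ ∥²) ∎
    where
    N = ∥ lineSum d φ ∥²
    cross : ∀ {es} → All (Transversal d) es → (∑[ e ← es ] ⟪ lineSum d φ , lineSum e φ ⟫) ≡ 0ℤ
    cross []               = refl
    cross (_∷_ {e} t ts) = cong₂ _+_ (lineSum-transversal d e φ φ t ∑φ≡0) (cross ts)

  -- The operators `lineSum d` are q times projections whose ranges are orthogonal on functions of
  -- mean zero. With S the sum of the line sums, the squared norm of S and q ⟨φ , S⟩ both equal the
  -- left-hand side T, so expanding the squared norm of S - q φ leaves q² times that of φ minus T.
  bessel : ∀ {ds} φ → AllPairs Transversal ds → ∑ pts φ ≡ 0ℤ →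
    (∑[ d ← ds ] ∥ lineSum d φ ∥²) ≤ q * q * ∥ φ ∥²
  bessel {ds} φ ts ∑φ≡0 = ≤-by _ (0≤∥∥² (λ z → - q * φ z + S z)) (sym (begin
    T + ∥ (λ z → - q * φ z + S z) ∥²
      ≡⟨ cong (_+_ T) (∥+∥² (λ z → - q * φ z) S) ⟩
    T + (∥ (λ z → - q * φ z) ∥² + (+ 2 * ⟪ (λ z → - q * φ z) , S ⟫ + ∥ S ∥²))
      ≡⟨ cong (_+_ T) (cong₂ _+_ (∥*∥² (- q) φ) (cong₂ (λ a b → + 2 * a + b) (⟪⟫-*ˡ (- q) φ S) (∥∑lineSum∥² φ ts ∑φ≡0))) ⟩
    T + (- q * - q * ∥ φ ∥² + (+ 2 * (- q * ⟪ φ , S ⟫) + T))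
      ≡⟨ lem T q ∥ φ ∥² ⟪ φ , S ⟫ ⟩
    q * q * ∥ φ ∥² + + 2 * (T - q * ⟪ φ , S ⟫)
      ≡⟨ cong (λ a → q * q * ∥ φ ∥² + + 2 * (T - a)) (sym T≡) ⟩
    q * q * ∥ φ ∥² + + 2 * (T - T)
      ≡⟨ lem₂ (q * q * ∥ φ ∥²) T ⟩
    q * q * ∥ φ ∥² ∎))
    where
    S : Pt → ℤ
    S z = ∑[ d ← ds ] lineSum d φ z
    T : ℤ
    T = ∑[ d ← ds ] ∥ lineSum d φ ∥²
    T≡ : T ≡ q * ⟪ φ , S ⟫
    T≡ = trans (∑-cong ds λ d → lineSum-parallel d φ φ)
      (trans (∑-*ˡ ds q (λ d → ⟪ φ , lineSum d φ ⟫)) (cong (q *_) (sym (⟪⟫-∑ʳ ds φ (λ d → lineSum d φ)))))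
    lem : ∀ T q n s → T + (- q * - q * n + (+ 2 * (- q * s) + T)) ≡ q * q * n + + 2 * (T - q * s)
    lem = solve-∀
    lem₂ : ∀ n t → n + + 2 * (t - t) ≡ n
    lem₂ = solve-∀

-- The geometry of the unit circle

module CircleGeometry (𝔽 : FiniteField) (2≢0 : FiniteField.OddCharacteristic 𝔽) where

  open FinitePlane 𝔽 public
  open IntegerCoefficients commutativeRing using (module Solver)
  open Solver using (solve; _:=_; _:+_; _:*_; _:-_; con) renaming (:-_ to ⊖′_)
  open ≡-Reasoning

  OnCircle : Pt → Set
  OnCircle w = dot w w ≡ 𝟙

  onCircle? : ∀ w → Dec (OnCircle w)
  onCircle? w = Finite._≟_ finite (dot w w) 𝟙

  circle : List Pt
  circle = filter onCircle? pts

  circle-unique : Unique circle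
  circle-unique = Unique.filter⁺ onCircle? (Finite.unique finitePt)

  ∈-circle : ∀ {w} → OnCircle w → w ∈ circle
  ∈-circle {w} = ∈-filter⁺ onCircle? (Finite.complete finitePt w)

  -- The form may have nonzero null vectors, so the claim is special to the circle. A null
  -- difference gives 2 (1 - u·v) = 0, hence u·v = 1 in odd characteristic; then det² = |u|²|v|² -
  -- (u·v)² = 0, and resolving v along u and its perpendicular returns u.
  circle-null : ∀ {u v} → OnCircle u → OnCircle v → dot (u ⊟ v) (u ⊟ v) ≡ 𝟘 → u ≡ v
  circle-null {u@(u₁ , u₂)} {v@(v₁ , v₂)} |u| |v| n = sym (cong₂ _,_ (component₁ u₁ u₂ v₁ v₂ |u| uv≡1 det≡0) (component₂ u₁ u₂ v₁ v₂ |u| uv≡1 det≡0))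
    where
    1-uv≡0 : 𝟙 ⊕ ⊝ dot u v ≡ 𝟘
    1-uv≡0 = noZeroDivisors (begin
      (𝟙 ⊕ 𝟙) ⊗ (𝟙 ⊕ ⊝ dot u v)
        ≡⟨ solve 4 (λ u₁ u₂ v₁ v₂ → con (+ 2) :* (con 1ℤ :- (u₁ :* v₁ :+ u₂ :* v₂))
             := ((u₁ :- v₁) :* (u₁ :- v₁) :+ (u₂ :- v₂) :* (u₂ :- v₂))
                :+ ((con 1ℤ :- (u₁ :* u₁ :+ u₂ :* u₂)) :+ (con 1ℤ :- (v₁ :* v₁ :+ v₂ :* v₂))))
             refl u₁ u₂ v₁ v₂ ⟩
      dot (u ⊟ v) (u ⊟ v) ⊕ ((𝟙 ⊕ ⊝ dot u u) ⊕ (𝟙 ⊕ ⊝ dot v v))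
        ≡⟨ cong₂ _⊕_ n (cong₂ (λ a b → (𝟙 ⊕ ⊝ a) ⊕ (𝟙 ⊕ ⊝ b)) |u| |v|) ⟩
      𝟘 ⊕ ((𝟙 ⊕ ⊝ 𝟙) ⊕ (𝟙 ⊕ ⊝ 𝟙))
        ≡⟨ solve 0 (con 0ℤ :+ ((con 1ℤ :- con 1ℤ) :+ (con 1ℤ :- con 1ℤ)) := con 0ℤ) refl ⟩
      𝟘 ∎) 2≢0
    uv≡1 : dot u v ≡ 𝟙
    uv≡1 = begin
      dot u v                    ≡⟨ solve 1 (λ p → p := con 1ℤ :- (con 1ℤ :- p)) refl (dot u v) ⟩
      𝟙 ⊕ ⊝ (𝟙 ⊕ ⊝ dot u v)      ≡⟨ cong (λ a → 𝟙 ⊕ ⊝ a) 1-uv≡0 ⟩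
      𝟙 ⊕ ⊝ 𝟘                    ≡⟨ solve 0 (con 1ℤ :- con 0ℤ := con 1ℤ) refl ⟩
      𝟙 ∎
    det≡0 : det u v ≡ 𝟘
    det≡0 = square-zero (begin
      det u v ⊗ det u v
        ≡⟨ solve 4 (λ u₁ u₂ v₁ v₂ → (u₁ :* v₂ :- u₂ :* v₁) :* (u₁ :* v₂ :- u₂ :* v₁)
             := (u₁ :* u₁ :+ u₂ :* u₂) :* (v₁ :* v₁ :+ v₂ :* v₂) :- (u₁ :* v₁ :+ u₂ :* v₂) :* (u₁ :* v₁ :+ u₂ :* v₂))
             refl u₁ u₂ v₁ v₂ ⟩
      dot u u ⊗ dot v v ⊕ ⊝ (dot u v ⊗ dot u v)
        ≡⟨ cong₂ (λ a b → a ⊕ ⊝ b) (cong₂ _⊗_ |u| |v|) (cong₂ _⊗_ uv≡1 uv≡1) ⟩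
      𝟙 ⊗ 𝟙 ⊕ ⊝ (𝟙 ⊗ 𝟙)
        ≡⟨ solve 0 (con 1ℤ :* con 1ℤ :- con 1ℤ :* con 1ℤ := con 0ℤ) refl ⟩
      𝟘 ∎)
    component₁ : ∀ u₁ u₂ v₁ v₂ → OnCircle (u₁ , u₂) → dot (u₁ , u₂) (v₁ , v₂) ≡ 𝟙 → det (u₁ , u₂) (v₁ , v₂) ≡ 𝟘 → v₁ ≡ u₁
    component₁ u₁ u₂ v₁ v₂ |u| uv≡1 det≡0 = begin
      v₁                        ≡⟨ *-identityˡ v₁ ⟨
      𝟙 ⊗ v₁                    ≡⟨ cong (_⊗ v₁) |u| ⟨
      (u₁ ⊗ u₁ ⊕ u₂ ⊗ u₂) ⊗ v₁  ≡⟨ solve 4 (λ u₁ u₂ v₁ v₂ → (u₁ :* u₁ :+ u₂ :* u₂) :* v₁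
                                       := (u₁ :* v₁ :+ u₂ :* v₂) :* u₁ :- (u₁ :* v₂ :- u₂ :* v₁) :* u₂) refl u₁ u₂ v₁ v₂ ⟩
      dot (u₁ , u₂) (v₁ , v₂) ⊗ u₁ ⊕ ⊝ (det (u₁ , u₂) (v₁ , v₂) ⊗ u₂)
                                ≡⟨ cong₂ (λ a b → a ⊗ u₁ ⊕ ⊝ (b ⊗ u₂)) uv≡1 det≡0 ⟩
      𝟙 ⊗ u₁ ⊕ ⊝ (𝟘 ⊗ u₂)       ≡⟨ solve 2 (λ a b → con 1ℤ :* a :- con 0ℤ :* b := a) refl u₁ u₂ ⟩
      u₁ ∎
    component₂ : ∀ u₁ u₂ v₁ v₂ → OnCircle (u₁ , u₂) → dot (u₁ , u₂) (v₁ , v₂) ≡ 𝟙 → det (u₁ , u₂) (v₁ , v₂) ≡ 𝟘 → v₂ ≡ u₂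
    component₂ u₁ u₂ v₁ v₂ |u| uv≡1 det≡0 = begin
      v₂                        ≡⟨ *-identityˡ v₂ ⟨
      𝟙 ⊗ v₂                    ≡⟨ cong (_⊗ v₂) |u| ⟨
      (u₁ ⊗ u₁ ⊕ u₂ ⊗ u₂) ⊗ v₂  ≡⟨ solve 4 (λ u₁ u₂ v₁ v₂ → (u₁ :* u₁ :+ u₂ :* u₂) :* v₂
                                       := (u₁ :* v₁ :+ u₂ :* v₂) :* u₂ :+ (u₁ :* v₂ :- u₂ :* v₁) :* u₁) refl u₁ u₂ v₁ v₂ ⟩
      dot (u₁ , u₂) (v₁ , v₂) ⊗ u₂ ⊕ det (u₁ , u₂) (v₁ , v₂) ⊗ u₁
                                ≡⟨ cong₂ (λ a b → a ⊗ u₂ ⊕ b ⊗ u₁) uv≡1 det≡0 ⟩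
      𝟙 ⊗ u₂ ⊕ 𝟘 ⊗ u₁           ≡⟨ solve 2 (λ a b → con 1ℤ :* a :+ con 0ℤ :* b := a) refl u₂ u₁ ⟩
      u₂ ∎

  -- For parallel d and e one has (d·d) e = (d·e) d; pair this with 2 w and use 2 w·d = - d·d, 2 w·e = - e·e.
  collinear-dot : ∀ {w u v} → OnCircle w → OnCircle u → OnCircle v → u ≢ w → det (u ⊟ w) (v ⊟ w) ≡ 𝟘 →
    dot (v ⊟ w) (v ⊟ w) ⊕ ⊝ dot (u ⊟ w) (v ⊟ w) ≡ 𝟘
  collinear-dot {w@(w₁ , w₂)} {u@(u₁ , u₂)} {v@(v₁ , v₂)} |w| |u| |v| u≢w D≡0 =
    noZeroDivisors (begin
      dot d d ⊗ (dot e e ⊕ ⊝ dot d e)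
        ≡⟨ solve 6 (λ w₁ w₂ u₁ u₂ v₁ v₂ →
             let d₁ = u₁ :- w₁; d₂ = u₂ :- w₂; e₁ = v₁ :- w₁; e₂ = v₂ :- w₂
                 dd = d₁ :* d₁ :+ d₂ :* d₂; ee = e₁ :* e₁ :+ e₂ :* e₂; de = d₁ :* e₁ :+ d₂ :* e₂
                 uu = u₁ :* u₁ :+ u₂ :* u₂; vv = v₁ :* v₁ :+ v₂ :* v₂; ww = w₁ :* w₁ :+ w₂ :* w₂
             in dd :* (ee :- de) := (vv :- ww) :* dd :- (uu :- ww) :* de
                  :- (d₁ :* e₂ :- d₂ :* e₁) :* (con (+ 2) :* (w₂ :* d₁ :- w₁ :* d₂)))
             refl w₁ w₂ u₁ u₂ v₁ v₂ ⟩
      (dot v v ⊕ ⊝ dot w w) ⊗ dot d d ⊕ ⊝ ((dot u u ⊕ ⊝ dot w w) ⊗ dot d e) ⊕ ⊝ (det d e ⊗ r)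
        ≡⟨ cong₂ (λ a b → a ⊕ ⊝ b)
             (cong₂ (λ a b → a ⊗ dot d d ⊕ ⊝ (b ⊗ dot d e)) (cong₂ (λ a b → a ⊕ ⊝ b) |v| |w|) (cong₂ (λ a b → a ⊕ ⊝ b) |u| |w|))
             (cong (_⊗ r) D≡0) ⟩
      (𝟙 ⊕ ⊝ 𝟙) ⊗ dot d d ⊕ ⊝ ((𝟙 ⊕ ⊝ 𝟙) ⊗ dot d e) ⊕ ⊝ (𝟘 ⊗ r)
        ≡⟨ solve 3 (λ a b r → (con 1ℤ :- con 1ℤ) :* a :- (con 1ℤ :- con 1ℤ) :* b :- con 0ℤ :* r := con 0ℤ) refl (dot d d) (dot d e) r ⟩
      𝟘 ∎) (λ dd≡0 → u≢w (circle-null |u| |w| dd≡0))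
    where
    d = u ⊟ w
    e = v ⊟ w
    r = (𝟙 ⊕ 𝟙) ⊗ (w₂ ⊗ (u₁ ⊕ ⊝ w₁) ⊕ ⊝ (w₁ ⊗ (u₂ ⊕ ⊝ w₂)))

  difference-zero : ∀ x y → x ⊕ ⊝ y ≡ 𝟘 → x ≡ y
  difference-zero x y x-y≡0 = begin
    x                ≡⟨ solve 2 (λ x y → x := x :- y :+ y) refl x y ⟩
    x ⊕ ⊝ y ⊕ y      ≡⟨ cong (_⊕ y) x-y≡0 ⟩
    𝟘 ⊕ y            ≡⟨ solve 1 (λ y → con 0ℤ :+ y := y) refl y ⟩
    y ∎

  -- No line meets the circle in three points.
  chords-transversal : ∀ {w u v} → OnCircle w → OnCircle u → OnCircle v → u ≢ w → v ≢ w → u ≢ v →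
    Transversal (u ⊟ w) (v ⊟ w)
  chords-transversal {w@(w₁ , w₂)} {u@(u₁ , u₂)} {v@(v₁ , v₂)} |w| |u| |v| u≢w v≢w u≢v D≡0 =
    -- If the chords d and e from w were parallel, then e·e = d·e = d·d, so that their difference u
    -- - v would be null.
    u≢v (circle-null |u| |v| (begin
      dot (u ⊟ v) (u ⊟ v)
        ≡⟨ solve 6 (λ w₁ w₂ u₁ u₂ v₁ v₂ →
             let d₁ = u₁ :- w₁; d₂ = u₂ :- w₂; e₁ = v₁ :- w₁; e₂ = v₂ :- w₂
             in (u₁ :- v₁) :* (u₁ :- v₁) :+ (u₂ :- v₂) :* (u₂ :- v₂)
                := (e₁ :* e₁ :+ e₂ :* e₂ :- (d₁ :* e₁ :+ d₂ :* e₂)) :+ (d₁ :* d₁ :+ d₂ :* d₂ :- (e₁ :* d₁ :+ e₂ :* d₂)))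
             refl w₁ w₂ u₁ u₂ v₁ v₂ ⟩
      (dot e e ⊕ ⊝ dot d e) ⊕ (dot d d ⊕ ⊝ dot e d)
        ≡⟨ cong₂ _⊕_ (collinear-dot |w| |u| |v| u≢w D≡0) (collinear-dot |w| |v| |u| v≢w D′≡0) ⟩
      𝟘 ⊕ 𝟘
        ≡⟨ solve 0 (con 0ℤ :+ con 0ℤ := con 0ℤ) refl ⟩
      𝟘 ∎))
    where
    d = u ⊟ w
    e = v ⊟ w
    D′≡0 : det e d ≡ 𝟘
    D′≡0 = trans (solve 4 (λ d₁ d₂ e₁ e₂ → e₁ :* d₂ :- e₂ :* d₁ := ⊖′ (d₁ :* e₂ :- d₂ :* e₁)) refl (proj₁ d) (proj₂ d) (proj₁ e) (proj₂ e))
      (trans (cong ⊝_ D≡0) (solve 0 (⊖′ con 0ℤ := con 0ℤ) refl))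

-- Incidences with lines in isotropic directions

module Circle (𝔽 : FiniteField) (2≢0 : FiniteField.OddCharacteristic 𝔽) where

  open CircleGeometry 𝔽 2≢0 public
  open IntegerCoefficients commutativeRing using (module Solver)
  open Solver using (solve; _:=_; _:+_; _:*_; _:-_; con) renaming (:-_ to ⊖′_)
  open ℤ.≤-Reasoning

  lineSum-0 : ∀ d φ → d ≡ (𝟘 , 𝟘) → ∥ lineSum d φ ∥² ≡ q * q * ∥ φ ∥²
  lineSum-0 d φ refl = trans
    (∑-cong pts λ z → cong₂ _*_ (constant z) (constant z)) (∥*∥² q φ)
    where
    constant : ∀ z → lineSum (𝟘 , 𝟘) φ z ≡ q * φ z
    constant z@(z₁ , z₂) = trans (∑-cong κ λ t → cong φ (cong₂ _,_ (lem z₁ t) (lem z₂ t))) (∑-const κ (φ z))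
      where
      lem : ∀ z t → z ⊕ t ⊗ 𝟘 ≡ z
      lem = solve 2 (λ z t → z :+ t :* con 0ℤ := z) refl

  lineSum-⊟ : ∀ u v φ z → lineSum (u ⊟ v) φ z ≡ lineSum (v ⊟ u) φ z
  lineSum-⊟ (u₁ , u₂) (v₁ , v₂) φ z@(z₁ , z₂) = trans
    (∑-cong κ λ t → cong φ (cong₂ _,_ (lem z₁ t u₁ v₁) (lem z₂ t u₂ v₂)))
    (∑-bijection finite finite ⊝_ ⊝_ neg-neg neg-neg λ t → φ (z ⊞ t · ((v₁ , v₂) ⊟ (u₁ , u₂))))
    where
    lem : ∀ z t u v → z ⊕ t ⊗ (u ⊕ ⊝ v) ≡ z ⊕ ⊝ t ⊗ (v ⊕ ⊝ u)
    lem = solve 4 (λ z t u v → z :+ t :* (u :- v) := z :+ ⊖′ t :* (v :- u)) refl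
    neg-neg : ∀ x → ⊝ ⊝ x ≡ x
    neg-neg = solve 1 (λ x → ⊖′ (⊖′ x) := x) refl

  -- The degenerate chord u = w makes `lineSum` multiplication by q and contributes `q * q * ∥ φ ∥²`
  -- by itself; the proper chords through w are pairwise transversal and contribute at most as much
  -- again by `bessel`.
  chords-bound : ∀ {w} φ → OnCircle w → ∑ pts φ ≡ 0ℤ →
    (∑[ u ← circle ] ∥ lineSum (u ⊟ w) φ ∥²) ≤ + 2 * (q * q * ∥ φ ∥²)
  chords-bound {w@(w₁ , w₂)} φ |w| ∑φ≡0 = begin
    (∑[ u ← circle ] N u)
      ≤⟨ ∑-⊆ circle-unique covers (λ u → 0≤∥∥² (lineSum (u ⊟ w) φ)) ⟩
    N w + (∑[ u ← others ] N u)
      ≡⟨ cong₂ _+_ (lineSum-0 (w ⊟ w) φ (cong₂ _,_ (-‿inverse w₁) (-‿inverse w₂))) (sym (∑-map (_⊟ w) others (λ d → ∥ lineSum d φ ∥²))) ⟩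
    q * q * ∥ φ ∥² + (∑[ d ← map (_⊟ w) others ] ∥ lineSum d φ ∥²)
      ≤⟨ ℤ.+-monoʳ-≤ (q * q * ∥ φ ∥²) (bessel φ transversal ∑φ≡0) ⟩
    q * q * ∥ φ ∥² + q * q * ∥ φ ∥²
      ≡⟨ lem (q * q * ∥ φ ∥²) ⟩
    + 2 * (q * q * ∥ φ ∥²) ∎
    where
    N : Pt → ℤ
    N u = ∥ lineSum (u ⊟ w) φ ∥²
    ≢w? : ∀ u → Dec (u ≢ w)
    ≢w? u = ¬? (Finite._≟_ finitePt u w)
    others : List Pt
    others = filter ≢w? circle
    covers : ∀ {u} → u ∈ circle → u ∈ w ∷ others
    covers {u} u∈ with Finite._≟_ finitePt u w
    ... | yes u≡w = here u≡w
    ... | no  u≢w = there (∈-filter⁺ ≢w? u∈ u≢w)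
    transversal : AllPairs Transversal (map (_⊟ w) others)
    transversal = AllPairs.map⁺ (AllPairs.map
      (λ ((u≢w , |u|) , (v≢w , |v|) , u≢v) → chords-transversal |w| |u| |v| u≢w v≢w u≢v)
      (distinct-pairs (Unique.filter⁺ ≢w? circle-unique)
        (All.zip (All.all-filter ≢w? circle , All.filter⁺ ≢w? (All.all-filter onCircle? pts)))))
    -‿inverse : ∀ x → x ⊕ ⊝ x ≡ 𝟘
    -‿inverse = solve 1 (λ x → x :- x := con 0ℤ) refl
    lem : ∀ n → n + n ≡ + 2 * n
    lem = solve-∀

  -- One ordinate y on the circle determines all others, as y² is fixed by x. For y = 0 the point is
  -- listed twice, which is harmless in an upper bound.
  abscissa-points : K → List Pt
  abscissa-points x with filter (λ y → onCircle? (x , y)) κ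
  ... | []    = []
  ... | y ∷ _ = (x , y) ∷ (x , ⊝ y) ∷ []

  abscissa-points-covers : ∀ {x y} → OnCircle (x , y) → (x , y) ∈ abscissa-points x
  abscissa-points-covers {x} {y} |xy| with filter (λ y → onCircle? (x , y)) κ
    | All.all-filter (λ y → onCircle? (x , y)) κ
    | ∈-filter⁺ (λ y → onCircle? (x , y)) (Finite.complete finite y) |xy|
  ... | []    | _         | ()
  ... | y₀ ∷ _ | |xy₀| ∷ _ | _ with Finite._≟_ finite (y ⊕ ⊝ y₀) 𝟘
  ...   | yes y-y₀≡0 = here (cong (x ,_) (difference-zero y y₀ y-y₀≡0))
  ...   | no  y-y₀≢0 = there (here (cong (x ,_) (trans (difference-zero y (⊝ y₀)
          (trans (solve 2 (λ y y₀ → y :- (⊖′ y₀) := y :+ y₀) refl y y₀) (noZeroDivisors prod y-y₀≢0))) refl)))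
    where
    prod : (y ⊕ ⊝ y₀) ⊗ (y ⊕ y₀) ≡ 𝟘
    prod = trans (solve 3 (λ x y y₀ → (y :- y₀) :* (y :+ y₀) := (x :* x :+ y :* y) :- (x :* x :+ y₀ :* y₀)) refl x y y₀)
      (trans (cong₂ (λ a b → a ⊕ ⊝ b) |xy| |xy₀|) (solve 0 (con 1ℤ :- con 1ℤ := con 0ℤ) refl))

  ∑-abscissa-points : ∀ x → (∑[ _ ← abscissa-points x ] 1ℤ) ≤ + 2
  ∑-abscissa-points x with filter (λ y → onCircle? (x , y)) κ
  ... | []    = +≤+ ℕ.z≤n
  ... | _ ∷ _ = ℤ.≤-refl

  circle-size : + length circle ≤ + 2 * q
  circle-size = begin
    + length circle                                ≡⟨ ℤ.*-identityʳ _ ⟨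
    + length circle * 1ℤ                           ≡⟨ ∑-const circle 1ℤ ⟨
    (∑[ _ ← circle ] 1ℤ)                           ≤⟨ ∑-⊆ circle-unique covers (λ _ → 0≤-+n) ⟩
    (∑[ _ ← concatMap abscissa-points κ ] 1ℤ)      ≡⟨ ∑-concatMap abscissa-points κ (λ _ → 1ℤ) ⟩
    (∑[ x ← κ ] ∑[ _ ← abscissa-points x ] 1ℤ)     ≤⟨ ∑-mono κ ∑-abscissa-points ⟩
    (∑[ _ ← κ ] + 2)                               ≡⟨ ∑-const κ (+ 2) ⟩
    q * + 2                                        ≡⟨ ℤ.*-comm q (+ 2) ⟩
    + 2 * q                                        ∎
    where
    covers : ∀ {w} → w ∈ circle → w ∈ concatMap abscissa-points κ
    covers {x , y} w∈ = ∈-concatMap⁺ abscissa-points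
      (Any.map (λ { refl → abscissa-points-covers (proj₂ (∈-filter⁻ onCircle? {xs = pts} w∈)) }) (Finite.complete finite x))

  -- φ w z is a weight on the line of F³ through (z , 0) in the isotropic direction (w , 1),
  -- and incident φ t z is the sum of the weights of the lines through (z , t).
  incident : (Pt → Pt → ℤ) → K → Pt → ℤ
  incident φ t z = ∑[ w ← circle ] φ w (z ⊟ t · w)

  -- Lines in directions w and u with base points z and z′ meet at height t precisely if z′ = z + t
  -- (w - u). Summing over t therefore turns the correlation of `φ w` and `φ u` into a line sum in
  -- direction w - u.
  ∥incident∥² : ∀ φ → (∑[ t ← κ ] ∥ incident φ t ∥²) ≡
    (∑[ w ← circle ] ∑[ u ← circle ] ⟪ φ w , lineSum (w ⊟ u) (φ u) ⟫)
  ∥incident∥² φ = begin-equality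
    (∑[ t ← κ ] ∑[ z ← pts ] incident φ t z * incident φ t z)
      ≡⟨ ∑-cong κ (λ t → ∑-cong pts λ z → ∑-*-∑ circle circle (λ w → φ w (z ⊟ t · w)) (λ w → φ w (z ⊟ t · w))) ⟩
    (∑[ t ← κ ] ∑[ z ← pts ] ∑[ w ← circle ] ∑[ u ← circle ] φ w (z ⊟ t · w) * φ u (z ⊟ t · u))
      ≡⟨ ∑-cong κ (λ t → trans
           (∑-swap pts circle (λ z w → ∑[ u ← circle ] φ w (z ⊟ t · w) * φ u (z ⊟ t · u)))
           (∑-cong circle λ w → trans
             (∑-swap pts circle (λ z u → φ w (z ⊟ t · w) * φ u (z ⊟ t · u)))
             (∑-cong circle λ u → trans
               (sym (∑-translate (t · w) (λ z → φ w (z ⊟ t · w) * φ u (z ⊟ t · u))))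
               (∑-cong pts λ z → cong₂ (λ x y → φ w x * φ u y) (back z t w) (move z t w u))))) ⟩
    (∑[ t ← κ ] ∑[ w ← circle ] ∑[ u ← circle ] ∑[ z ← pts ] φ w z * φ u (z ⊞ t · (w ⊟ u)))
      ≡⟨ ∑-swap κ circle (λ t w → ∑[ u ← circle ] ∑[ z ← pts ] φ w z * φ u (z ⊞ t · (w ⊟ u))) ⟩
    (∑[ w ← circle ] ∑[ t ← κ ] ∑[ u ← circle ] ∑[ z ← pts ] φ w z * φ u (z ⊞ t · (w ⊟ u)))
      ≡⟨ ∑-cong circle (λ w → trans
           (∑-swap κ circle (λ t u → ∑[ z ← pts ] φ w z * φ u (z ⊞ t · (w ⊟ u))))
           (∑-cong circle λ u → sym (⟪⟫-∑ʳ κ (φ w) (λ t z → φ u (z ⊞ t · (w ⊟ u)))))) ⟩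
    (∑[ w ← circle ] ∑[ u ← circle ] ⟪ φ w , lineSum (w ⊟ u) (φ u) ⟫) ∎
    where
    back : ∀ z t w → z ⊞ t · w ⊟ t · w ≡ z
    back (z₁ , z₂) t (w₁ , w₂) = cong₂ _,_ (lem z₁ (t ⊗ w₁)) (lem z₂ (t ⊗ w₂))
      where
      lem : ∀ z a → z ⊕ a ⊕ ⊝ a ≡ z
      lem = solve 2 (λ z a → z :+ a :- a := z) refl
    move : ∀ z t w u → z ⊞ t · w ⊟ t · u ≡ z ⊞ t · (w ⊟ u)
    move (z₁ , z₂) t (w₁ , w₂) (u₁ , u₂) = cong₂ _,_ (lem z₁ t w₁ u₁) (lem z₂ t w₂ u₂)
      where
      lem : ∀ z t w u → z ⊕ t ⊗ w ⊕ ⊝ (t ⊗ u) ≡ z ⊕ t ⊗ (w ⊕ ⊝ u)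
      lem = solve 4 (λ z t w u → z :+ t :* w :- t :* u := z :+ t :* (w :- u)) refl

  2⟪⟫≤ : ∀ f g → + 2 * ⟪ f , g ⟫ ≤ ∥ f ∥² + ∥ g ∥²
  2⟪⟫≤ f g = ≤-by _ (0≤∥∥² (λ z → f z + - 1ℤ * g z))
    (sym (trans (cong (_+_ (+ 2 * ⟪ f , g ⟫)) (trans (∥+∥² f (λ z → - 1ℤ * g z))
      (cong₂ (λ a b → ∥ f ∥² + (+ 2 * a + b)) ⟪f,-g⟫ (∥*∥² (- 1ℤ) g)))) (lem ⟪ f , g ⟫ ∥ f ∥² ∥ g ∥²)))
    where
    ⟪f,-g⟫ : ⟪ f , (λ z → - 1ℤ * g z) ⟫ ≡ - 1ℤ * ⟪ f , g ⟫
    ⟪f,-g⟫ = trans (∑-cong pts λ z → lem′ (f z) (g z)) (∑-*ˡ pts (- 1ℤ) λ z → f z * g z)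
      where
      lem′ : ∀ a b → a * (- 1ℤ * b) ≡ - 1ℤ * (a * b)
      lem′ = solve-∀
    lem : ∀ s a b → + 2 * s + (a + (+ 2 * (- 1ℤ * s) + - 1ℤ * - 1ℤ * b)) ≡ a + b
    lem = solve-∀

  -- Cauchy-Schwarz over the circle would give q times the size of the circle in place of 2 q.
  -- Instead, multiplying by 2 q turns each correlation into twice a product of two line sums by
  -- `lineSum-parallel`, the arithmetic-geometric mean inequality separates `φ w` from `φ u`, and
  -- each of the two halves is a sum over the chords from one fixed point, to which `chords-bound`
  -- applies.
  incident-bound : ∀ φ → (∀ w → ∑ pts (φ w) ≡ 0ℤ) →
    (∑[ t ← κ ] ∥ incident φ t ∥²) ≤ + 2 * q * (∑[ w ← circle ] ∥ φ w ∥²)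
  incident-bound φ ∑φ≡0 = ℤ.*-cancelˡ-≤-pos _ _ (+ 2) (ℤ.*-cancelˡ-≤-pos _ _ q (begin
    q * (+ 2 * (∑[ t ← κ ] ∥ incident φ t ∥²))
      ≡⟨ trans (lem₁ q _) (cong (+ 2 * q *_) (∥incident∥² φ)) ⟩
    + 2 * q * (∑[ w ← circle ] ∑[ u ← circle ] ⟪ φ w , lineSum (w ⊟ u) (φ u) ⟫)
      ≡⟨ trans (sym (∑-*ˡ circle (+ 2 * q) (λ w → ∑[ u ← circle ] ⟪ φ w , lineSum (w ⊟ u) (φ u) ⟫)))
           (∑-cong circle λ w → trans (sym (∑-*ˡ circle (+ 2 * q) (λ u → ⟪ φ w , lineSum (w ⊟ u) (φ u) ⟫)))
           (∑-cong circle λ u → trans (ℤ.*-assoc (+ 2) q ⟪ φ w , lineSum (w ⊟ u) (φ u) ⟫) (cong (+ 2 *_) (sym (lineSum-parallel (w ⊟ u) (φ w) (φ u)))))) ⟩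
    (∑[ w ← circle ] ∑[ u ← circle ] + 2 * ⟪ lineSum (w ⊟ u) (φ w) , lineSum (w ⊟ u) (φ u) ⟫)
      ≤⟨ ∑-mono circle (λ w → ∑-mono circle λ u → 2⟪⟫≤ (lineSum (w ⊟ u) (φ w)) (lineSum (w ⊟ u) (φ u))) ⟩
    (∑[ w ← circle ] ∑[ u ← circle ] ∥ lineSum (w ⊟ u) (φ w) ∥² + ∥ lineSum (w ⊟ u) (φ u) ∥²)
      ≡⟨ trans (∑-cong circle λ w → ∑-+ circle (λ u → ∥ lineSum (w ⊟ u) (φ w) ∥²) (λ u → ∥ lineSum (w ⊟ u) (φ u) ∥²))
           (∑-+ circle (λ w → ∑[ u ← circle ] ∥ lineSum (w ⊟ u) (φ w) ∥²) (λ w → ∑[ u ← circle ] ∥ lineSum (w ⊟ u) (φ u) ∥²)) ⟩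
    (∑[ w ← circle ] ∑[ u ← circle ] ∥ lineSum (w ⊟ u) (φ w) ∥²) + (∑[ w ← circle ] ∑[ u ← circle ] ∥ lineSum (w ⊟ u) (φ u) ∥²)
      ≡⟨ cong₂ _+_
           -- Reversing the chord in one half and exchanging w and u in the other makes the two
           -- halves the same sum.
           (∑-cong circle λ w → ∑-cong circle λ u → ∑-cong pts λ z → cong₂ _*_ (lineSum-⊟ w u (φ w) z) (lineSum-⊟ w u (φ w) z))
           (∑-swap circle circle (λ w u → ∥ lineSum (w ⊟ u) (φ u) ∥²)) ⟩
    chords + chords
      ≤⟨ ℤ.+-mono-≤ chords≤ chords≤ ⟩
    + 2 * (q * q * V) + + 2 * (q * q * V)
      ≡⟨ lem₂ q V ⟩
    q * (+ 2 * (+ 2 * q * V)) ∎))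
    where
    V : ℤ
    V = ∑[ w ← circle ] ∥ φ w ∥²
    chords : ℤ
    chords = ∑[ w ← circle ] ∑[ u ← circle ] ∥ lineSum (u ⊟ w) (φ w) ∥²
    chords≤ : chords ≤ + 2 * (q * q * V)
    chords≤ = begin
      chords
        ≤⟨ ∑-mono-∈ circle (λ {w} w∈ → chords-bound (φ w) (proj₂ (∈-filter⁻ onCircle? {xs = pts} w∈)) (∑φ≡0 w)) ⟩
      (∑[ w ← circle ] + 2 * (q * q * ∥ φ w ∥²))
        ≡⟨ trans (∑-*ˡ circle (+ 2) (λ w → q * q * ∥ φ w ∥²)) (cong (+ 2 *_) (∑-*ˡ circle (q * q) (λ w → ∥ φ w ∥²))) ⟩
      + 2 * (q * q * V) ∎
    lem₁ : ∀ q t → q * (+ 2 * t) ≡ + 2 * q * t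
    lem₁ = solve-∀
    lem₂ : ∀ q v → + 2 * (q * q * v) + + 2 * (q * q * v) ≡ q * (+ 2 * (+ 2 * q * v))
    lem₂ = solve-∀

-- The orthogonal group in coordinates

module Isometries (𝔽 : FiniteField) (2≢0 : FiniteField.OddCharacteristic 𝔽) where

  open Circle 𝔽 2≢0 public
  open IntegerCoefficients commutativeRing using (module Solver)
  open Solver using (solve; _:=_; _:+_; _:*_; _:-_; con) renaming (:-_ to ⊖′_)
  open ≡-Reasoning

  rotate : K → Pt → Pt
  rotate σ (w₁ , w₂) = σ · (w₂ , ⊝ w₁)

  signs : List K
  signs = 𝟙 ∷ ⊝ 𝟙 ∷ []

  sign-square : ∀ {σ} → σ ∈ signs → σ ⊗ σ ≡ 𝟙
  sign-square (here refl)         = *-identityˡ 𝟙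
  sign-square (there (here refl)) = solve 0 ((⊖′ con 1ℤ) :* (⊖′ con 1ℤ) := con 1ℤ) refl

  square⇒sign : ∀ {σ} → σ ⊗ σ ≡ 𝟙 → σ ∈ signs
  square⇒sign {σ} σσ≡1 with Finite._≟_ finite (σ ⊕ ⊝ 𝟙) 𝟘
  ... | yes σ-1≡0 = here (difference-zero σ 𝟙 σ-1≡0)
  ... | no  σ-1≢0 = there (here (difference-zero σ (⊝ 𝟙) (noZeroDivisors (begin
    (σ ⊕ ⊝ 𝟙) ⊗ (σ ⊕ ⊝ ⊝ 𝟙)   ≡⟨ solve 1 (λ σ → (σ :- con 1ℤ) :* (σ :- (⊖′ con 1ℤ)) := σ :* σ :- con 1ℤ) refl σ ⟩
    σ ⊗ σ ⊕ ⊝ 𝟙               ≡⟨ cong (_⊕ ⊝ 𝟙) σσ≡1 ⟩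
    𝟙 ⊕ ⊝ 𝟙                   ≡⟨ solve 0 (con 1ℤ :- con 1ℤ := con 0ℤ) refl ⟩
    𝟘 ∎) σ-1≢0)))

  -- The elements of O(2) are the maps orth w σ with w on the circle and σ = ± 1.
  orth : Pt → K → Pt → Pt
  orth w σ (x , y) = x · rotate σ w ⊞ y · w

  -- The transpose of `orth w σ`, whose columns `rotate σ w` and `w` are orthonormal.
  orth⁻¹ : Pt → K → Pt → Pt
  orth⁻¹ w σ v = dot v (rotate σ w) , dot v w

  orth-⊞ : ∀ w σ u v → orth w σ (u ⊞ v) ≡ orth w σ u ⊞ orth w σ v
  orth-⊞ w@(w₁ , w₂) σ (u₁ , u₂) (v₁ , v₂) = cong₂ _,_ (lem u₁ u₂ v₁ v₂ (σ ⊗ w₂) w₁) (lem u₁ u₂ v₁ v₂ (σ ⊗ ⊝ w₁) w₂)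
    where
    lem : ∀ u₁ u₂ v₁ v₂ a b → (u₁ ⊕ v₁) ⊗ a ⊕ (u₂ ⊕ v₂) ⊗ b ≡ (u₁ ⊗ a ⊕ u₂ ⊗ b) ⊕ (v₁ ⊗ a ⊕ v₂ ⊗ b)
    lem = solve 6 (λ u₁ u₂ v₁ v₂ a b → (u₁ :+ v₁) :* a :+ (u₂ :+ v₂) :* b := (u₁ :* a :+ u₂ :* b) :+ (v₁ :* a :+ v₂ :* b)) refl

  orth-· : ∀ w σ t v → orth w σ (t · v) ≡ t · orth w σ v
  orth-· w@(w₁ , w₂) σ t (v₁ , v₂) = cong₂ _,_ (lem t v₁ v₂ (σ ⊗ w₂) w₁) (lem t v₁ v₂ (σ ⊗ ⊝ w₁) w₂)
    where
    lem : ∀ t v₁ v₂ a b → t ⊗ v₁ ⊗ a ⊕ t ⊗ v₂ ⊗ b ≡ t ⊗ (v₁ ⊗ a ⊕ v₂ ⊗ b)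
    lem = solve 5 (λ t v₁ v₂ a b → t :* v₁ :* a :+ t :* v₂ :* b := t :* (v₁ :* a :+ v₂ :* b)) refl

  -- Bracketed so that the first coordinate only shifts the base point: for fixed x, letting y run
  -- through B gives `hits w` at `z ⊞ x · rotate σ w`.
  move : Pt → K → Pt → Pt → Pt
  move w σ z (x , y) = z ⊞ x · rotate σ w ⊞ y · w

  move-orth : ∀ w σ z v → move w σ z v ≡ z ⊞ orth w σ v
  move-orth (w₁ , w₂) σ (z₁ , z₂) (x , y) = cong₂ _,_ (lem z₁ _ _) (lem z₂ _ _)
    where
    lem : ∀ a b c → a ⊕ b ⊕ c ≡ a ⊕ (b ⊕ c)
    lem = solve 3 (λ a b c → a :+ b :+ c := a :+ (b :+ c)) refl

  module _ {w : Pt} {σ : K} (|w| : OnCircle w) (σ²≡1 : σ ⊗ σ ≡ 𝟙) where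

    private
      w₁ w₂ : K
      w₁ = proj₁ w
      w₂ = proj₂ w

      unit² : ∀ x y → σ ⊗ σ ⊗ x ⊗ dot w w ⊕ y ⊗ dot w w ≡ x ⊕ y
      unit² x y = trans (cong₂ (λ s d → s ⊗ x ⊗ d ⊕ y ⊗ d) σ²≡1 |w|)
        (solve 2 (λ x y → con 1ℤ :* x :* con 1ℤ :+ y :* con 1ℤ := x :+ y) refl x y)

    orth-dot : ∀ v → dot (orth w σ v) (orth w σ v) ≡ dot v v
    orth-dot (x , y) = trans
      (solve 5 (λ x y σ w₁ w₂ →
        (x :* (σ :* w₂) :+ y :* w₁) :* (x :* (σ :* w₂) :+ y :* w₁) :+ (x :* (σ :* (⊖′ w₁)) :+ y :* w₂) :* (x :* (σ :* (⊖′ w₁)) :+ y :* w₂)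
          := σ :* σ :* (x :* x) :* (w₁ :* w₁ :+ w₂ :* w₂) :+ y :* y :* (w₁ :* w₁ :+ w₂ :* w₂)) refl x y σ w₁ w₂)
      (unit² (x ⊗ x) (y ⊗ y))

    orth⁻¹-orth : ∀ v → orth⁻¹ w σ (orth w σ v) ≡ v
    orth⁻¹-orth (x , y) = cong₂ _,_
      (trans (solve 5 (λ x y σ w₁ w₂ →
          (x :* (σ :* w₂) :+ y :* w₁) :* (σ :* w₂) :+ (x :* (σ :* (⊖′ w₁)) :+ y :* w₂) :* (σ :* (⊖′ w₁))
            := σ :* σ :* x :* (w₁ :* w₁ :+ w₂ :* w₂) :+ con 0ℤ :* (w₁ :* w₁ :+ w₂ :* w₂)) refl x y σ w₁ w₂)
        (trans (unit² x 𝟘) (solve 1 (λ x → x :+ con 0ℤ := x) refl x)))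
      (trans (solve 5 (λ x y σ w₁ w₂ →
          (x :* (σ :* w₂) :+ y :* w₁) :* w₁ :+ (x :* (σ :* (⊖′ w₁)) :+ y :* w₂) :* w₂
            := σ :* σ :* con 0ℤ :* (w₁ :* w₁ :+ w₂ :* w₂) :+ y :* (w₁ :* w₁ :+ w₂ :* w₂)) refl x y σ w₁ w₂)
        (trans (unit² 𝟘 y) (solve 1 (λ x → con 0ℤ :+ x := x) refl y)))

    orth-orth⁻¹ : ∀ v → orth w σ (orth⁻¹ w σ v) ≡ v
    orth-orth⁻¹ (x , y) = cong₂ _,_
      (trans (solve 5 (λ x y σ w₁ w₂ →
          (x :* (σ :* w₂) :+ y :* (σ :* (⊖′ w₁))) :* (σ :* w₂) :+ (x :* w₁ :+ y :* w₂) :* w₁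
            := (σ :* σ) :* (x :* w₂ :- y :* w₁) :* w₂ :+ (x :* w₁ :+ y :* w₂) :* w₁) refl x y σ w₁ w₂)
        (trans (cong (λ s → s ⊗ (x ⊗ w₂ ⊕ ⊝ (y ⊗ w₁)) ⊗ w₂ ⊕ (x ⊗ w₁ ⊕ y ⊗ w₂) ⊗ w₁) σ²≡1)
        (trans (solve 4 (λ x y w₁ w₂ → con 1ℤ :* (x :* w₂ :- y :* w₁) :* w₂ :+ (x :* w₁ :+ y :* w₂) :* w₁
            := (w₁ :* w₁ :+ w₂ :* w₂) :* x) refl x y w₁ w₂) (trans (cong (_⊗ x) |w|) (*-identityˡ x)))))
      (trans (solve 5 (λ x y σ w₁ w₂ →
          (x :* (σ :* w₂) :+ y :* (σ :* (⊖′ w₁))) :* (σ :* (⊖′ w₁)) :+ (x :* w₁ :+ y :* w₂) :* w₂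
            := (σ :* σ) :* (x :* w₂ :- y :* w₁) :* (⊖′ w₁) :+ (x :* w₁ :+ y :* w₂) :* w₂) refl x y σ w₁ w₂)
        (trans (cong (λ s → s ⊗ (x ⊗ w₂ ⊕ ⊝ (y ⊗ w₁)) ⊗ ⊝ w₁ ⊕ (x ⊗ w₁ ⊕ y ⊗ w₂) ⊗ w₂) σ²≡1)
        (trans (solve 4 (λ x y w₁ w₂ → con 1ℤ :* (x :* w₂ :- y :* w₁) :* (⊖′ w₁) :+ (x :* w₁ :+ y :* w₂) :* w₂
            := (w₁ :* w₁ :+ w₂ :* w₂) :* y) refl x y w₁ w₂) (trans (cong (_⊗ y) |w|) (*-identityˡ y)))))

  -- An isometry is known to preserve only the quadratic form, so orthogonality enters through the
  -- length of u + w, and polarisation in odd characteristic recovers u·w = 0. Then σ = det u w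
  -- satisfies σ² = |u|²|w|² - (u·w)² = 1, and u has no component along w.
  orthonormal : ∀ u w → dot u u ≡ 𝟙 → dot w w ≡ 𝟙 → dot (u ⊞ w) (u ⊞ w) ≡ 𝟙 ⊕ 𝟙 → ∃ λ σ → σ ∈ signs × u ≡ rotate σ w
  orthonormal u@(u₁ , u₂) w@(w₁ , w₂) |u| |w| |u+w| = σ , square⇒sign σσ≡1 , cong₂ _,_
    (trans (sym (trans (cong (_⊗ u₁) |w|) (*-identityˡ u₁)))
      (trans (solve 4 (λ u₁ u₂ w₁ w₂ → (w₁ :* w₁ :+ w₂ :* w₂) :* u₁
          := (u₁ :* w₂ :- u₂ :* w₁) :* w₂ :+ (u₁ :* w₁ :+ u₂ :* w₂) :* w₁) refl u₁ u₂ w₁ w₂)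
        (trans (cong (λ s → σ ⊗ w₂ ⊕ s ⊗ w₁) uw≡0) (solve 2 (λ a b → a :+ con 0ℤ :* b := a) refl (σ ⊗ w₂) w₁))))
    (trans (sym (trans (cong (_⊗ u₂) |w|) (*-identityˡ u₂)))
      (trans (solve 4 (λ u₁ u₂ w₁ w₂ → (w₁ :* w₁ :+ w₂ :* w₂) :* u₂
          := (u₁ :* w₂ :- u₂ :* w₁) :* (⊖′ w₁) :+ (u₁ :* w₁ :+ u₂ :* w₂) :* w₂) refl u₁ u₂ w₁ w₂)
        (trans (cong (λ s → σ ⊗ ⊝ w₁ ⊕ s ⊗ w₂) uw≡0) (solve 2 (λ a b → a :+ con 0ℤ :* b := a) refl (σ ⊗ ⊝ w₁) w₂))))
    where
    σ : K
    σ = det u w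
    uw≡0 : dot u w ≡ 𝟘
    uw≡0 = noZeroDivisors (begin
      (𝟙 ⊕ 𝟙) ⊗ dot u w
        ≡⟨ solve 4 (λ u₁ u₂ w₁ w₂ → con (+ 2) :* (u₁ :* w₁ :+ u₂ :* w₂)
             := ((u₁ :+ w₁) :* (u₁ :+ w₁) :+ (u₂ :+ w₂) :* (u₂ :+ w₂)) :- (u₁ :* u₁ :+ u₂ :* u₂) :- (w₁ :* w₁ :+ w₂ :* w₂))
             refl u₁ u₂ w₁ w₂ ⟩
      dot (u ⊞ w) (u ⊞ w) ⊕ ⊝ dot u u ⊕ ⊝ dot w w
        ≡⟨ cong₂ (λ a b → a ⊕ ⊝ b) (cong₂ (λ a b → a ⊕ ⊝ b) |u+w| |u|) |w| ⟩
      𝟙 ⊕ 𝟙 ⊕ ⊝ 𝟙 ⊕ ⊝ 𝟙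
        ≡⟨ solve 0 (con 1ℤ :+ con 1ℤ :- con 1ℤ :- con 1ℤ := con 0ℤ) refl ⟩
      𝟘 ∎) 2≢0
    σσ≡1 : σ ⊗ σ ≡ 𝟙
    σσ≡1 = begin
      det u w ⊗ det u w
        ≡⟨ solve 4 (λ u₁ u₂ v₁ v₂ → (u₁ :* v₂ :- u₂ :* v₁) :* (u₁ :* v₂ :- u₂ :* v₁)
             := (u₁ :* u₁ :+ u₂ :* u₂) :* (v₁ :* v₁ :+ v₂ :* v₂) :- (u₁ :* v₁ :+ u₂ :* v₂) :* (u₁ :* v₁ :+ u₂ :* v₂))
             refl u₁ u₂ w₁ w₂ ⟩
      dot u u ⊗ dot w w ⊕ ⊝ (dot u w ⊗ dot u w)
        ≡⟨ cong₂ (λ a b → a ⊕ ⊝ b) (cong₂ _⊗_ |u| |w|) (cong₂ _⊗_ uw≡0 uw≡0) ⟩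
      𝟙 ⊗ 𝟙 ⊕ ⊝ (𝟘 ⊗ 𝟘)
        ≡⟨ solve 0 (con 1ℤ :* con 1ℤ :- con 0ℤ :* con 0ℤ := con 1ℤ) refl ⟩
      𝟙 ∎

  dot-e₁ : dot (𝟙 , 𝟘) (𝟙 , 𝟘) ≡ 𝟙
  dot-e₁ = solve 0 (con 1ℤ :* con 1ℤ :+ con 0ℤ :* con 0ℤ := con 1ℤ) refl

  dot-e₂ : dot (𝟘 , 𝟙) (𝟘 , 𝟙) ≡ 𝟙
  dot-e₂ = solve 0 (con 0ℤ :* con 0ℤ :+ con 1ℤ :* con 1ℤ := con 1ℤ) refl

  dot-e₁+e₂ : dot ((𝟙 , 𝟘) ⊞ (𝟘 , 𝟙)) ((𝟙 , 𝟘) ⊞ (𝟘 , 𝟙)) ≡ 𝟙 ⊕ 𝟙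
  dot-e₁+e₂ = solve 0 ((con 1ℤ :+ con 0ℤ) :* (con 1ℤ :+ con 0ℤ) :+ (con 0ℤ :+ con 1ℤ) :* (con 0ℤ :+ con 1ℤ) := con 1ℤ :+ con 1ℤ) refl

-- Moments

module Moments (𝔽 : FiniteField) (2≢0 : FiniteField.OddCharacteristic 𝔽)
  (𝐀 𝐁 : List (FiniteField.K 𝔽)) (𝐀-unique : Unique 𝐀) (𝐁-unique : Unique 𝐁) where

  open Isometries 𝔽 2≢0 public
  open IntegerCoefficients commutativeRing using (module Solver)
  open Solver using (solve; _:=_; _:+_; _:*_; _:-_; con) renaming (:-_ to ⊖′_)
  open Finite finitePt using (δ; 0≤δ; δ-⇔; ∑-δ; ∑-δ-1)
  open ℤ.≤-Reasoning

  𝐄 : List Pt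
  𝐄 = cartesianProduct 𝐀 𝐁

  𝐄-unique : Unique 𝐄
  𝐄-unique = Unique.cartesianProduct⁺ 𝐀-unique 𝐁-unique

  a b : ℤ
  a = + length 𝐀
  b = + length 𝐁

  0≤a : 0ℤ ≤ a
  0≤a = 0≤-+n
  0≤b : 0ℤ ≤ b
  0≤b = 0≤-+n

  |𝐄| : + length 𝐄 ≡ a * b
  |𝐄| = length-cartesianProduct 𝐀 𝐁

  χ : Pt → ℤ
  χ z = ∑[ e ← 𝐄 ] δ e z

  0≤χ : ∀ z → 0ℤ ≤ χ z
  0≤χ z = ∑-nonNeg 𝐄 λ e → 0≤δ e z

  χ≤1 : ∀ z → χ z ≤ 1ℤ
  χ≤1 z = begin
    (∑[ e ← 𝐄 ] δ e z)     ≡⟨ ∑-cong 𝐄 (λ e → δ-⇔ sym sym) ⟩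
    (∑[ e ← 𝐄 ] δ z e)     ≤⟨ ∑-⊆ 𝐄-unique (λ _ → Finite.complete finitePt _) (0≤δ z) ⟩
    (∑[ e ← pts ] δ z e)   ≡⟨ ∑-δ-1 z ⟩
    1ℤ ∎

  ∑χ : ∑ pts χ ≡ a * b
  ∑χ = begin-equality
    (∑[ z ← pts ] ∑[ e ← 𝐄 ] δ e z)   ≡⟨ ∑-swap pts 𝐄 (λ z e → δ e z) ⟩
    (∑[ e ← 𝐄 ] ∑[ z ← pts ] δ e z)   ≡⟨ ∑-cong 𝐄 ∑-δ-1 ⟩
    (∑[ e ← 𝐄 ] 1ℤ)                   ≡⟨ trans (∑-1 𝐄) |𝐄| ⟩
    a * b ∎

  hits : Pt → Pt → ℤ
  hits w z = ∑[ t ← 𝐁 ] χ (z ⊞ t · w)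

  -- The mean of `hits w` is a b² / q²; the factor q² keeps the deviation an integer.
  discrepancy : Pt → Pt → ℤ
  discrepancy w z = q * q * hits w z - a * b * b

  ∑-hits : ∀ w → ∑ pts (hits w) ≡ a * b * b
  ∑-hits w = begin-equality
    (∑[ z ← pts ] ∑[ t ← 𝐁 ] χ (z ⊞ t · w))   ≡⟨ ∑-swap pts 𝐁 (λ z t → χ (z ⊞ t · w)) ⟩
    (∑[ t ← 𝐁 ] ∑[ z ← pts ] χ (z ⊞ t · w))   ≡⟨ ∑-cong 𝐁 (λ t → trans (∑-translate (t · w) χ) ∑χ) ⟩
    (∑[ t ← 𝐁 ] a * b)                        ≡⟨ trans (∑-const 𝐁 (a * b)) (ℤ.*-comm b (a * b)) ⟩
    a * b * b ∎

  |pts| : + length pts ≡ q * q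
  |pts| = length-cartesianProduct κ κ

  ∑-discrepancy : ∀ w → ∑ pts (discrepancy w) ≡ 0ℤ
  ∑-discrepancy w = begin-equality
    (∑[ z ← pts ] q * q * hits w z - a * b * b)
      ≡⟨ ∑-+ pts (λ z → q * q * hits w z) (λ _ → - (a * b * b)) ⟩
    (∑[ z ← pts ] q * q * hits w z) + (∑[ _ ← pts ] - (a * b * b))
      ≡⟨ cong₂ _+_ (trans (∑-*ˡ pts (q * q) (hits w)) (cong (q * q *_) (∑-hits w)))
           (trans (∑-const pts (- (a * b * b))) (cong (_* - (a * b * b)) |pts|)) ⟩
    q * q * (a * b * b) + q * q * - (a * b * b)
      ≡⟨ lem (q * q) (a * b * b) ⟩
    0ℤ ∎
    where
    lem : ∀ x y → x * y + x * - y ≡ 0ℤ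
    lem = solve-∀

  -- The adjoint form of `hits`: `e ⊟ t · w` is the base point of the line in direction (w , 1)
  -- through the point (e , t) of E × B.
  ⟪,hits⟫ : ∀ w f → ⟪ f , hits w ⟫ ≡ (∑[ t ← 𝐁 ] ∑[ e ← 𝐄 ] f (e ⊟ t · w))
  ⟪,hits⟫ w f = begin-equality
    ⟪ f , hits w ⟫
      ≡⟨ ⟪⟫-∑ʳ 𝐁 f (λ t z → χ (z ⊞ t · w)) ⟩
    (∑[ t ← 𝐁 ] ⟪ f , (λ z → χ (z ⊞ t · w)) ⟫)
      ≡⟨ ∑-cong 𝐁 (λ t → trans (⟪⟫-∑ʳ 𝐄 f (λ e z → δ e (z ⊞ t · w))) (∑-cong 𝐄 λ e →
           trans (∑-cong pts λ z → trans (ℤ.*-comm (f z) (δ e (z ⊞ t · w))) (cong (_* f z) (δ-⇔ (to e t z) (from e t z))))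
                 (∑-δ (e ⊟ t · w) f))) ⟩
    (∑[ t ← 𝐁 ] ∑[ e ← 𝐄 ] f (e ⊟ t · w)) ∎
    where
    to : ∀ e t z → e ≡ z ⊞ t · w → e ⊟ t · w ≡ z
    to _ t (z₁ , z₂) refl = cong₂ _,_ (lem z₁ (t ⊗ proj₁ w)) (lem z₂ (t ⊗ proj₂ w))
      where
      lem : ∀ z a → z ⊕ a ⊕ ⊝ a ≡ z
      lem = solve 2 (λ z a → z :+ a :- a := z) refl
    from : ∀ e t z → e ⊟ t · w ≡ z → e ≡ z ⊞ t · w
    from (e₁ , e₂) t _ refl = cong₂ _,_ (lem e₁ (t ⊗ proj₁ w)) (lem e₂ (t ⊗ proj₂ w))
      where
      lem : ∀ z a → z ≡ z ⊕ ⊝ a ⊕ a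
      lem = solve 2 (λ z a → z := z :- a :+ a) refl

  variance : ℤ
  variance = ∑[ w ← circle ] ∥ discrepancy w ∥²

  -- The discrepancies of all lines, each counted as often as it meets E × B.
  total : ℤ
  total = ∑[ t ← 𝐁 ] ∑[ e ← 𝐄 ] incident discrepancy t e

  -- A function of mean zero is orthogonal to constants, so the mean may be dropped from one of the
  -- two factors.
  ∥discrepancy∥² : ∀ w → ∥ discrepancy w ∥² ≡ q * q * ⟪ discrepancy w , hits w ⟫
  ∥discrepancy∥² w = begin-equality
    (∑[ z ← pts ] d z * (q * q * hits w z - a * b * b))
      ≡⟨ ∑-cong pts (λ z → lem (d z) (q * q) (hits w z) (a * b * b)) ⟩
    (∑[ z ← pts ] q * q * (d z * hits w z) + - (a * b * b) * d z)
      ≡⟨ ∑-+ pts (λ z → q * q * (d z * hits w z)) (λ z → - (a * b * b) * d z) ⟩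
    (∑[ z ← pts ] q * q * (d z * hits w z)) + (∑[ z ← pts ] - (a * b * b) * d z)
      ≡⟨ cong₂ _+_ (∑-*ˡ pts (q * q) (λ z → d z * hits w z))
           (trans (∑-*ˡ pts (- (a * b * b)) d) (trans (cong (- (a * b * b) *_) (∑-discrepancy w)) (ℤ.*-zeroʳ (- (a * b * b))))) ⟩
    q * q * ⟪ d , hits w ⟫ + 0ℤ
      ≡⟨ ℤ.+-identityʳ _ ⟩
    q * q * ⟪ d , hits w ⟫ ∎
    where
    d = discrepancy w
    lem : ∀ d q h m → d * (q * h - m) ≡ q * (d * h) + - m * d
    lem = solve-∀

  variance-total : variance ≡ q * q * total
  variance-total = begin-equality
    (∑[ w ← circle ] ∥ discrepancy w ∥²)
      ≡⟨ ∑-cong circle (λ w → trans (∥discrepancy∥² w) (cong (q * q *_) (⟪,hits⟫ w (discrepancy w)))) ⟩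
    (∑[ w ← circle ] q * q * (∑[ t ← 𝐁 ] ∑[ e ← 𝐄 ] discrepancy w (e ⊟ t · w)))
      ≡⟨ ∑-*ˡ circle (q * q) (λ w → ∑[ t ← 𝐁 ] ∑[ e ← 𝐄 ] discrepancy w (e ⊟ t · w)) ⟩
    q * q * (∑[ w ← circle ] ∑[ t ← 𝐁 ] ∑[ e ← 𝐄 ] discrepancy w (e ⊟ t · w))
      ≡⟨ cong (q * q *_) (trans (∑-swap circle 𝐁 (λ w t → ∑[ e ← 𝐄 ] discrepancy w (e ⊟ t · w)))
           (∑-cong 𝐁 λ t → ∑-swap circle 𝐄 (λ w e → discrepancy w (e ⊟ t · w)))) ⟩
    q * q * total ∎

  -- Cauchy-Schwarz over the a b² points of E × B. The squares are nonnegative, so their sum may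
  -- then be extended to all of F³, where `incident-bound` applies.
  total-bound : total * total ≤ a * b * b * (+ 2 * q * variance)
  total-bound = begin
    total * total
      ≤⟨ ∑-²≤ 𝐁 (λ t → ∑[ e ← 𝐄 ] T t e) ⟩
    b * (∑[ t ← 𝐁 ] (∑[ e ← 𝐄 ] T t e) * (∑[ e ← 𝐄 ] T t e))
      ≤⟨ *-monoˡ-≤ 0≤b (∑-mono 𝐁 λ t → ∑-²≤ 𝐄 (T t)) ⟩
    b * (∑[ t ← 𝐁 ] + length 𝐄 * (∑[ e ← 𝐄 ] T t e * T t e))
      ≡⟨ cong (b *_) (trans (∑-*ˡ 𝐁 (+ length 𝐄) (λ t → ∑[ e ← 𝐄 ] T t e * T t e)) (cong (_* (∑[ t ← 𝐁 ] ∑[ e ← 𝐄 ] T t e * T t e)) |𝐄|)) ⟩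
    b * (a * b * (∑[ t ← 𝐁 ] ∑[ e ← 𝐄 ] T t e * T t e))
      ≡⟨ lem a b _ ⟩
    a * b * b * (∑[ t ← 𝐁 ] ∑[ e ← 𝐄 ] T t e * T t e)
      ≤⟨ *-monoˡ-≤ 0≤abb (∑-mono 𝐁 λ t → ∑-⊆ 𝐄-unique (λ _ → Finite.complete finitePt _) (λ e → 0≤-² (T t e))) ⟩
    a * b * b * (∑[ t ← 𝐁 ] ∥ T t ∥²)
      ≤⟨ *-monoˡ-≤ 0≤abb (∑-⊆ 𝐁-unique (λ _ → Finite.complete finite _) (λ t → 0≤∥∥² (T t))) ⟩
    a * b * b * (∑[ t ← κ ] ∥ T t ∥²)
      ≤⟨ *-monoˡ-≤ 0≤abb (incident-bound discrepancy ∑-discrepancy) ⟩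
    a * b * b * (+ 2 * q * variance) ∎
    where
    T : K → Pt → ℤ
    T = incident discrepancy
    0≤abb : 0ℤ ≤ a * b * b
    0≤abb = 0≤-* (0≤-* 0≤a 0≤b) 0≤b
    lem : ∀ a b s → b * (a * b * s) ≡ a * b * b * s
    lem = solve-∀

  -- `total` is `variance` divided by q², and `total-bound` estimates its square by a multiple of
  -- `variance`; one factor `variance` cancels.
  variance-bound : variance ≤ + 2 * (q * q * q * q * q) * (a * b * b)
  variance-bound = *-cancel-square (∑-nonNeg circle λ w → 0≤∥∥² (discrepancy w))
    (0≤-* (0≤-* (0≤-+n {2}) (0≤-* (0≤-* (0≤-* (0≤-² q) 0≤q) 0≤q) 0≤q)) (0≤-* (0≤-* 0≤a 0≤b) 0≤b))
    (begin
      variance * variance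
        ≡⟨ trans (cong₂ _*_ variance-total variance-total) (lem₁ q total) ⟩
      q * q * (q * q) * (total * total)
        ≤⟨ *-monoˡ-≤ (0≤-* (0≤-² q) (0≤-² q)) total-bound ⟩
      q * q * (q * q) * (a * b * b * (+ 2 * q * variance))
        ≡⟨ lem₂ q (a * b * b) variance ⟩
      + 2 * (q * q * q * q * q) * (a * b * b) * variance ∎)
    where
    lem₁ : ∀ q t → q * q * t * (q * q * t) ≡ q * q * (q * q) * (t * t)
    lem₁ = solve-∀
    lem₂ : ∀ q m v → q * q * (q * q) * (m * (+ 2 * q * v)) ≡ + 2 * (q * q * q * q * q) * m * v
    lem₂ = solve-∀

  -- Motions and their third moment

  ν : Pt → K → Pt → ℤ
  ν w σ z = ∑[ e ← 𝐄 ] χ (move w σ z e)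

  0≤ν : ∀ w σ z → 0ℤ ≤ ν w σ z
  0≤ν w σ z = ∑-nonNeg 𝐄 λ e → 0≤χ (move w σ z e)

  ν≤ : ∀ w σ z → ν w σ z ≤ a * b
  ν≤ w σ z = begin
    ν w σ z            ≤⟨ ∑-mono 𝐄 (λ e → χ≤1 (move w σ z e)) ⟩
    (∑[ e ← 𝐄 ] 1ℤ)    ≡⟨ trans (∑-1 𝐄) |𝐄| ⟩
    a * b ∎

  excess : Pt → K → Pt → ℤ
  excess w σ z = q * q * ν w σ z - a * b * (a * b)

  excess-discrepancy : ∀ w σ z → excess w σ z ≡ (∑[ x ← 𝐀 ] discrepancy w (z ⊞ x · rotate σ w))
  excess-discrepancy w σ z = sym (begin-equality
    (∑[ x ← 𝐀 ] q * q * h x - a * b * b)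
      ≡⟨ ∑-+ 𝐀 (λ x → q * q * h x) (λ _ → - (a * b * b)) ⟩
    (∑[ x ← 𝐀 ] q * q * h x) + (∑[ _ ← 𝐀 ] - (a * b * b))
      ≡⟨ cong₂ _+_ (∑-*ˡ 𝐀 (q * q) h) (∑-const 𝐀 (- (a * b * b))) ⟩
    q * q * (∑[ x ← 𝐀 ] h x) + a * - (a * b * b)
      ≡⟨ cong₂ (λ s t → q * q * s + t) (sym (∑-cartesianProduct 𝐀 𝐁 (λ e → χ (move w σ z e)))) (lem a b) ⟩
    excess w σ z ∎)
    where
    h : K → ℤ
    h x = hits w (z ⊞ x · rotate σ w)
    lem : ∀ a b → a * - (a * b * b) ≡ - (a * b * (a * b))
    lem = solve-∀

  -- By Cauchy-Schwarz over x in A; each x only translates `discrepancy w`, so all of them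
  -- contribute the same norm.
  ∥excess∥² : ∀ w σ → ∥ excess w σ ∥² ≤ a * a * ∥ discrepancy w ∥²
  ∥excess∥² w σ = begin
    ∥ excess w σ ∥²
      ≡⟨ ∑-cong pts (λ z → cong₂ _*_ (excess-discrepancy w σ z) (excess-discrepancy w σ z)) ⟩
    (∑[ z ← pts ] (∑[ x ← 𝐀 ] d x z) * (∑[ x ← 𝐀 ] d x z))
      ≤⟨ ∑-mono pts (λ z → ∑-²≤ 𝐀 (λ x → d x z)) ⟩
    (∑[ z ← pts ] a * (∑[ x ← 𝐀 ] d x z * d x z))
      ≡⟨ trans (∑-*ˡ pts a (λ z → ∑[ x ← 𝐀 ] d x z * d x z)) (cong (a *_) (∑-swap pts 𝐀 (λ z x → d x z * d x z))) ⟩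
    a * (∑[ x ← 𝐀 ] ∥ d x ∥²)
      ≡⟨ cong (a *_) (trans (∑-cong 𝐀 λ x → ∑-translate (x · rotate σ w) (λ z → discrepancy w z * discrepancy w z))
           (∑-const 𝐀 ∥ discrepancy w ∥²)) ⟩
    a * (a * ∥ discrepancy w ∥²)
      ≡⟨ ℤ.*-assoc a a _ ⟨
    a * a * ∥ discrepancy w ∥² ∎
    where
    d : K → Pt → ℤ
    d x z = discrepancy w (z ⊞ x · rotate σ w)

  third-moment : ℤ
  third-moment = ∑[ w ← circle ] ∑[ σ ← signs ] ∑[ z ← pts ] ν w σ z * ν w σ z * ν w σ z

  -- The power q⁶ clears the denominator of (|E|² / q²)³. The 32 is the 8 of `cube-bound` times two
  -- signs times the 2 of `circle-size`; the 16 is the 4 of `cube-bound` times two signs times the 2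
  -- of `variance-bound`.
  third-moment-bound : q * q * q * q * q * q * third-moment ≤
    + 32 * (q * q * q * (a * b * (a * b) * (a * b * (a * b)) * (a * b * (a * b)))) + + 16 * (q * q * (q * q * q * q * q) * (a * b * (a * a) * (a * b * b)))
  third-moment-bound = begin
    q * q * q * q * q * q * third-moment
      ≡⟨ trans (sym (∑-*ˡ circle q⁶ (λ w → ∑[ σ ← signs ] ∑[ z ← pts ] ν w σ z * ν w σ z * ν w σ z)))
           (∑-cong circle λ w → trans (sym (∑-*ˡ signs q⁶ (λ σ → ∑[ z ← pts ] ν w σ z * ν w σ z * ν w σ z)))
           (∑-cong signs λ σ → sym (∑-*ˡ pts q⁶ (λ z → ν w σ z * ν w σ z * ν w σ z)))) ⟩
    (∑[ w ← circle ] ∑[ σ ← signs ] ∑[ z ← pts ] q⁶ * (ν w σ z * ν w σ z * ν w σ z))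
      ≤⟨ ∑-mono circle (λ w → ∑-mono signs λ σ → ∑-mono pts (pointwise w σ)) ⟩
    (∑[ w ← circle ] ∑[ σ ← signs ] ∑[ z ← pts ] M + c * (excess w σ z * excess w σ z))
      ≡⟨ ∑-cong circle (λ w → ∑-cong signs λ σ → trans (∑-+ pts (λ _ → M) (λ z → c * (excess w σ z * excess w σ z)))
           (cong₂ _+_ (trans (∑-const pts M) (cong (_* M) |pts|)) (∑-*ˡ pts c (λ z → excess w σ z * excess w σ z)))) ⟩
    (∑[ w ← circle ] ∑[ σ ← signs ] q * q * M + c * ∥ excess w σ ∥²)
      ≤⟨ ∑-mono circle (λ w → ∑-mono signs λ σ → ℤ.+-monoʳ-≤ (q * q * M) (*-monoˡ-≤ 0≤c (∥excess∥² w σ))) ⟩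
    (∑[ w ← circle ] ∑[ σ ← signs ] q * q * M + c * (a * a * ∥ discrepancy w ∥²))
      ≡⟨ ∑-cong circle (λ w → trans (∑-const signs (q * q * M + c * (a * a * ∥ discrepancy w ∥²))) (lem₁ (q * q) M c (a * a) ∥ discrepancy w ∥²)) ⟩
    (∑[ w ← circle ] + 2 * (q * q * M) + + 2 * (c * (a * a)) * ∥ discrepancy w ∥²)
      ≡⟨ trans (∑-+ circle (λ _ → + 2 * (q * q * M)) (λ w → + 2 * (c * (a * a)) * ∥ discrepancy w ∥²))
           (cong₂ _+_ (trans (∑-const circle (+ 2 * (q * q * M))) (ℤ.*-comm _ (+ 2 * (q * q * M)))) (∑-*ˡ circle (+ 2 * (c * (a * a))) (λ w → ∥ discrepancy w ∥²))) ⟩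
    + 2 * (q * q * M) * + length circle + + 2 * (c * (a * a)) * variance
      ≤⟨ ℤ.+-mono-≤ (*-monoˡ-≤ (0≤-* (0≤-+n {2}) (0≤-* (0≤-² q) 0≤M)) circle-size)
           (*-monoˡ-≤ (0≤-* (0≤-+n {2}) (0≤-* 0≤c (0≤-² a))) variance-bound) ⟩
    + 2 * (q * q * M) * (+ 2 * q) + + 2 * (c * (a * a)) * (+ 2 * (q * q * q * q * q) * (a * b * b))
      ≡⟨ cong₂ _+_ (lem₂ q (m * m * m)) (lem₃ (q * q) (a * b) (a * a) (q * q * q * q * q) (a * b * b)) ⟩
    + 32 * (q * q * q * (a * b * (a * b) * (a * b * (a * b)) * (a * b * (a * b)))) + + 16 * (q * q * (q * q * q * q * q) * (a * b * (a * a) * (a * b * b))) ∎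
    where
    q⁶ m M c : ℤ
    q⁶ = q * q * q * q * q * q
    m = a * b * (a * b)
    M = + 8 * (m * m * m)
    c = + 4 * (q * q * (a * b))
    0≤m : 0ℤ ≤ m
    0≤m = 0≤-² (a * b)
    0≤M : 0ℤ ≤ M
    0≤M = 0≤-* (0≤-+n {8}) (0≤-* (0≤-² m) 0≤m)
    0≤c : 0ℤ ≤ c
    0≤c = 0≤-* (0≤-+n {4}) (0≤-* (0≤-² q) (0≤-* 0≤a 0≤b))
    pointwise : ∀ w σ z → q⁶ * (ν w σ z * ν w σ z * ν w σ z) ≤ M + c * (excess w σ z * excess w σ z)
    pointwise w σ z = begin
      q⁶ * (n * n * n)
        ≡⟨ lem q n ⟩
      q * q * n * (q * q * n) * (q * q * n)
        ≤⟨ cube-bound {q * q * n} {m} (0≤-* (0≤-² q) (0≤ν w σ z)) 0≤m ⟩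
      M + + 4 * (q * q * n * (excess w σ z * excess w σ z))
        -- The trivial bound ν ≤ |E| removes the third factor, so that the mean square of `excess`
        -- suffices.
        ≤⟨ ℤ.+-monoʳ-≤ M (*-monoˡ-≤ (0≤-+n {4}) (*-mono-≤ {q * q * n} {q * q * (a * b)} (0≤-* (0≤-² q) (0≤-* 0≤a 0≤b)) (0≤-² (excess w σ z))
             (*-monoˡ-≤ (0≤-² q) (ν≤ w σ z)) ℤ.≤-refl)) ⟩
      M + + 4 * (q * q * (a * b) * (excess w σ z * excess w σ z))
        ≡⟨ cong (_+_ M) (sym (ℤ.*-assoc (+ 4) (q * q * (a * b)) (excess w σ z * excess w σ z))) ⟩
      M + c * (excess w σ z * excess w σ z) ∎
      where
      n = ν w σ z
      lem : ∀ q n → q * q * q * q * q * q * (n * n * n) ≡ q * q * n * (q * q * n) * (q * q * n)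
      lem = solve-∀
    lem₁ : ∀ q M c a d → + 2 * (q * M + c * (a * d)) ≡ + 2 * (q * M) + + 2 * (c * a) * d
    lem₁ = solve-∀
    lem₂ : ∀ q m → + 2 * (q * q * (+ 8 * m)) * (+ 2 * q) ≡ + 32 * (q * q * q * m)
    lem₂ = solve-∀
    lem₃ : ∀ q e α x s → + 2 * (+ 4 * (q * e) * α) * (+ 2 * x * s) ≡ + 16 * (q * x * (e * α * s))
    lem₃ = solve-∀

-- Counting classes

module Classes {c ℓ : Level} (S : Setoid c ℓ) {J : Set} (js : List J) (h : J → Setoid.Carrier S)
  (_≟_ : ∀ i j → Dec (Setoid._≈_ S (h i) (h j)))
  (surjective : ∀ s → ∃ λ j → j ∈ js × Setoid._≈_ S s (h j)) where

  open Setoid S using (Carrier; _≈_) renaming (refl to ≈-refl; sym to ≈-sym; trans to ≈-trans)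

  decSetoid : DecSetoid _ _
  decSetoid = record
    { isDecEquivalence = record
      { isEquivalence = Setoid.isEquivalence (On.setoid S h)
      ; _≟_           = _≟_
      }
    }

  reps : List J
  reps = deduplicate _≟_ js

  Inequivalent : List J → Set ℓ
  Inequivalent = AllPairs λ i j → ¬ h i ≈ h j

  reps-inequivalent : Inequivalent reps
  reps-inequivalent = UniqueDecSetoid.deduplicate-! decSetoid js

  represented : ∀ s → Any (λ j → s ≈ h j) reps
  represented s with j , j∈js , s≈hj ← surjective s =
    Any.deduplicate⁺ _≟_ (λ hy≈hx s≈hx → ≈-trans s≈hx (≈-sym hy≈hx)) (lose j∈js s≈hj)

  index-unique : ∀ {js s} → Inequivalent js → ∀ i j → s ≈ h (lookup js i) → s ≈ h (lookup js j) → i ≡ j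
  index-unique (_ ∷ _)  zero    zero    _ _ = ≡.refl
  index-unique {_ ∷ js} (p ∷ _)  zero    (suc j) s≈i s≈j = contradiction (≈-trans (≈-sym s≈i) s≈j) (All.lookup p (∈-lookup {xs = js} j))
  index-unique {_ ∷ js} (p ∷ _)  (suc i) zero    s≈i s≈j = contradiction (≈-trans (≈-sym s≈j) s≈i) (All.lookup p (∈-lookup {xs = js} i))
  index-unique (_ ∷ ps) (suc i) (suc j) s≈i s≈j = ≡.cong suc (index-unique ps i j s≈i s≈j)

  hasCardinality : HasCardinality S (length reps)
  hasCardinality = record
    { to        = to
    ; from      = from
    ; to-cong   = λ {s} {s′} s≈s′ → index-unique reps-inequivalent (to s) (to s′) (from-to s) (≈-trans s≈s′ (from-to s′))
    ; from-cong = λ { ≡.refl → ≈-refl }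
    ; inverse   = (λ {i} {s} s≈ → index-unique reps-inequivalent (to s) i (from-to s) s≈)
                , (λ { {s} ≡.refl → ≈-sym (from-to s) })
    }
    where
    to : Carrier → Fin (length reps)
    to s = Any.index (represented s)
    from : Fin (length reps) → Carrier
    from i = h (lookup reps i)
    from-to : ∀ s → s ≈ from (to s)
    from-to s = Any.lookup-index (represented s)

  ι : J → J → ℤ
  ι i j with i ≟ j
  ... | yes _ = 1ℤ
  ... | no  _ = 0ℤ

  0≤ι : ∀ i j → 0ℤ ≤ ι i j
  0≤ι i j with i ≟ j
  ... | yes _ = 0≤-+n
  ... | no  _ = ℤ.≤-refl

  ι-yes : ∀ {i j} → h i ≈ h j → ι i j ≡ 1ℤ
  ι-yes {i} {j} i≈j with i ≟ j
  ... | yes _   = ≡.refl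
  ... | no  i≉j = contradiction i≈j i≉j

  ι-no : ∀ {i j} → ¬ h i ≈ h j → ι i j ≡ 0ℤ
  ι-no {i} {j} i≉j with i ≟ j
  ... | yes i≈j = contradiction i≈j i≉j
  ... | no  _   = ≡.refl

  1≤∑ι : ∀ {rs i} → Any (λ r → h i ≈ h r) rs → 1ℤ ≤ ∑ rs (ι i)
  1≤∑ι {r ∷ rs} {i} (here i≈r) =
    ≡.subst (λ x → 1ℤ ≤ x + ∑ rs (ι i)) (≡.sym (ι-yes i≈r)) (ℤ.+-monoʳ-≤ 1ℤ (∑-nonNeg rs (0≤ι i)))
  1≤∑ι {r ∷ rs} {i} (there p) = ℤ.≤-trans (1≤∑ι p) (≡.subst (_≤ ι i r + ∑ rs (ι i)) (ℤ.+-identityˡ _) (ℤ.+-monoˡ-≤ (∑ rs (ι i)) (0≤ι i r)))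

  ∑ι≡0 : ∀ {rs i} → All (λ r → ¬ h i ≈ h r) rs → ∑ rs (ι i) ≡ 0ℤ
  ∑ι≡0 []       = ≡.refl
  ∑ι≡0 (p ∷ ps) = ≡.cong₂ _+_ (ι-no p) (∑ι≡0 ps)

  -- Inequivalent representatives cannot share a member: once i is equivalent to r, all later
  -- indicators vanish.
  ∑ι≤1 : ∀ {rs i} → Inequivalent rs → ∑ rs (ι i) ≤ 1ℤ
  ∑ι≤1 []                    = 0≤-+n
  ∑ι≤1 {r ∷ rs} {i} (p ∷ ps) with i ≟ r
  ... | yes i≈r = ℤ.≤-reflexive (≡.cong (_+_ 1ℤ) (∑ι≡0 (All.map (λ r≉ i≈ → r≉ (≈-trans (≈-sym i≈r) i≈)) p)))
  ... | no  _   = ≡.subst (_≤ 1ℤ) (≡.sym (ℤ.+-identityˡ _)) (∑ι≤1 ps)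

  ι*ι≤ι : ∀ i j r → ι i r * ι j r ≤ ι i r
  ι*ι≤ι i j r with i ≟ r | j ≟ r
  ... | yes _ | yes _ = ℤ.≤-refl
  ... | yes _ | no  _ = 0≤-+n
  ... | no  _ | yes _ = ℤ.≤-refl
  ... | no  _ | no  _ = ℤ.≤-refl

  ι*ι≡0 : ∀ i j r → ¬ h i ≈ h j → ι i r * ι j r ≡ 0ℤ
  ι*ι≡0 i j r i≉j with i ≟ r | j ≟ r
  ... | yes i≈r | yes j≈r = contradiction (≈-trans i≈r (≈-sym j≈r)) i≉j
  ... | yes _ | no  _ = ≡.refl
  ... | no  _ | yes _ = ≡.refl
  ... | no  _ | no  _ = ≡.refl

  -- Cauchy-Schwarz for the class sizes: they add up to at least the length of `js`, and their
  -- squares add up to the number of equivalent pairs. `M` needs only to majorise the indicator of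
  -- equivalence, so a pair may be counted once for every motion relating it.
  count-classes : (M : J → J → ℤ) → (∀ i j → 0ℤ ≤ M i j) → (∀ i j → h i ≈ h j → 1ℤ ≤ M i j) →
    + length js * + length js ≤ + length reps * (∑[ i ← js ] ∑[ j ← js ] M i j)
  count-classes M 0≤M 1≤M = begin
    + length js * + length js
      ≤⟨ *-mono-≤ 0≤s 0≤-+n size≤ size≤ ⟩
    (∑[ r ← reps ] class r) * (∑[ r ← reps ] class r)
      ≤⟨ ∑-²≤ reps class ⟩
    + length reps * (∑[ r ← reps ] class r * class r)
      ≡⟨ ≡.cong (+ length reps *_) (≡.trans
           (∑-cong reps λ r → ∑-*-∑ js js (λ i → ι i r) (λ i → ι i r))
           (≡.trans (∑-swap reps js (λ r i → ∑[ j ← js ] ι i r * ι j r))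
             (∑-cong js λ i → ∑-swap reps js (λ r j → ι i r * ι j r)))) ⟩
    + length reps * (∑[ i ← js ] ∑[ j ← js ] ∑[ r ← reps ] ι i r * ι j r)
      ≤⟨ *-monoˡ-≤ (0≤-+n {length reps}) (∑-mono js λ i → ∑-mono js λ j → common i j) ⟩
    + length reps * (∑[ i ← js ] ∑[ j ← js ] M i j) ∎
    where
    open ℤ.≤-Reasoning
    class : J → ℤ
    class r = ∑[ i ← js ] ι i r
    0≤s : 0ℤ ≤ ∑ reps class
    0≤s = ∑-nonNeg reps λ r → ∑-nonNeg js λ i → 0≤ι i r
    size≤ : + length js ≤ ∑ reps class
    size≤ = begin
      + length js                         ≡⟨ ℤ.*-identityʳ _ ⟨
      + length js * 1ℤ                    ≡⟨ ∑-const js 1ℤ ⟨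
      (∑[ i ← js ] 1ℤ)                    ≤⟨ ∑-mono js (λ i → 1≤∑ι (represented (h i))) ⟩
      (∑[ i ← js ] ∑[ r ← reps ] ι i r)   ≡⟨ ∑-swap js reps ι ⟩
      ∑ reps class ∎
    common : ∀ i j → (∑[ r ← reps ] ι i r * ι j r) ≤ M i j
    common i j with i ≟ j
    ... | yes i≈j = ℤ.≤-trans (∑-mono reps (ι*ι≤ι i j)) (ℤ.≤-trans (∑ι≤1 reps-inequivalent) (1≤M i j i≈j))
    ... | no  i≉j = ≡.subst (_≤ M i j) (≡.sym (∑-zero reps λ r → ι*ι≡0 i j r i≉j)) (0≤M i j)

-- Fields of odd order and their copies with propositional equality

odd-prime-power : ∀ p r → Prime p → p ≢ 2 → ¬ 2 ∣ p ℕ.^ r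
odd-prime-power p zero    _  _   2∣1 with () ← ∣1⇒≡1 2∣1
odd-prime-power p (suc r) pr p≢2 2∣pʳ with euclidsLemma p (p ℕ.^ r) prime[2] 2∣pʳ
... | inj₂ 2∣p^r = odd-prime-power p r pr p≢2 2∣p^r
... | inj₁ 2∣p with prime⇒irreducible pr 2∣p
...   | inj₂ 2≡p = p≢2 (sym 2≡p)

odd⇒1+2k : ∀ n → ¬ 2 ∣ n → ∃ λ k → n ≡ suc (k ℕ.+ k)
odd⇒1+2k n 2∤n with n % 2 in eq | m%n<n n 2 | m≡m%n+[m/n]*n n 2
... | 0 | _ | _ = contradiction (m%n≡0⇒n∣m n 2 eq) 2∤n
... | 1 | _ | n≡ = n / 2 , trans n≡ (cong suc (trans (ℕ.*-comm (n / 2) 2) (cong (n / 2 ℕ.+_) (ℕ.+-identityʳ _))))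
... | suc (suc _) | ℕ.s≤s (ℕ.s≤s ()) | _

-- The counting happens in a copy of F whose equality is propositional.
record Copy (F : Field 0ℓ 0ℓ) (𝔽 : FiniteField) : Set where
  private module F = Field F
  open FiniteField 𝔽
  field
    to      : F.Carrier → K
    from    : K → F.Carrier
    to-cong : ∀ {x y} → x F.≈ y → to x ≡ to y
    to-injective : ∀ {x y} → to x ≡ to y → x F.≈ y
    to-from : ∀ i → to (from i) ≡ i
    to-+    : ∀ x y → to (x F.+ y) ≡ to x ⊕ to y
    to-*    : ∀ x y → to (x F.* y) ≡ to x ⊗ to y
    to-0    : to F.0# ≡ 𝟘
    to-1    : to F.1# ≡ 𝟙

module FinField (F : Field 0ℓ 0ℓ) (n : ℕ) (card : HasCardinality (Field.setoid F) n) where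

  private module F = Field F
  open Inverse card public using (to; from; to-cong)

  to-from : ∀ i → to (from i) ≡ i
  to-from = Inverse.strictlyInverseˡ card

  from-to : ∀ x → from (to x) F.≈ x
  from-to = Inverse.strictlyInverseʳ card

  from-injective : ∀ {i j} → from i F.≈ from j → i ≡ j
  from-injective {i} {j} eq = trans (sym (to-from i)) (trans (to-cong eq) (to-from j))

  to-injective : ∀ {x y} → to x ≡ to y → x F.≈ y
  to-injective {x} {y} eq = F.trans (F.sym (from-to x)) (F.trans (F.reflexive (cong from eq)) (from-to y))

  rawRing : RawRing 0ℓ 0ℓ
  rawRing = record
    { Carrier = Fin n
    ; _≈_     = _≡_
    ; _+_     = λ i j → to (from i F.+ from j)
    ; _*_     = λ i j → to (from i F.* from j)
    ; -_      = λ i → to (F.- from i)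
    ; 0#      = to F.0#
    ; 1#      = to F.1#
    }

  -- The ring laws on `Fin n` are pulled back along this injective homomorphism.
  from-monomorphism : IsRingMonomorphism rawRing (CommutativeRing.rawRing F.commutativeRing) from
  from-monomorphism = record
    { isRingHomomorphism = record
      { isSemiringHomomorphism = record
        { isNearSemiringHomomorphism = record
          { +-isMonoidHomomorphism = record
            { isMagmaHomomorphism = record
              { isRelHomomorphism = record { cong = λ eq → F.reflexive (cong from eq) }
              ; homo              = λ i j → from-to _
              }
            ; ε-homo = from-to _
            }
          ; *-homo = λ i j → from-to _
          }
        ; 1#-homo = from-to _
        }
      ; -‿homo = λ i → from-to _
      }
    ; injective = from-injective
    }

  finField : FiniteField
  finField = record
    { K       = Fin n
    ; _⊕_     = RawRing._+_ rawRing
    ; _⊗_     = RawRing._*_ rawRing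
    ; ⊝_      = RawRing.-_ rawRing
    ; 𝟘       = RawRing.0# rawRing
    ; 𝟙       = RawRing.1# rawRing
    ; isCommutativeRing = RingMonomorphism.isCommutativeRing from-monomorphism F.isCommutativeRing
    ; 𝟘≢𝟙     = λ eq → F.0≉1 (to-injective eq)
    ; inverse = λ i i≢0 → let y , eq = F.inverse (from i) (λ i≈0 → i≢0 (trans (sym (to-from i)) (to-cong i≈0))) in
        to y , to-cong (F.trans (F.*-congˡ (from-to y)) eq)
    ; finite  = record
      { _≟_      = Fin._≟_
      ; elements = allFin n
      ; unique   = Unique.allFin⁺ n
      ; complete = ∈-allFin
      }
    }

  open FiniteField finField

  to-+ : ∀ x y → to (x F.+ y) ≡ to x ⊕ to y
  to-+ x y = to-cong (F.sym (F.+-cong (from-to x) (from-to y)))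

  to-* : ∀ x y → to (x F.* y) ≡ to x ⊗ to y
  to-* x y = to-cong (F.sym (F.*-cong (from-to x) (from-to y)))

  copy : Copy F finField
  copy = record
    { to = to ; from = from ; to-cong = to-cong ; to-injective = to-injective
    ; to-from = to-from ; to-+ = to-+ ; to-* = to-* ; to-0 = refl ; to-1 = refl }

  -- Translation by 𝟙 permutes F, so n · 𝟙 = 𝟘; for odd n this is incompatible with 𝟙 + 𝟙 = 𝟘.
  2≢0 : ∀ k → n ≡ suc (k ℕ.+ k) → OddCharacteristic
  2≢0 k n≡ 2≡0 = 𝟘≢𝟙 (trans (sym n×𝟙≡𝟘) (trans (cong (_×′ 𝟙) n≡) odd×𝟙))
    where
    open CommutativeRing (FiniteField.commutativeRing finField) using (+-commutativeMonoid; +-monoid; +-identityʳ; +-assoc; +-group)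
    open import Algebra.Properties.Group +-group using (∙-cancelˡ)
    open Algebra.Properties.CommutativeMonoid.Sum +-commutativeMonoid using (sum; sum-permute; ∑-distrib-+; sum-replicate)
    open Algebra.Properties.Monoid.Mult +-monoid using () renaming (_×_ to _×′_)
    open IntegerCoefficients (FiniteField.commutativeRing finField) using (module Solver)
    open Solver using (solve; _:=_; _:+_; _:-_)
    open ≡-Reasoning
    n×𝟙≡𝟘 : n ×′ 𝟙 ≡ 𝟘
    n×𝟙≡𝟘 = ∙-cancelˡ (sum {n} (λ i → i)) _ _ (begin
      sum {n} (λ i → i) ⊕ n ×′ 𝟙                 ≡⟨ cong (sum {n} (λ i → i) ⊕_) (sum-replicate n) ⟨
      sum {n} (λ i → i) ⊕ sum {n} (λ _ → 𝟙)     ≡⟨ ∑-distrib-+ {n} (λ i → i) (λ _ → 𝟙) ⟨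
      sum {n} (λ i → i ⊕ 𝟙)                     ≡⟨ sum-permute {n} (λ i → i) (mk↔ₛ′ (_⊕ 𝟙) (_⊕ ⊝ 𝟙)
                                                     (λ i → solve 2 (λ i o → i :- o :+ o := i) refl i 𝟙)
                                                     (λ i → solve 2 (λ i o → i :+ o :- o := i) refl i 𝟙)) ⟨
      sum {n} (λ i → i)                         ≡⟨ +-identityʳ _ ⟨
      sum {n} (λ i → i) ⊕ 𝟘                     ∎)
    k×2 : ∀ k → (k ℕ.+ k) ×′ 𝟙 ≡ 𝟘
    k×2 zero    = refl
    k×2 (suc k) = begin
      𝟙 ⊕ (k ℕ.+ suc k) ×′ 𝟙       ≡⟨ cong (λ m → 𝟙 ⊕ m ×′ 𝟙) (ℕ.+-suc k k) ⟩
      𝟙 ⊕ (𝟙 ⊕ (k ℕ.+ k) ×′ 𝟙)     ≡⟨ +-assoc 𝟙 𝟙 _ ⟨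
      𝟙 ⊕ 𝟙 ⊕ (k ℕ.+ k) ×′ 𝟙       ≡⟨ cong₂ _⊕_ 2≡0 (k×2 k) ⟩
      𝟘 ⊕ 𝟘                       ≡⟨ +-identityʳ 𝟘 ⟩
      𝟘                           ∎
    odd×𝟙 : suc (k ℕ.+ k) ×′ 𝟙 ≡ 𝟙
    odd×𝟙 = trans (cong (𝟙 ⊕_) (k×2 k)) (+-identityʳ 𝟙)

-- Congruence in terms of finitely many motions

module Triangles (F : Field 0ℓ 0ℓ) (𝔽 : FiniteField) (copy : Copy F 𝔽)
  (2≢0 : FiniteField.OddCharacteristic 𝔽) where

  private module F = Field F
  open Plane F
  private module Pl = LeftModule plane
  open Copy copy
  open Isometries 𝔽 2≢0

  coords : Point → Pt
  coords (x , y) = to x , to y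

  point : Pt → Point
  point (i , j) = from i , from j

  coords-cong : ∀ {u v} → u ≈ᴹ v → coords u ≡ coords v
  coords-cong (p , q) = cong₂ _,_ (to-cong p) (to-cong q)

  coords-injective : ∀ {u v} → coords u ≡ coords v → u ≈ᴹ v
  coords-injective eq = to-injective (cong proj₁ eq) , to-injective (cong proj₂ eq)

  coords-point : ∀ v → coords (point v) ≡ v
  coords-point (i , j) = cong₂ _,_ (to-from i) (to-from j)

  coords-+ : ∀ u v → coords (u +ᴹ v) ≡ coords u ⊞ coords v
  coords-+ (u₁ , u₂) (v₁ , v₂) = cong₂ _,_ (to-+ u₁ v₁) (to-+ u₂ v₂)

  coords-* : ∀ c u → coords (c *ₗ u) ≡ to c · coords u
  coords-* c (u₁ , u₂) = cong₂ _,_ (to-* c u₁) (to-* c u₂)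

  coords-form : ∀ u → to (form u) ≡ dot (coords u) (coords u)
  coords-form (x , y) = trans (to-+ (x F.* x) (y F.* y)) (cong₂ _⊕_ (to-* x x) (to-* y y))

  module _ {w : Pt} {σ : K} (|w| : OnCircle w) (σσ≡1 : σ ⊗ σ ≡ 𝟙) where

    orthMap : Point → Point
    orthMap u = point (orth w σ (coords u))

    coords-orthMap : ∀ u → coords (orthMap u) ≡ orth w σ (coords u)
    coords-orthMap u = coords-point (orth w σ (coords u))

    orthMap-+ : ∀ u v → orthMap (u +ᴹ v) ≈ᴹ (orthMap u +ᴹ orthMap v)
    orthMap-+ u v = coords-injective (trans (coords-orthMap (u +ᴹ v))
      (trans (cong (orth w σ) (coords-+ u v)) (trans (orth-⊞ w σ (coords u) (coords v))
      (trans (sym (cong₂ _⊞_ (coords-orthMap u) (coords-orthMap v))) (sym (coords-+ (orthMap u) (orthMap v)))))))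

    orthMap-* : ∀ c u → orthMap (c *ₗ u) ≈ᴹ (c *ₗ orthMap u)
    orthMap-* c u = coords-injective (trans (coords-orthMap (c *ₗ u))
      (trans (cong (orth w σ) (coords-* c u)) (trans (orth-· w σ (to c) (coords u))
      (trans (cong (to c ·_) (sym (coords-orthMap u))) (sym (coords-* c (orthMap u)))))))

    orthMap-cong : ∀ {u v} → u ≈ᴹ v → orthMap u ≈ᴹ orthMap v
    orthMap-cong u≈v = Pl.≈ᴹ-reflexive (cong (λ p → point (orth w σ p)) (coords-cong u≈v))

    isometry : O₂
    isometry = record
      { map    = orthMap
      ; linear = record
        { isLeftModuleMonomorphism = record
          { isLeftModuleHomomorphism = record
            { +ᴹ-isGroupHomomorphism = record
              { isMonoidHomomorphism = record
                { isMagmaHomomorphism = record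
                  { isRelHomomorphism = record { cong = orthMap-cong }
                  ; homo              = orthMap-+
                  }
                ; ε-homo = ε-homo
                }
              ; ⁻¹-homo = λ u → uniqueʳ (orthMap u) (orthMap (-ᴹ u))
                  (≈ᴹ-trans (≈ᴹ-sym (orthMap-+ u (-ᴹ u))) (≈ᴹ-trans (orthMap-cong (Pl.-ᴹ‿inverseʳ u)) ε-homo))
              }
            ; *ₗ-homo = orthMap-*
            }
          ; injective = λ {u} {v} eq → coords-injective (trans (sym (orth⁻¹-orth |w| σσ≡1 (coords u)))
              (trans (cong (orth⁻¹ w σ) (trans (sym (coords-orthMap u)) (trans (coords-cong eq) (coords-orthMap v))))
                     (orth⁻¹-orth |w| σσ≡1 (coords v))))
          }
        ; surjective = λ v → point (orth⁻¹ w σ (coords v)) , λ {u} u≈ → coords-injective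
            (trans (coords-orthMap u) (trans (cong (orth w σ) (trans (coords-cong u≈) (coords-point _))) (orth-orth⁻¹ |w| σσ≡1 (coords v))))
        }
      ; preserves = λ u → to-injective (trans (coords-form (orthMap u))
          (trans (cong₂ dot (coords-orthMap u) (coords-orthMap u)) (trans (orth-dot |w| σσ≡1 (coords u)) (sym (coords-form u)))))
      }
      where
      open import Algebra.Properties.Group Pl.+ᴹ-group using (identityʳ-unique; inverseʳ-unique)
      ε-homo : orthMap 0ᴹ ≈ᴹ 0ᴹ
      ε-homo = identityʳ-unique (orthMap 0ᴹ) (orthMap 0ᴹ)
        (≈ᴹ-trans (≈ᴹ-sym (orthMap-+ 0ᴹ 0ᴹ)) (orthMap-cong (Pl.+ᴹ-identityʳ 0ᴹ)))
      uniqueʳ : ∀ u v → (u +ᴹ v) ≈ᴹ 0ᴹ → v ≈ᴹ (-ᴹ u)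
      uniqueʳ u v eq = inverseʳ-unique u v eq

  module _ (θ : O₂) where
    open O₂ θ renaming (map to θmap)

    e₁ e₂ : Point
    e₁ = F.1# , F.0#
    e₂ = F.0# , F.1#

    image : Point → Pt
    image u = coords (θmap u)

    coords-e₁ : coords e₁ ≡ (𝟙 , 𝟘)
    coords-e₁ = cong₂ _,_ to-1 to-0

    coords-e₂ : coords e₂ ≡ (𝟘 , 𝟙)
    coords-e₂ = cong₂ _,_ to-0 to-1

    coords-image : ∀ u → image u ≡ proj₁ (coords u) · image e₁ ⊞ proj₂ (coords u) · image e₂
    coords-image u@(x , y) = trans (coords-cong (⟦⟧-cong split)) (trans (coords-cong (+ᴹ-homo (x *ₗ e₁) (y *ₗ e₂)))
      (trans (coords-+ (θmap (x *ₗ e₁)) (θmap (y *ₗ e₂))) (cong₂ _⊞_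
        (trans (coords-cong (*ₗ-homo x e₁)) (coords-* x (θmap e₁)))
        (trans (coords-cong (*ₗ-homo y e₂)) (coords-* y (θmap e₂))))))
      where
      split : u ≈ᴹ ((x *ₗ e₁) +ᴹ (y *ₗ e₂))
      split = F.sym (F.trans (F.+-cong (F.*-identityʳ x) (F.zeroʳ y)) (F.+-identityʳ x))
            , F.sym (F.trans (F.+-cong (F.zeroʳ x) (F.*-identityʳ y)) (F.+-identityˡ y))

    image-dot : ∀ u → dot (image u) (image u) ≡ dot (coords u) (coords u)
    image-dot u = trans (sym (coords-form (θmap u))) (trans (to-cong (preserves u)) (coords-form u))

    |image-e₁| : dot (image e₁) (image e₁) ≡ 𝟙
    |image-e₁| = trans (image-dot e₁) (trans (cong₂ dot coords-e₁ coords-e₁) dot-e₁)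

    |image-e₂| : dot (image e₂) (image e₂) ≡ 𝟙
    |image-e₂| = trans (image-dot e₂) (trans (cong₂ dot coords-e₂ coords-e₂) dot-e₂)

    |image-e₁+e₂| : dot (image e₁ ⊞ image e₂) (image e₁ ⊞ image e₂) ≡ 𝟙 ⊕ 𝟙
    |image-e₁+e₂| = trans (cong₂ dot image-+ image-+) (trans (image-dot (e₁ +ᴹ e₂)) (trans (cong₂ dot coords-e₁+e₂ coords-e₁+e₂) dot-e₁+e₂))
      where
      image-+ : image e₁ ⊞ image e₂ ≡ image (e₁ +ᴹ e₂)
      image-+ = sym (trans (coords-cong (+ᴹ-homo e₁ e₂)) (coords-+ (θmap e₁) (θmap e₂)))
      coords-e₁+e₂ : coords (e₁ +ᴹ e₂) ≡ (𝟙 , 𝟘) ⊞ (𝟘 , 𝟙)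
      coords-e₁+e₂ = trans (coords-+ e₁ e₂) (cong₂ _⊞_ coords-e₁ coords-e₂)

    -- A linear map is determined by the images of the basis vectors. That of `e₂` serves as w; by
    -- `orthonormal` that of `e₁` is w turned by a right angle, up to the sign σ.
    image-orth : ∃ λ σ → σ ∈ signs × image e₂ ∈ circle × (∀ u → image u ≡ orth (image e₂) σ (coords u))
    image-orth = conclude (orthonormal (image e₁) (image e₂) |image-e₁| |image-e₂| |image-e₁+e₂|)
      where
      conclude : (∃ λ σ → σ ∈ signs × image e₁ ≡ rotate σ (image e₂)) →
                 ∃ λ σ → σ ∈ signs × image e₂ ∈ circle × (∀ u → image u ≡ orth (image e₂) σ (coords u))
      conclude (σ , σ∈ , eq) = σ , σ∈ , ∈-circle |image-e₂| ,
        λ u → trans (coords-image u) (cong (λ p → proj₁ (coords u) · p ⊞ proj₂ (coords u) · image e₂) eq)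

  Motion : Set
  Motion = Pt × K × Pt

  motions : List Motion
  motions = cartesianProduct circle (cartesianProduct signs pts)

  Moves : Motion → Triangle → Triangle → Set
  Moves (w , σ , z) x y = ∀ i → move w σ z (coords (x i)) ≡ coords (y i)

  congruent⇒moves : ∀ {x y} → Congruent x y → ∃ λ g → g ∈ motions × Moves g x y
  congruent⇒moves {x} {y} (θ , z , eq) = conclude (image-orth θ)
    where
    w : Pt
    w = image θ (e₂ θ)
    conclude : (∃ λ σ → σ ∈ signs × w ∈ circle × (∀ u → image θ u ≡ orth w σ (coords u))) → ∃ λ g → g ∈ motions × Moves g x y
    conclude (σ , σ∈ , w∈ , im) = (w , σ , coords z) ,
      ∈-cartesianProduct⁺ w∈ (∈-cartesianProduct⁺ σ∈ (Finite.complete finitePt (coords z))) ,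
      λ i → trans (move-orth w σ (coords z) (coords (x i))) (trans (cong (coords z ⊞_) (sym (im (x i))))
        (trans (sym (coords-+ z (O₂.map θ (x i)))) (coords-cong (eq i))))

  moves⇒congruent : ∀ {x y g} → g ∈ motions → Moves g x y → Congruent x y
  moves⇒congruent {x} {y} {w , σ , z} g∈ mv = isometry |w| σσ≡1 , point z ,
    λ i → coords-injective (trans (coords-+ (point z) (orthMap |w| σσ≡1 (x i)))
      (trans (cong₂ _⊞_ (coords-point z) (coords-orthMap |w| σσ≡1 (x i))) (trans (sym (move-orth w σ z (coords (x i)))) (mv i))))
    where
    |w| : OnCircle w
    |w| = proj₂ (∈-filter⁻ onCircle? {xs = pts} (proj₁ (∈-cartesianProduct⁻ circle (cartesianProduct signs pts) g∈)))
    σσ≡1 : σ ⊗ σ ≡ 𝟙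
    σσ≡1 = sign-square (proj₁ (∈-cartesianProduct⁻ signs pts (proj₂ (∈-cartesianProduct⁻ circle (cartesianProduct signs pts) g∈))))

  -- The orthogonal maps are functions and cannot be searched, but congruence amounts to the
  -- existence of an entry of `motions` carrying one triangle to the other. This decidability allows
  -- representatives, and with them an exact number of classes, to be chosen.
  congruent? : ∀ x y → Dec (Congruent x y)
  congruent? x y = Dec.map′
    (λ any → let g , g∈ , mv = find any in moves⇒congruent g∈ mv)
    (λ x≅y → let g , g∈ , mv = congruent⇒moves x≅y in lose g∈ mv)
    (Any.any? (λ (w , σ , z) → Fin.all? λ i → Finite._≟_ finitePt (move w σ z (coords (x i))) (coords (y i))) motions)

-- Enumerating the sets and their triangles

module Elements (F : Field 0ℓ 0ℓ) (𝔽 : FiniteField) (copy : Copy F 𝔽) (A : Subset (Field.setoid F)) (n : ℕ) (card : ∣ A ∣≡ n) where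

  open Copy copy
  open Subset A
  private module card = Inverse card

  element : Fin n → Field.Carrier F
  element i = proj₁ (card.from i)

  elements : List (FiniteField.K 𝔽)
  elements = map (λ i → to (element i)) (allFin n)

  elements-unique : Unique elements
  elements-unique = Unique.map⁺ (λ {i} {j} eq →
    trans (sym (card.strictlyInverseˡ i)) (trans (card.to-cong {card.from i} {card.from j} (to-injective eq)) (card.strictlyInverseˡ j)))
    (Unique.allFin⁺ n)

  elements-length : length elements ≡ n
  elements-length = trans (List.length-map (λ i → to (element i)) (allFin n)) (List.length-tabulate (λ i → i))

  element∈ : ∀ i → member (element i)
  element∈ i = proj₂ (card.from i)

  element-surjective : ∀ {x} → member x → ∃ λ i → Field._≈_ F (element i) x
  element-surjective {x} x∈ = card.to (x , x∈) , card.strictlyInverseʳ (x , x∈)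

module Counting (F : Field 0ℓ 0ℓ) (𝔽 : FiniteField) (copy : Copy F 𝔽)
  (2≢0 : FiniteField.OddCharacteristic 𝔽)
  (A B : Subset (Field.setoid F)) (#A #B : ℕ) (cardA : ∣ A ∣≡ #A) (cardB : ∣ B ∣≡ #B) where

  open Plane F
  open Copy copy
  open Triangles F 𝔽 copy 2≢0
  module A = Elements F 𝔽 copy A #A cardA
  module B = Elements F 𝔽 copy B #B cardB
  open Moments 𝔽 2≢0 A.elements B.elements A.elements-unique B.elements-unique public
  open Finite finitePt using (δ; 0≤δ; δ-refl)

  -- Indices rather than points, since an index carries its proofs of membership in A and B;
  -- `∑-vertices` returns to coordinates.
  Vertex : Set
  Vertex = Fin #A × Fin #B

  vertices : List Vertex
  vertices = cartesianProduct (allFin #A) (allFin #B)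

  vertex : Vertex → Point
  vertex (i , j) = A.element i , B.element j

  ∑-vertices : ∀ f → (∑[ s ← vertices ] f (coords (vertex s))) ≡ ∑ 𝐄 f
  ∑-vertices f = trans (∑-cartesianProduct (allFin #A) (allFin #B) (λ s → f (coords (vertex s))))
    (sym (trans (∑-cartesianProduct A.elements B.elements f)
      (trans (∑-map (λ i → to (A.element i)) (allFin #A) (λ x → ∑[ y ← B.elements ] f (x , y)))
        (∑-cong (allFin #A) λ i → ∑-map (λ j → to (B.element j)) (allFin #B) (λ y → f (to (A.element i) , y))))))

  J : Set
  J = Vertex × Vertex × Vertex

  js : List J
  js = cartesianProduct vertices (cartesianProduct vertices vertices)

  triangle : J → Triangle
  triangle (s , t , u) zero             = vertex s
  triangle (s , t , u) (suc zero)       = vertex t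
  triangle (s , t , u) (suc (suc zero)) = vertex u

  classes : Setoid 0ℓ 0ℓ
  classes = On.setoid {B = Σ Triangle (Subset.member (determinedBy (product A B)))} congruenceClasses proj₁

  determined : J → Setoid.Carrier classes
  determined j = triangle j , triangle j , vertices∈ , congruent-refl
    where
    vertex∈ : ∀ s → Subset.member (product A B) (vertex s)
    vertex∈ (i , k) = A.element∈ i , B.element∈ k
    vertices∈ : ∀ i → Subset.member (product A B) (triangle j i)
    vertices∈ zero             = vertex∈ (proj₁ j)
    vertices∈ (suc zero)       = vertex∈ (proj₁ (proj₂ j))
    vertices∈ (suc (suc zero)) = vertex∈ (proj₂ (proj₂ j))

  determined-surjective : ∀ (x : Setoid.Carrier classes) → ∃ λ j → j ∈ js × Congruent (proj₁ x) (triangle j)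
  determined-surjective (x , t , t∈ , t≅x) = j ,
    ∈-cartesianProduct⁺ (all-vertices (proj₁ j)) (∈-cartesianProduct⁺ (all-vertices (proj₁ (proj₂ j))) (all-vertices (proj₂ (proj₂ j)))) ,
    congruent-trans (congruent-sym t≅x) (idO , 0ᴹ , λ i → ≈ᴹ-trans (+ᴹ-identityˡ (t i)) (≈ᴹ-sym (t≈j i)))
    where
    all-vertices : ∀ s → s ∈ vertices
    all-vertices (i , k) = ∈-cartesianProduct⁺ (∈-allFin i) (∈-allFin k)
    vertex-of : ∀ i → ∃ λ s → vertex s ≈ᴹ t i
    vertex-of i = let k , k≈ = A.element-surjective (proj₁ (t∈ i)); l , l≈ = B.element-surjective (proj₂ (t∈ i)) in (k , l) , k≈ , l≈
    j : J
    j = proj₁ (vertex-of zero) , proj₁ (vertex-of (suc zero)) , proj₁ (vertex-of (suc (suc zero)))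
    t≈j : ∀ i → triangle j i ≈ᴹ t i
    t≈j zero             = proj₂ (vertex-of zero)
    t≈j (suc zero)       = proj₂ (vertex-of (suc zero))
    t≈j (suc (suc zero)) = proj₂ (vertex-of (suc (suc zero)))

  open Classes classes js determined (λ i j → congruent? (triangle i) (triangle j)) determined-surjective

  hit : Motion → Vertex → Vertex → ℤ
  hit (w , σ , z) s t = δ (coords (vertex t)) (move w σ z (coords (vertex s)))

  0≤hit : ∀ g s t → 0ℤ ≤ hit g s t
  0≤hit (w , σ , z) s t = 0≤δ (coords (vertex t)) (move w σ z (coords (vertex s)))

  -- The indicator that g carries one triangle to the other, written as a product over the vertices.
  -- They range independently over all ordered triples, degenerate ones included, so the sum over
  -- pairs of triangles factors into ν³.
  hits³ : Motion → J → J → ℤ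
  hits³ g (s , t , u) (s′ , t′ , u′) = hit g s s′ * (hit g t t′ * hit g u u′)

  0≤hits³ : ∀ g i j → 0ℤ ≤ hits³ g i j
  0≤hits³ g (s , t , u) (s′ , t′ , u′) = 0≤-* (0≤hit g s s′) (0≤-* (0≤hit g t t′) (0≤hit g u u′))

  moves⇒hits³ : ∀ g i j → Moves g (triangle i) (triangle j) → hits³ g i j ≡ 1ℤ
  moves⇒hits³ g i j mv = cong₂ ℤ._*_ (δ-refl (sym (mv zero)))
    (cong₂ ℤ._*_ (δ-refl (sym (mv (suc zero)))) (δ-refl (sym (mv (suc (suc zero))))))

  congruences : J → J → ℤ
  congruences i j = ∑[ g ← motions ] hits³ g i j

  1≤congruences : ∀ i j → Congruent (triangle i) (triangle j) → 1ℤ ≤ congruences i j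
  1≤congruences i j i≅j = let g , g∈ , mv = congruent⇒moves i≅j in
    subst (ℤ._≤ congruences i j) (moves⇒hits³ g i j mv) (term≤∑ {f = λ g → hits³ g i j} (λ g → 0≤hits³ g i j) g∈)

  ∑-hit : ∀ w σ z → (∑[ s ← vertices ] ∑[ t ← vertices ] hit (w , σ , z) s t) ≡ ν w σ z
  ∑-hit w σ z = trans (∑-cong vertices λ s → ∑-vertices (λ e → δ e (move w σ z (coords (vertex s)))))
    (∑-vertices (λ e → χ (move w σ z e)))

  ∑-hits³ : ∀ w σ z → (∑[ i ← js ] ∑[ j ← js ] hits³ (w , σ , z) i j) ≡ ν w σ z * ν w σ z * ν w σ z
  ∑-hits³ w σ z = trans
    (∑-cong js λ (s , t , u) → trans
      (∑-×-product vertices (cartesianProduct vertices vertices) (hit g s) (λ (t′ , u′) → hit g t t′ * hit g u u′))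
      (cong (∑ vertices (hit g s) ℤ.*_) (∑-×-product vertices vertices (hit g t) (hit g u))))
    (trans (∑-×-product vertices (cartesianProduct vertices vertices) row (λ (t , u) → row t * row u))
      (trans (cong (∑ vertices row ℤ.*_) (∑-×-product vertices vertices row row))
        (trans (cong (λ r → r * (r * r)) (∑-hit w σ z)) (sym (ℤ.*-assoc (ν w σ z) (ν w σ z) (ν w σ z))))))
    where
    g : Motion
    g = w , σ , z
    row : Vertex → ℤ
    row s = ∑ vertices (hit g s)

  ∑-congruences : (∑[ i ← js ] ∑[ j ← js ] congruences i j) ≡ third-moment
  ∑-congruences = trans
    (trans (∑-cong js λ i → ∑-swap js motions (λ j g → hits³ g i j)) (∑-swap js motions (λ i g → ∑[ j ← js ] hits³ g i j)))
    (trans (∑-cartesianProduct circle (cartesianProduct signs pts) (λ g → ∑[ i ← js ] ∑[ j ← js ] hits³ g i j))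
      (∑-cong circle λ w → trans (∑-cartesianProduct signs pts (λ (σ , z) → ∑[ i ← js ] ∑[ j ← js ] hits³ (w , σ , z) i j))
        (∑-cong signs λ σ → ∑-cong pts λ z → ∑-hits³ w σ z)))

  |vertices| : + length vertices ≡ a * b
  |vertices| = trans (sym (∑-1 vertices)) (trans (∑-vertices (λ _ → 1ℤ)) (trans (∑-1 𝐄) |𝐄|))

  |js| : + length js ≡ a * b * (a * b * (a * b))
  |js| = trans (length-cartesianProduct vertices (cartesianProduct vertices vertices))
    (cong₂ ℤ._*_ |vertices| (trans (length-cartesianProduct vertices vertices) (cong₂ ℤ._*_ |vertices| |vertices|)))

  classCount : ℕ
  classCount = length reps

  classCount-cardinality : ∣ determinedBy (product A B) ∣≡ classCount
  classCount-cardinality = hasCardinality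

  triangles-bound : + length js * + length js ≤ + classCount * third-moment
  triangles-bound = subst (λ s → + length js * + length js ≤ + classCount * s) ∑-congruences
    (count-classes congruences (λ i j → ∑-nonNeg motions λ g → 0≤hits³ g i j) 1≤congruences)

-- From the moment bound to the number of classes

pos*pos : ∀ i j .{{_ : ℤ.Positive i}} .{{_ : ℤ.Positive j}} → ℤ.Positive (i * j)
pos*pos +[1+ _ ] +[1+ _ ] = _

-- After multiplication by q⁶ everything is compared with q³ |E|⁶, where |E| is `e` and |E|⁶ is
-- `m * m * m`. The hypothesis on q⁴ bounds s q⁴ by 2 |E|⁶, since `s` times a² b³ is a⁶ b⁶. Thus 64
-- = 32 + 16 · 2.
class-bound : ∀ {q a b N T} .{{_ : ℤ.Positive q}} → 0ℤ ≤ a → 0ℤ ≤ b → 0ℤ ≤ N →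
  q * q * q * q ≤ + 2 * (a * a * (b * b * b)) →
  let e = a * b; m = e * e; s = e * (a * a) * (a * b * b) in
  e * m * (e * m) ≤ N * T →
  q * q * q * q * q * q * T ℤ.≤
    + 32 * (q * q * q * (m * m * m)) + + 16 * (q * q * (q * q * q * q * q) * s) →
  q * q * q ≤ + 64 * N
class-bound {q} {a} {b} {N} {T} 0≤a 0≤b 0≤N q⁴≤ E≤NT q⁶T≤ =
  ℤ.*-cancelʳ-≤-pos _ _ (q³ * E) {{pos*pos q³ E {{q³-pos}} {{E-pos}}}} (begin
    q³ * (q³ * E)
      ≡⟨ lem₁ q a b ⟩
    q * q * q * q * q * q * (e * m * (e * m))
      ≤⟨ *-monoˡ-≤ 0≤q⁶ E≤NT ⟩
    q * q * q * q * q * q * (N * T)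
      ≡⟨ lem₂ (q * q * q * q * q * q) N T ⟩
    N * (q * q * q * q * q * q * T)
      ≤⟨ *-monoˡ-≤ 0≤N q⁶T≤ ⟩
    N * (+ 32 * (q³ * E) + + 16 * (q * q * (q * q * q * q * q) * s))
      ≡⟨ cong (λ t → N * (+ 32 * (q³ * E) + + 16 * t)) (lem₃ q s) ⟩
    N * (+ 32 * (q³ * E) + + 16 * (q³ * s * (q * q * q * q)))
      ≤⟨ *-monoˡ-≤ 0≤N (ℤ.+-monoʳ-≤ (+ 32 * (q³ * E)) (*-monoˡ-≤ (0≤-+n {16}) (*-monoˡ-≤ (0≤-* 0≤q³ 0≤s) q⁴≤))) ⟩
    N * (+ 32 * (q³ * E) + + 16 * (q³ * s * (+ 2 * (a * a * (b * b * b)))))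
      ≡⟨ cong (λ t → N * (+ 32 * (q³ * E) + + 16 * t)) (lem₄ q³ a b) ⟩
    N * (+ 32 * (q³ * E) + + 16 * (+ 2 * (q³ * E)))
      ≡⟨ lem₅ N (q³ * E) ⟩
    + 64 * N * (q³ * E) ∎)
  where
  open ℤ.≤-Reasoning
  q³ e m s E : ℤ
  q³ = q * q * q
  e = a * b
  m = e * e
  s = e * (a * a) * (a * b * b)
  E = m * m * m
  0≤q : 0ℤ ≤ q
  0≤q = ℤ.<⇒≤ (ℤ.positive⁻¹ q)
  0≤q³ : 0ℤ ≤ q³
  0≤q³ = 0≤-* (0≤-² q) 0≤q
  0≤q⁶ : 0ℤ ≤ q * q * q * q * q * q
  0≤q⁶ = 0≤-* (0≤-* (0≤-* 0≤q³ 0≤q) 0≤q) 0≤q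
  0≤s : 0ℤ ≤ s
  0≤s = 0≤-* (0≤-* (0≤-* 0≤a 0≤b) (0≤-² a)) (0≤-* (0≤-* 0≤a 0≤b) 0≤b)
  q³-pos : ℤ.Positive q³
  q³-pos = pos*pos (q * q) q {{pos*pos q q}}
  q⁴>0 : 0ℤ ℤ.< q * q * q * q
  q⁴>0 = ℤ.positive⁻¹ _ {{pos*pos q³ q {{q³-pos}}}}
  -- |E|⁶ can be cancelled only if both sets are nonempty; an empty one would make the upper bound
  -- for the positive number q⁴ vanish.
  a-pos : ℤ.Positive a
  a-pos = ℤ.positive (ℤ.≤∧≢⇒< 0≤a λ 0≡a → ℤ.<⇒≱ q⁴>0
    (subst (q * q * q * q ℤ.≤_) (trans (cong (λ a → + 2 * (a * a * (b * b * b))) (sym 0≡a)) (zero₁ (b * b * b))) q⁴≤))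
    where
    zero₁ : ∀ b → + 2 * (0ℤ * 0ℤ * b) ≡ 0ℤ
    zero₁ = solve-∀
  b-pos : ℤ.Positive b
  b-pos = ℤ.positive (ℤ.≤∧≢⇒< 0≤b λ 0≡b → ℤ.<⇒≱ q⁴>0
    (subst (q * q * q * q ℤ.≤_) (trans (cong (λ b → + 2 * (a * a * (b * b * b))) (sym 0≡b)) (zero₂ (a * a))) q⁴≤))
    where
    zero₂ : ∀ a → + 2 * (a * (0ℤ * 0ℤ * 0ℤ)) ≡ 0ℤ
    zero₂ = solve-∀
  e-pos : ℤ.Positive e
  e-pos = pos*pos a b {{a-pos}} {{b-pos}}
  m-pos : ℤ.Positive m
  m-pos = pos*pos e e {{e-pos}} {{e-pos}}
  E-pos : ℤ.Positive E
  E-pos = pos*pos (m * m) m {{pos*pos m m {{m-pos}} {{m-pos}}}} {{m-pos}}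
  lem₁′ : ∀ q e → q * (q * (e * e * (e * e) * (e * e))) ≡ q * q * (e * (e * e) * (e * (e * e)))
  lem₁′ = solve-∀
  lem₁″ : ∀ q → q * q * q * (q * q * q) ≡ q * q * q * q * q * q
  lem₁″ = solve-∀
  lem₁ : ∀ q a b → let q³ = q * q * q; e = a * b; m = e * e in
    q³ * (q³ * (m * m * m)) ≡ q * q * q * q * q * q * (e * m * (e * m))
  lem₁ q a b = trans (lem₁′ (q * q * q) (a * b)) (cong (ℤ._* _) (lem₁″ q))
  lem₂ : ∀ x n t → x * (n * t) ≡ n * (x * t)
  lem₂ = solve-∀
  lem₃ : ∀ q s → q * q * (q * q * q * q * q) * s ≡ q * q * q * s * (q * q * q * q)
  lem₃ = solve-∀
  lem₄ : ∀ x a b → x * (a * b * (a * a) * (a * b * b)) * (+ 2 * (a * a * (b * b * b)))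
    ≡ + 2 * (x * (a * b * (a * b) * (a * b * (a * b)) * (a * b * (a * b))))
  lem₄ = solve-∀
  lem₅ : ∀ n x → n * (+ 32 * x + + 16 * (+ 2 * x)) ≡ + 64 * n * x
  lem₅ = solve-∀

pos-^2 : ∀ n → + (n ℕ.^ 2) ≡ + n * + n
pos-^2 n = trans (cong +_ (cong (n ℕ.*_) (ℕ.*-identityʳ n))) (ℤ.pos-* n n)

pos-^3 : ∀ n → + (n ℕ.^ 3) ≡ + n * + n * + n
pos-^3 n = trans (ℤ.pos-* n (n ℕ.^ 2)) (trans (cong (+ n ℤ.*_) (pos-^2 n)) (sym (ℤ.*-assoc (+ n) (+ n) (+ n))))

pos-^4 : ∀ n → + (n ℕ.^ 4) ≡ + n * + n * + n * + n
pos-^4 n = trans (ℤ.pos-* n (n ℕ.^ 3)) (trans (cong (+ n ℤ.*_) (pos-^3 n)) (ℤ.*-comm (+ n) (+ n * + n * + n)))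

triangle-classes : (F : Field 0ℓ 0ℓ) (𝔽 : FiniteField) (copy : Copy F 𝔽) (2≢0 : FiniteField.OddCharacteristic 𝔽) →
  (A B : Subset (Field.setoid F)) (a b : ℕ) → ∣ A ∣≡ a → ∣ B ∣≡ b →
  ∀ q → length (Finite.elements (FiniteField.finite 𝔽)) ≡ q → q ℕ.^ 4 ℕ.≤ 2 ℕ.* (a ℕ.^ 2 ℕ.* b ℕ.^ 3) →
  ∃ λ N → ∣ Plane.determinedBy F (Plane.product F A B) ∣≡ N × + (q ℕ.^ 3) ≤ + 64 * + N
triangle-classes F 𝔽 copy 2≢0 A B #A #B cardA cardB _ refl q⁴≤ = classCount , classCount-cardinality ,
  subst (ℤ._≤ + 64 * + classCount) (sym (pos-^3 (length κ)))
    (class-bound {q} {a} {b} {+ classCount} {third-moment} 0≤a 0≤b 0≤-+n q⁴≤′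
      (subst (λ t → t * t ≤ + classCount * third-moment) |js| triangles-bound) third-moment-bound)
  where
  open Counting F 𝔽 copy 2≢0 A B #A #B cardA cardB
  q⁴≤′ : q * q * q * q ≤ + 2 * (a * a * (b * b * b))
  q⁴≤′ = ≡.subst₂ ℤ._≤_ (pos-^4 (length κ))
    (trans (ℤ.pos-* 2 (#A ℕ.^ 2 ℕ.* #B ℕ.^ 3)) (cong (+ 2 ℤ.*_) (trans (ℤ.pos-* (#A ℕ.^ 2) (#B ℕ.^ 3))
      (trans (cong₂ ℤ._*_ (pos-^2 #A) (pos-^3 #B)) (sym (cong₂ (λ x y → + x * + x * (+ y * + y * + y)) A.elements-length B.elements-length))))))
    (ℤ.+≤+ q⁴≤)

1/64-bound : ∀ m N → + m ≤ + 64 * + N → (+ 1 ℚ./ 64) ℚ.* (+ m ℚ./ 1) ℚ.≤ + N ℚ./ 1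
1/64-bound m N m≤64N = ℚ.toℚᵘ-cancel-≤ (ℚᵘ.≤-respˡ-≃ (ℚᵘ.≃-sym (ℚᵘ.≃-trans (ℚ.toℚᵘ-homo-* (+ 1 ℚ./ 64) (+ m ℚ./ 1))
    (ℚᵘ.*-congˡ {mkℚᵘ (+ 1) 63} (ℚ.toℚᵘ-fromℚᵘ (mkℚᵘ (+ m) 0)))))
  (ℚᵘ.≤-respʳ-≃ (ℚᵘ.≃-sym (ℚ.toℚᵘ-fromℚᵘ (mkℚᵘ (+ N) 0)))
    (*≤* (≡.subst₂ ℤ._≤_ (lem₁ (+ m)) (ℤ.*-comm (+ 64) (+ N)) m≤64N))))
  where
  lem₁ : ∀ m → m ≡ + 1 * m * + 1
  lem₁ = solve-∀

theorem1p6 : ∃ λ (c : ℚ) → 0ℚ ℚ.< c ×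
    (∀ (p r q : ℕ) → Prime p → p ≢ 2 → 1 ℕ.≤ r → q ≡ p ℕ.^ r →
    (F : Field 0ℓ 0ℓ) → HasCardinality (Field.setoid F) q →
    (A B : Subset (Field.setoid F)) (a b : ℕ) → ∣ A ∣≡ a → ∣ B ∣≡ b →
    (ε : ℝ) → NonNegative ε →
    q ^ℝ (½ +ℝ ε) ≤ a →
    q ^ℝ (1ℚ +ℝ -ℝ ((+ 2 ℚ./ 3) *ℝ ε)) ≤ b →
    ∃ λ (N : ℕ) → (∣ Plane.determinedBy F (Plane.product F A B) ∣≡ N) ×
    (c ℚ.* (+ (q ℕ.^ 3) ℚ./ 1) ℚ.≤ + N ℚ./ 1))
-- The reciprocal of the constant in `class-bound`.
theorem1p6 = + 1 ℚ./ 64 , ℚ.positive⁻¹ (+ 1 ℚ./ 64) ,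
  λ p r q prime p≢2 _ q≡pʳ F card A B a b cardA cardB ε _ q^≤a q^≤b →
  let open FinField F q card
      1≤q = subst (1 ℕ.≤_) (sym q≡pʳ) (ℕ.m^n>0 p {{prime⇒nonZero prime}} r)
      k , q≡1+2k = odd⇒1+2k q (subst (λ n → ¬ 2 ∣ n) (sym q≡pʳ) (odd-prime-power p r prime p≢2))
      N , cardN , q³≤64N = triangle-classes F finField copy (2≢0 k q≡1+2k) A B a b cardA cardB
        q (List.length-tabulate (λ i → i)) (exponents-bound q a b ε 1≤q q^≤a q^≤b)
  in N , cardN , 1/64-bound (q ℕ.^ 3) N q³≤64N
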